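{- Let $\rho,\gamma\ge1$. A (polynomial-time) $(\rho,\gamma)$-tree approximation algorithm for the path-orienteering problem can be used to obtain an $O(\rho\gamma)$-approximation algorithm for the minimum latency problem (ML). Likewise, a (polynomial-time) $(\rho,\gamma)$-tree approximation algorithm for the group orienteering problem can be used to obtain an $O(\rho\gamma)$-approximation algorithm for the minimum group latency problem (MGL).
   Context: ML: given the complete graph on $\mathcal D\cup\{r\}$ with metric edge weights, find a path starting at $r$ visiting all nodes of $\mathcal D$ that minimizes the sum over $j\in\mathcal D$ of the length of the path from $r$ to $j$. MGL: given a metric $d$ on $\mathcal F\cup\{r\}$ and groups $G_1,\dots,G_m\subseteq\mathcal F$, find a path starting at $r$ minimizing the sum over $j$ of the length of the path from $r$ to the first visited node of $G_j$. Path-orienteering: given metric edge lengths, a root $r$, nonnegative node rewards and a length bound $B$, find a simple path starting at $r$ of length at most $B$ gathering maximum total reward. Group orienteering: the same with a nonnegative reward for each group $G_j$, collected if the path contains at least one node of $G_j$. A $(\rho,\gamma)$-tree approximation algorithm for either problem is an algorithm that always returns a tree containing $r$, of total length at most $\gamma B$, gathering reward at least $1/\rho$ times the optimum reward (the optimum being over paths from $r$ of length at most $B$). The approximation algorithms for ML and MGL may be randomized, with the guarantee holding in expectation.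
   Formalization: The metric edge lengths, node and group rewards, the length bound B, and the parameters ρ and γ are taken to be rational numbers rather than real numbers. -}

module Defs where

open import Data.Bool using (Bool; true; false; if_then_else_)
open import Data.Fin using (Fin; zero; suc; toℕ)
open import Data.Fin.Properties using () renaming (_≟_ to _≟ᶠ_)
open import Data.Fin.Subset using (Subset; Nonempty; outside) renaming (_∈_ to _∈ˢ_)
open import Data.Fin.Subset.Properties using () renaming (_∈?_ to _∈ˢ?_)
open import Data.Integer using (+_; ∣_∣)
open import Data.List using (List; []; _∷_; _++_; [_]; map; foldr; length; tabulate; concatMap; upTo)
open import Data.List.Membership.DecPropositional using (_∈?_)
open import Data.List.Membership.Propositional using (_∈_)
open import Data.List.Relation.Unary.All using (All; []; _∷_; lookup)
open import Data.List.Relation.Unary.AllPairs using (AllPairs)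
open import Data.List.Relation.Unary.Any using (Any; any?)
open import Data.List.Relation.Unary.Linked using (Linked)
open import Data.List.Relation.Unary.Unique.Propositional using (Unique)
open import Data.Nat as ℕ using (ℕ; suc; _≡ᵇ_)
open import Data.Nat.DivMod using () renaming (_/_ to _/ⁿ_; _%_ to _%ⁿ_)
open import Data.Nat.Logarithm using (⌊log₂_⌋)
open import Data.Nat.Properties using (m^n≢0)
open import Data.Product using (Σ-syntax; ∃-syntax; _×_; _,_; proj₁; proj₂; swap)
open import Data.Rational using (ℚ; 0ℚ; ½; _≤_; _+_; _-_; _*_; _/_; _≤ᵇ_; ↥_; ↧ₙ_; +-0-rawMonoid)
open import Data.Sum using (_⊎_)
open import Data.Vec as Vec using (Vec; []; _∷_; toList)
open import Function using (_∘_)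
open import Level using (0ℓ)
open import Function.Bundles using (_⇔_)
open import Relation.Binary.Construct.Closure.ReflexiveTransitive using (Star)
open import Relation.Binary.PropositionalEquality using (_≡_; _≢_)
open import Relation.Nullary using (¬_; does)
open import Relation.Unary using (Pred; Decidable)
open import Algebra.Definitions.RawMonoid +-0-rawMonoid using (sum)

------------------------------------------------------------------------
-- Data manipulated by algorithms

infixr 6 _×ᵗ_

data Ty : Set where
  bool nat rat : Ty
  _×ᵗ_         : Ty → Ty → Ty
  list         : Ty → Ty

⟦_⟧ : Ty → Set
⟦ bool ⟧   = Bool
⟦ nat ⟧    = ℕ
⟦ rat ⟧    = ℚ
⟦ σ ×ᵗ τ ⟧ = ⟦ σ ⟧ × ⟦ τ ⟧
⟦ list σ ⟧ = List ⟦ σ ⟧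

bitLength : ℕ → ℕ
bitLength n = suc ⌊log₂ n ⌋

-- Length of the binary encoding, up to a constant factor.
size : (τ : Ty) → ⟦ τ ⟧ → ℕ
size bool     _       = 1
size nat      n       = bitLength n
size rat      q       = bitLength ∣ ↥ q ∣ ℕ.+ bitLength (↧ₙ q)
size (σ ×ᵗ τ) (x , y) = size σ x ℕ.+ size τ y
size (list σ) xs      = foldr (λ x s → size σ x ℕ.+ s) 1 xs

-- Least significant digit first.
binaryDigits : ℕ → List ℕ
binaryDigits n = map (λ i → ((n /ⁿ (2 ℕ.^ i)) {{m^n≢0 2 i}}) %ⁿ 2) (upTo (bitLength n))

------------------------------------------------------------------------
-- Algorithms and polynomial time

-- A black box: an input-output map together with a running time.
record Algorithm (σ τ : Ty) : Set where
  field
    run   : ⟦ σ ⟧ → ⟦ τ ⟧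
    steps : ⟦ σ ⟧ → ℕ

  -- The output has to be written down.
  time : ⟦ σ ⟧ → ℕ
  time x = steps x ℕ.+ size τ (run x)

record Polynomial : Set where
  field
    coefficient degree : ℕ

  at : ℕ → ℕ
  at n = coefficient ℕ.* n ℕ.^ degree ℕ.+ coefficient

-- The second component of the input is the string of random bits, whose
-- length may only depend on the size of the first component.
record RandomizedAlgorithm (σ τ : Ty) : Set where
  field
    coins     : Polynomial
    algorithm : Algorithm (σ ×ᵗ list bool) τ

  numCoins : ⟦ σ ⟧ → ℕ
  numCoins x = Polynomial.at coins (size σ x)

  input : (x : ⟦ σ ⟧) → Vec Bool (numCoins x) → ⟦ σ ×ᵗ list bool ⟧
  input x ω = x , toList ω

PolyTime : {σ τ : Ty} {I : Set} → (I → ⟦ σ ⟧) → Algorithm σ τ → Set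
PolyTime {σ} encode A =
  Σ[ p ∈ Polynomial ] ∀ i →
    Algorithm.time A (encode i) ℕ.≤ Polynomial.at p (size σ (encode i))

RandomizedPolyTime : {σ τ : Ty} {I : Set} → (I → ⟦ σ ⟧) → RandomizedAlgorithm σ τ → Set
RandomizedPolyTime {σ} encode R =
  Σ[ p ∈ Polynomial ] ∀ i ω →
    Algorithm.time algorithm (input (encode i) ω) ℕ.≤ Polynomial.at p (size σ (encode i))
  where open RandomizedAlgorithm R

-- Expectation over a uniformly random bit string.
mean : (m : ℕ) → (Vec Bool m → ℚ) → ℚ
mean 0       f = f []
mean (suc m) f = ½ * (mean m (λ ω → f (true ∷ ω)) + mean m (λ ω → f (false ∷ ω)))

------------------------------------------------------------------------
-- Programs with oracle calls

-- These are all computable in time polynomial in the sizes of the argument and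
-- of the result.
data Op : Ty → Ty → Set where
  fst             : ∀ {σ τ} → Op (σ ×ᵗ τ) σ
  snd             : ∀ {σ τ} → Op (σ ×ᵗ τ) τ
  addⁿ subⁿ mulⁿ  : Op (nat ×ᵗ nat) nat
  eqⁿ leqⁿ        : Op (nat ×ᵗ nat) bool
  digits          : Op nat (list nat)
  addʳ subʳ mulʳ  : Op (rat ×ᵗ rat) rat
  leqʳ            : Op (rat ×ᵗ rat) bool
  numʳ denʳ       : Op rat nat
  frac            : Op (nat ×ᵗ nat) rat

applyOp : ∀ {σ τ} → Op σ τ → ⟦ σ ⟧ → ⟦ τ ⟧
applyOp fst    (x , _) = x
applyOp snd    (_ , y) = y
applyOp addⁿ   (m , n) = m ℕ.+ n
applyOp subⁿ   (m , n) = m ℕ.∸ n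
applyOp mulⁿ   (m , n) = m ℕ.* n
applyOp eqⁿ    (m , n) = m ≡ᵇ n
applyOp leqⁿ   (m , n) = m ℕ.≤ᵇ n
applyOp digits n       = binaryDigits n
applyOp addʳ   (p , q) = p + q
applyOp subʳ   (p , q) = p - q
applyOp mulʳ   (p , q) = p * q
applyOp leqʳ   (p , q) = p ≤ᵇ q
applyOp numʳ   q       = ∣ ↥ q ∣
applyOp denʳ   q       = ↧ₙ q
applyOp frac   (m , n) = + m / suc n

-- Call-by-value programs over a typed context, with calls to an oracle that
-- answers queries of type κ by values of type α.  The only loop is iteration
-- over a list, so every program terminates.
data Term (κ α : Ty) (Γ : List Ty) : Ty → Set where
  var    : ∀ {τ} → τ ∈ Γ → Term κ α Γ τ
  const  : ∀ {τ} → ⟦ τ ⟧ → Term κ α Γ τ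
  letin  : ∀ {σ τ} → Term κ α Γ σ → Term κ α (σ ∷ Γ) τ → Term κ α Γ τ
  op     : ∀ {σ τ} → Op σ τ → Term κ α Γ σ → Term κ α Γ τ
  pair   : ∀ {σ τ} → Term κ α Γ σ → Term κ α Γ τ → Term κ α Γ (σ ×ᵗ τ)
  cond   : ∀ {τ} → Term κ α Γ bool → Term κ α Γ τ → Term κ α Γ τ → Term κ α Γ τ
  cons   : ∀ {τ} → Term κ α Γ τ → Term κ α Γ (list τ) → Term κ α Γ (list τ)
  -- the body sees the current element and the accumulated result
  fold   : ∀ {σ τ} → Term κ α Γ (list σ) → Term κ α Γ τ → Term κ α (σ ∷ τ ∷ Γ) τ → Term κ α Γ τ
  oracle : Term κ α Γ κ → Term κ α Γ α

foldSteps : {A B : Set} → (A → B → B) → (A → B → ℕ) → B → List A → ℕ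
foldSteps f c z []       = 0
foldSteps f c z (x ∷ xs) = c x (foldr f z xs) ℕ.+ foldSteps f c z xs

module Semantics {κ α : Ty} (A : Algorithm κ α) where

  open Algorithm A using (run; time)

  Env : List Ty → Set
  Env = All ⟦_⟧

  value : ∀ {Γ τ} → Term κ α Γ τ → Env Γ → ⟦ τ ⟧
  value (var x)      ρ = lookup ρ x
  value (const v)    ρ = v
  value (letin t u)  ρ = value u (value t ρ ∷ ρ)
  value (op o t)     ρ = applyOp o (value t ρ)
  value (pair t u)   ρ = value t ρ , value u ρ
  value (cond b t u) ρ = if value b ρ then value t ρ else value u ρ
  value (cons t u)   ρ = value t ρ ∷ value u ρ
  value (fold l z f) ρ = foldr (λ x a → value f (x ∷ a ∷ ρ)) (value z ρ) (value l ρ)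
  value (oracle t)   ρ = run (value t ρ)

  -- Every evaluated subterm is charged the size of its value (logarithmic
  -- cost, without sharing), and every oracle call the running time of A.
  mutual
    steps : ∀ {Γ τ} → Term κ α Γ τ → Env Γ → ℕ
    steps {τ = τ} t ρ = size τ (value t ρ) ℕ.+ substeps t ρ

    substeps : ∀ {Γ τ} → Term κ α Γ τ → Env Γ → ℕ
    substeps (var x)      ρ = 0
    substeps (const v)    ρ = 0
    substeps (letin t u)  ρ = steps t ρ ℕ.+ steps u (value t ρ ∷ ρ)
    substeps (op o t)     ρ = steps t ρ
    substeps (pair t u)   ρ = steps t ρ ℕ.+ steps u ρ
    substeps (cond b t u) ρ = steps b ρ ℕ.+ (if value b ρ then steps t ρ else steps u ρ)
    substeps (cons t u)   ρ = steps t ρ ℕ.+ steps u ρ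
    substeps (fold l z f) ρ =
      steps l ρ ℕ.+ steps z ρ ℕ.+
      foldSteps (λ x a → value f (x ∷ a ∷ ρ)) (λ x a → steps f (x ∷ a ∷ ρ)) (value z ρ) (value l ρ)
    substeps (oracle t)   ρ = steps t ρ ℕ.+ time (value t ρ)

-- A randomized program computing σ → τ from an oracle for κ → α.
record Reduction (κ α σ τ : Ty) : Set where
  field
    coins   : Polynomial
    program : Term κ α (σ ∷ list bool ∷ []) τ

_⟨_⟩ : ∀ {κ α σ τ} → Reduction κ α σ τ → Algorithm κ α → RandomizedAlgorithm σ τ
R ⟨ A ⟩ = record
  { coins     = coins
  ; algorithm = record
    { run   = λ { (x , ω) → value program (x ∷ ω ∷ []) }
    ; steps = λ { (x , ω) → steps program (x ∷ ω ∷ []) }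
    }
  }
  where
  open Reduction R
  open Semantics A

------------------------------------------------------------------------
-- Metrics, paths, trees

-- The n non-root nodes together with the root zero.
Vertex : ℕ → Set
Vertex n = Fin (suc n)

root : ∀ {n} → Vertex n
root = zero

record Metric (n : ℕ) : Set where
  field
    dist     : Vertex n → Vertex n → ℚ
    dist≡0   : ∀ u v → (dist u v ≡ 0ℚ) ⇔ (u ≡ v)
    dist-sym : ∀ u v → dist u v ≡ dist v u
    triangle : ∀ u v w → dist u w ≤ dist u v + dist v w

open Metric public using (dist)

-- A walk from the root, given by the vertices visited after the root.
Walk : ℕ → Set
Walk n = List (Vertex n)

IsPath : ∀ {n} → Walk n → Set
IsPath p = Unique (root ∷ p)

walkLength : ∀ {n} → Metric n → Vertex n → Walk n → ℚ
walkLength d u []      = 0ℚ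
walkLength d u (v ∷ p) = dist d u v + walkLength d v p

-- Length of the walk u ∷ p from u to the first vertex of p satisfying P
-- (and of the whole walk if there is none).
lengthUntil : ∀ {n} {P : Pred (Vertex n) 0ℓ} → Metric n → Decidable P → Vertex n → Walk n → ℚ
lengthUntil d P? u []      = 0ℚ
lengthUntil d P? u (v ∷ p) =
  dist d u v + (if does (P? v) then 0ℚ else lengthUntil d P? v p)

Edges : ℕ → Set
Edges n = List (Vertex n × Vertex n)

-- The vertices of the graph consisting of the root and the given edges,
-- possibly with repetitions.
spanned : ∀ {n} → Edges n → List (Vertex n)
spanned E = root ∷ concatMap (λ { (u , v) → u ∷ v ∷ [] }) E

Adjacent : ∀ {n} → Edges n → Vertex n → Vertex n → Set
Adjacent E u v = (u , v) ∈ E ⊎ (v , u) ∈ E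

IsCycle : ∀ {n} → Edges n → Vertex n → List (Vertex n) → Set
IsCycle E v vs = Unique (v ∷ vs) × 2 ℕ.≤ length vs × Linked (Adjacent E) (v ∷ vs ++ [ v ])

-- An edge is listed once, in an arbitrary orientation.
record IsTree {n} (E : Edges n) : Set where
  field
    noLoops    : All (λ e → proj₁ e ≢ proj₂ e) E
    noParallel : AllPairs (λ e f → e ≢ f × e ≢ swap f) E
    connected  : ∀ {v} → v ∈ spanned E → Star (Adjacent E) root v
    acyclic    : ∀ v vs → ¬ IsCycle E v vs

treeLength : ∀ {n} → Metric n → Edges n → ℚ
treeLength d []            = 0ℚ
treeLength d ((u , v) ∷ E) = dist d u v + treeLength d E

-- m possibly overlapping sets of non-root nodes.
Groups : ℕ → ℕ → Set
Groups n m = Fin m → Subset n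

InGroup : ∀ {n} → Subset n → Pred (Vertex n) 0ℓ
InGroup G v = v ∈ˢ (outside ∷ G)

inGroup? : ∀ {n} (G : Subset n) → Decidable (InGroup G)
inGroup? G v = v ∈ˢ? (outside ∷ G)

walkTy treeTy matrixTy groupsTy : Ty
walkTy   = list nat
treeTy   = list (nat ×ᵗ nat)
matrixTy = list (list rat)
groupsTy = list (list bool)

encodeWalk : ∀ {n} → Walk n → ⟦ walkTy ⟧
encodeWalk = map toℕ

encodeTree : ∀ {n} → Edges n → ⟦ treeTy ⟧
encodeTree = map (λ { (u , v) → toℕ u , toℕ v })

encodeMetric : ∀ {n} → Metric n → ⟦ matrixTy ⟧
encodeMetric d = tabulate (λ u → tabulate (dist d u))

encodeGroups : ∀ {n m} → Groups n m → ⟦ groupsTy ⟧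
encodeGroups G = tabulate (λ j → toList (G j))

------------------------------------------------------------------------
-- Orienteering

record OrienteeringProblem : Set₁ where
  field
    Instance : Set
    inputTy  : Ty
    encode   : Instance → ⟦ inputTy ⟧
    nodes    : Instance → ℕ
    metric   : (I : Instance) → Metric (nodes I)
    bound    : Instance → ℚ
    -- reward of a path or tree, as a function of its list of vertices
    reward   : (I : Instance) → List (Vertex (nodes I)) → ℚ

record PathOrienteeringInstance : Set where
  field
    n           : ℕ
    d           : Metric n
    π           : Vertex n → ℚ
    π-nonneg    : ∀ v → 0ℚ ≤ π v
    B           : ℚ
    B-nonneg    : 0ℚ ≤ B

PathOrienteering : OrienteeringProblem
PathOrienteering = record
  { Instance = PathOrienteeringInstance
  ; inputTy  = matrixTy ×ᵗ list rat ×ᵗ rat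
  ; encode   = λ I → encodeMetric (d I) , tabulate (π I) , B I
  ; nodes    = n
  ; metric   = d
  ; bound    = B
  ; reward   = λ I vs → sum (λ v → if does (_∈?_ _≟ᶠ_ v vs) then π I v else 0ℚ)
  }
  where open PathOrienteeringInstance

record GroupOrienteeringInstance : Set where
  field
    n           : ℕ
    d           : Metric n
    m           : ℕ
    G           : Groups n m
    π           : Fin m → ℚ
    π-nonneg    : ∀ j → 0ℚ ≤ π j
    B           : ℚ
    B-nonneg    : 0ℚ ≤ B

GroupOrienteering : OrienteeringProblem
GroupOrienteering = record
  { Instance = GroupOrienteeringInstance
  ; inputTy  = matrixTy ×ᵗ groupsTy ×ᵗ list rat ×ᵗ rat
  ; encode   = λ I → encodeMetric (d I) , encodeGroups (G I) , tabulate (π I) , B I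
  ; nodes    = n
  ; metric   = d
  ; bound    = B
  ; reward   = λ I vs → sum (λ j → if does (any? (inGroup? (G I j)) vs) then π I j else 0ℚ)
  }
  where open GroupOrienteeringInstance

TreeAlgorithm : OrienteeringProblem → Set
TreeAlgorithm O = Algorithm (OrienteeringProblem.inputTy O) treeTy

-- Being within a factor ρ of the optimum is being within a factor ρ of every
-- feasible solution.
IsTreeApproximation : (ρ γ : ℚ) (O : OrienteeringProblem) → TreeAlgorithm O → Set
IsTreeApproximation ρ γ O A = ∀ I → ∃[ T ]
    Algorithm.run A (encode I) ≡ encodeTree T
  × IsTree T
  × treeLength (metric I) T ≤ γ * bound I
  × (∀ p → IsPath p → walkLength (metric I) root p ≤ bound I →
       reward I (root ∷ p) ≤ ρ * reward I (spanned T))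
  where open OrienteeringProblem O

------------------------------------------------------------------------
-- Minimum latency

record LatencyProblem : Set₁ where
  field
    Instance : Set
    inputTy  : Ty
    encode   : Instance → ⟦ inputTy ⟧
    nodes    : Instance → ℕ
    Feasible : (I : Instance) → Walk (nodes I) → Set
    latency  : (I : Instance) → Walk (nodes I) → ℚ

record MLInstance : Set where
  field
    n : ℕ
    d : Metric n

ML : LatencyProblem
ML = record
  { Instance = MLInstance
  ; inputTy  = matrixTy
  ; encode   = λ I → encodeMetric (d I)
  ; nodes    = n
  ; Feasible = λ I p → IsPath p × (∀ (j : Fin (n I)) → suc j ∈ p)
  ; latency  = λ I p → sum (λ (j : Fin (n I)) → lengthUntil (d I) (_≟ᶠ suc j) root p)
  }
  where open MLInstance

record MGLInstance : Set where
  field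
    n          : ℕ
    d          : Metric n
    m          : ℕ
    G          : Groups n m
    G-nonempty : ∀ j → Nonempty (G j)

MGL : LatencyProblem
MGL = record
  { Instance = MGLInstance
  ; inputTy  = matrixTy ×ᵗ groupsTy
  ; encode   = λ I → encodeMetric (d I) , encodeGroups (G I)
  ; nodes    = n
  ; Feasible = λ I p → IsPath p × (∀ j → Any (InGroup (G I j)) p)
  ; latency  = λ I p → sum (λ j → lengthUntil (d I) (inGroup? (G I j)) root p)
  }
  where open MGLInstance

-- On every sequence ω of random bits a feasible path p ω is returned, and its
-- expected latency is within a factor c of every feasible path.
IsApproximation : (c : ℚ) (L : LatencyProblem) →
  RandomizedAlgorithm (LatencyProblem.inputTy L) walkTy → Set
IsApproximation c L R = ∀ I → Σ[ p ∈ (Vec Bool (numCoins (encode I)) → Walk (nodes I)) ]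
    (∀ ω → Algorithm.run algorithm (input (encode I) ω) ≡ encodeWalk (p ω) × Feasible I (p ω))
  × (∀ q → Feasible I q → mean (numCoins (encode I)) (latency I ∘ p) ≤ c * latency I q)
  where
  open LatencyProblem L
  open RandomizedAlgorithm R

LatencyReduction : OrienteeringProblem → LatencyProblem → Set
LatencyReduction O L =
  Reduction (OrienteeringProblem.inputTy O) treeTy (LatencyProblem.inputTy L) walkTy

module Submission where

-- The reduction is deterministic.  For the lengths B = 2 ^ k / D, where 1 / D is at most every distance
-- between the root and another vertex, it asks K = O(ρ) times for a tree of length at most γ B, rewarding
-- the elements that are not yet covered, and appends a closed tour of length at most 2 γ B around the tree
-- to the path.
--
-- Let u and u′ be the numbers of uncovered elements before and after a call, and let r be the number of
-- elements whose latency on a competing path q exceeds B.  The prefix of q of length B shows that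
-- u ≤ r + ρ (u - u′), and the call raises the total latency by at most 2 γ B u.  Since K ≥ 2 ρ, the potential
-- "latency + 4 γ ρ B u" therefore grows by at most 4 K γ B r in a scale, even though B doubles at its end.
-- Summed over the scales, B r is at most twice the latency of q.  After the last scale the tour through
-- all vertices is paid for by the potential.
--
-- A closed tour is grown from the root: for an edge x y of the tree with x on the tour and y not on it,
-- y is inserted after x, which costs at most twice the length of the edge.

-- Closed tours are used because they can be concatenated: an element that has not been met yet is
-- charged the whole closed walk, so appending a tour of length `L` costs it at most `L`. The return
-- to the root is given up only in the final path. `D` is `Q + 1`, where `Q` is the sum of the
-- denominators in the root's row of the distance matrix. The number of scales is the bit length of
-- `(Q + 1) N`, where `N` is the sum of the numerators. Both are easy to compute, and the bit length
-- is polynomial in the input. The obstacle in the running time is nesting. A loop whose body is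
-- merely polynomial in its accumulator may blow up, so the accumulators need bounds in terms of the
-- input. For lists of visited vertices the bound comes from their being duplicate-free. The oracle
-- is only known to be fast and correct on encodings of instances, so the same invariant also has to
-- show that each query is such an encoding.

open import Defs

-- Bit lengths and polynomially bounded functions.

module PolynomialBounds where

  open import Data.Nat
  open import Data.Nat.Properties
  open import Data.Nat.Logarithm
  open import Data.Product
  open import Data.List using (List; []; _∷_; length)
  open import Data.List.Membership.Propositional using (_∈_)
  open import Data.List.Relation.Unary.Any using (here; there)
  open import Function using (_∘_)
  open import Relation.Binary.PropositionalEquality
  open import Relation.Nullary

  n<2^bitLength : ∀ n → n < 2 ^ bitLength n
  n<2^bitLength n with n <? 2 ^ bitLength n
  ... | yes p = p
  ... | no ¬p = contradiction
    (≤-trans (≤-reflexive (sym (⌊log₂[2^n]⌋≡n (bitLength n)))) (⌊log₂⌋-mono-≤ (≮⇒≥ ¬p)))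
    (<⇒≱ ≤-refl)

  bitLength-bound : ∀ {n k} → n ≤ 2 ^ k → bitLength n ≤ suc k
  bitLength-bound {n} {k} p = s≤s (≤-trans (⌊log₂⌋-mono-≤ p) (≤-reflexive (⌊log₂[2^n]⌋≡n k)))

  bitLength-mono : ∀ {m n} → m ≤ n → bitLength m ≤ bitLength n
  bitLength-mono p = s≤s (⌊log₂⌋-mono-≤ p)

  2≤2^bitLength : ∀ n → 2 ≤ 2 ^ bitLength n
  2≤2^bitLength n = ^-monoʳ-≤ 2 (s≤s (z≤n {⌊log₂ n ⌋}))

  m+n≤m*n : ∀ {m n} → 2 ≤ m → 2 ≤ n → m + n ≤ m * n
  m+n≤m*n {suc (suc m)} {suc (suc n)} (s≤s (s≤s _)) (s≤s (s≤s _)) = begin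
    2 + m + (2 + n)                           ≤⟨ m≤m+n _ (m + n + m * n) ⟩
    2 + m + (2 + n) + (m + n + m * n)         ≡⟨ solve 2 (λ m n →
      con 2 :+ m :+ (con 2 :+ n) :+ (m :+ n :+ m :* n) := (con 2 :+ m) :* (con 2 :+ n)) refl m n ⟩
    (2 + m) * (2 + n)                         ∎
    where
    open ≤-Reasoning
    open import Data.Nat.Solver
    open +-*-Solver

  -- Both powers of two are at least 2, so their sum is at most their product. This crude additive
  -- bound is enough for loops in which each round adds one number to the accumulator.
  bitLength-+ : ∀ m n → bitLength (m + n) ≤ suc (bitLength m + bitLength n)
  bitLength-+ m n = bitLength-bound (begin
    m + n                                 ≤⟨ +-mono-≤ (<⇒≤ (n<2^bitLength m)) (<⇒≤ (n<2^bitLength n)) ⟩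
    2 ^ bitLength m + 2 ^ bitLength n     ≤⟨ m+n≤m*n (2≤2^bitLength m) (2≤2^bitLength n) ⟩
    2 ^ bitLength m * 2 ^ bitLength n     ≡⟨ ^-distribˡ-+-* 2 (bitLength m) (bitLength n) ⟨
    2 ^ (bitLength m + bitLength n)       ∎)
    where open ≤-Reasoning

  bitLength-* : ∀ m n → bitLength (m * n) ≤ suc (bitLength m + bitLength n)
  bitLength-* m n = bitLength-bound (begin
    m * n                                 ≤⟨ *-mono-≤ (<⇒≤ (n<2^bitLength m)) (<⇒≤ (n<2^bitLength n)) ⟩
    2 ^ bitLength m * 2 ^ bitLength n     ≡⟨ ^-distribˡ-+-* 2 (bitLength m) (bitLength n) ⟨
    2 ^ (bitLength m + bitLength n)       ∎)
    where open ≤-Reasoning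

  bitLength≤suc : ∀ n → bitLength n ≤ suc n
  bitLength≤suc n = bitLength-bound (<⇒≤ (n<2^n n))
    where
    n<2^n : ∀ n → n < 2 ^ n
    n<2^n zero    = ≤-refl
    n<2^n (suc n) = begin
      2 + n          ≤⟨ s≤s (n<2^n n) ⟩
      1 + 2 ^ n      ≤⟨ +-monoˡ-≤ (2 ^ n) (≤-trans (s≤s z≤n) (n<2^n n)) ⟩
      2 ^ n + 2 ^ n  ≡⟨ cong (2 ^ n +_) (+-identityʳ _) ⟨
      2 ^ suc n      ∎
      where open ≤-Reasoning

  size>0 : ∀ τ (x : ⟦ τ ⟧) → 0 < size τ x
  size>0 bool x = ≤-refl
  size>0 nat x = s≤s z≤n
  size>0 rat x = s≤s z≤n
  size>0 (σ ×ᵗ τ) (x , y) = ≤-trans (size>0 σ x) (m≤m+n _ _)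
  size>0 (list σ) [] = ≤-refl
  size>0 (list σ) (x ∷ xs) = ≤-trans (size>0 σ x) (m≤m+n _ _)

  length≤size : ∀ {σ} (xs : List ⟦ σ ⟧) → length xs ≤ size (list σ) xs
  length≤size {σ} []       = z≤n
  length≤size {σ} (x ∷ xs) = +-mono-≤ (size>0 σ x) (length≤size xs)

  size-∈ : ∀ {σ x} {xs : List ⟦ σ ⟧} → x ∈ xs → size σ x ≤ size (list σ) xs
  size-∈ (here refl)        = m≤m+n _ _
  size-∈ {σ} {xs = y ∷ _} (there p) = ≤-trans (size-∈ p) (m≤n+m _ (size σ y))

  -- One polynomial serves all `j`. The index type is arbitrary, so that the notion applies both to
  -- inputs and to the loop iterations that they trigger.
  Bounded : {J : Set} → (J → ℕ) → (J → ℕ) → Set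
  Bounded s f = Σ[ p ∈ Polynomial ] ∀ j → f j ≤ Polynomial.at p (s j)

  -- The `+ 1` is there for `n = 0`, where `n ^ 0` is 1 but every higher power is 0.
  ^-split : ∀ n a b → n ^ a ≤ n ^ (a + b) + 1
  ^-split zero    zero    b = m≤n+m 1 _
  ^-split zero    (suc a) b = z≤n
  ^-split (suc n) a       b = ≤-trans (^-monoʳ-≤ (suc n) (m≤m+n a b)) (m≤m+n _ 1)

  ^-split′ : ∀ n a b → n ^ b ≤ n ^ (a + b) + 1
  ^-split′ n a b = subst (λ c → n ^ b ≤ n ^ c + 1) (+-comm b a) (^-split n b a)

  module _ {J : Set} {s : J → ℕ} where

    ≤-bounded : ∀ {f g} → (∀ j → f j ≤ g j) → Bounded s g → Bounded s f
    ≤-bounded f≤g (p , h) = p , λ j → ≤-trans (f≤g j) (h j)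

    const-bounded : ∀ c → Bounded s (λ _ → c)
    const-bounded c = record { coefficient = c ; degree = 0 } , λ j → m≤n+m c _

    self-bounded : Bounded s s
    self-bounded = record { coefficient = 1 ; degree = 1 } , λ j →
      ≤-trans (≤-reflexive (sym (trans (*-identityˡ _) (^-identityʳ (s j))))) (m≤m+n _ 1)

    +-bounded : ∀ {f g} → Bounded s f → Bounded s g → Bounded s (λ j → f j + g j)
    +-bounded {f} {g} (record { coefficient = c ; degree = a } , h) (record { coefficient = d ; degree = b } , k) =
      record { coefficient = (c + d) * 2 ; degree = a + b } , λ j → begin
        f j + g j
          ≤⟨ +-mono-≤ (h j) (k j) ⟩
        (c * s j ^ a + c) + (d * s j ^ b + d)
          ≤⟨ +-mono-≤ (+-monoˡ-≤ c (*-monoʳ-≤ c (^-split (s j) a b))) (+-monoˡ-≤ d (*-monoʳ-≤ d (^-split′ (s j) a b))) ⟩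
        (c * (s j ^ (a + b) + 1) + c) + (d * (s j ^ (a + b) + 1) + d)
          ≤⟨ m≤m+n _ ((c + d) * s j ^ (a + b)) ⟩
        (c * (s j ^ (a + b) + 1) + c) + (d * (s j ^ (a + b) + 1) + d) + (c + d) * s j ^ (a + b)
          ≡⟨ solve 3 (λ c d x → c :* (x :+ con 1) :+ c :+ (d :* (x :+ con 1) :+ d) :+ (c :+ d) :* x
                         := (c :+ d) :* con 2 :* x :+ (c :+ d) :* con 2) refl c d (s j ^ (a + b)) ⟩
        (c + d) * 2 * s j ^ (a + b) + (c + d) * 2 ∎
      where
      open ≤-Reasoning
      open import Data.Nat.Solver
      open +-*-Solver

    *-bounded : ∀ {f g} → Bounded s f → Bounded s g → Bounded s (λ j → f j * g j)
    *-bounded {f} {g} (record { coefficient = c ; degree = a } , h) (record { coefficient = d ; degree = b } , k) =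
      record { coefficient = c * d * 3 ; degree = a + b } , λ j → begin
        f j * g j
          ≤⟨ *-mono-≤ (h j) (k j) ⟩
        (c * s j ^ a + c) * (d * s j ^ b + d)
          ≡⟨ solve 4 (λ c d x y → (c :* x :+ c) :* (d :* y :+ d)
                         := c :* d :* (x :* y) :+ c :* d :* (x :+ y :+ con 1)) refl c d (s j ^ a) (s j ^ b) ⟩
        c * d * (s j ^ a * s j ^ b) + c * d * (s j ^ a + s j ^ b + 1)
          ≤⟨ +-mono-≤ (≤-reflexive (cong (c * d *_) (sym (^-distribˡ-+-* (s j) a b))))
               (*-monoʳ-≤ (c * d) (+-monoˡ-≤ 1 (+-mono-≤ (^-split (s j) a b) (^-split′ (s j) a b)))) ⟩
        c * d * s j ^ (a + b) + c * d * (s j ^ (a + b) + 1 + (s j ^ (a + b) + 1) + 1)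
          ≡⟨ solve 2 (λ c x → c :* x :+ c :* (x :+ con 1 :+ (x :+ con 1) :+ con 1)
                         := c :* con 3 :* x :+ c :* con 3) refl (c * d) (s j ^ (a + b)) ⟩
        c * d * 3 * s j ^ (a + b) + c * d * 3 ∎
      where
      open ≤-Reasoning
      open import Data.Nat.Solver
      open +-*-Solver

    suc-bounded : ∀ {f} → Bounded s f → Bounded s (suc ∘ f)
    suc-bounded = +-bounded (const-bounded 1)

    ^-bounded : ∀ {f} k → Bounded s f → Bounded s (λ j → f j ^ k)
    ^-bounded zero    b = const-bounded 1
    ^-bounded (suc k) b = *-bounded b (^-bounded k b)

    at-bounded : ∀ p {f} → Bounded s f → Bounded s (λ j → Polynomial.at p (f j))
    at-bounded p b = +-bounded (*-bounded (const-bounded c) (^-bounded k b)) (const-bounded c)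
      where open Polynomial p renaming (coefficient to c; degree to k)

  reindex : ∀ {J J′ : Set} {s : J → ℕ} {f} (h : J′ → J) → Bounded s f → Bounded (s ∘ h) (f ∘ h)
  reindex h (p , b) = p , b ∘ h

-- Running times of programs: one rule for each construct.

module RunningTime where

  open PolynomialBounds
  open import Data.Bool using (Bool; true; false; if_then_else_)
  open import Data.Integer as ℤ using (+_; ∣_∣)
  import Data.Integer.Properties as ℤₚ
  open import Data.Nat
  open import Data.Nat.Properties
  open import Data.Nat.DivMod using (m%n<n)
  open import Data.Nat.GCD using (gcd; gcd[m,n]≢0)
  open import Data.Product hiding (map)
  open import Data.Rational as ℚ using (ℚ; ↥_; ↧_; ↧ₙ_; normalize)
  open import Data.Rational.Properties using (↥-normalize; ↧-normalize)
  open import Data.List using (List; []; _∷_; length; foldr; map; upTo)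
  open import Data.List.Properties using (length-upTo)
  open import Data.List.Membership.Propositional using (_∈_)
  open import Data.List.Relation.Unary.Any using (here; there)
  open import Data.List.Relation.Unary.All using (All; []; _∷_; lookup)
  open import Data.Sum using (inj₂)
  open import Function using (_∘_)
  open import Relation.Binary.PropositionalEquality
  open import Relation.Nullary

  size-binaryDigits : ∀ n → size (list nat) (binaryDigits n) ≤ suc (bitLength n)
  size-binaryDigits n = subst (λ l → size (list nat) (binaryDigits n) ≤ suc l) (length-upTo (bitLength n)) (go (upTo (bitLength n)))
    where
    digit : ℕ → ℕ
    digit i = ((n / (2 ^ i)) {{m^n≢0 2 i}}) % 2

    go : ∀ is → size (list nat) (map digit is) ≤ suc (length is)
    go []       = ≤-refl
    go (i ∷ is) = +-mono-≤ (bitLength-mono {digit i} (s≤s⁻¹ (m%n<n ((n / (2 ^ i)) {{m^n≢0 2 i}}) 2))) (go is)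

  -- Reduction to lowest terms divides numerator and denominator by their gcd, so it cannot lengthen
  -- them.
  size-frac : ∀ m n → size rat (ℤ.+ m ℚ./ suc n) ≤ bitLength m + bitLength (suc n)
  size-frac m n = +-mono-≤ (bitLength-mono num) (bitLength-mono den)
    where
    g = gcd m (suc n)
    q = normalize m (suc n)

    instance
      g≢0 : NonZero g
      g≢0 = ≢-nonZero (gcd[m,n]≢0 m (suc n) (inj₂ λ ()))

    num : ∣ ↥ q ∣ ≤ m
    num = ≤-trans (m≤m*n ∣ ↥ q ∣ g) (≤-reflexive
      (trans (sym (ℤₚ.abs-* (↥ q) (+ g))) (cong ∣_∣ (↥-normalize m (suc n)))))

    den : ↧ₙ q ≤ suc n
    den = ≤-trans (m≤m*n (↧ₙ q) g) (≤-reflexive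
      (trans (sym (ℤₚ.abs-* (↧ q) (+ g))) (cong ∣_∣ (↧-normalize m (suc n)))))

  -- The counter is the number of elements already folded in, counted from the end of the list. It
  -- later becomes the number of calls or of scales already performed.
  foldr-invariant : ∀ {A B : Set} (Inv : ℕ → B → Set) {f : A → B → B} {z} xs → Inv 0 z →
    (∀ {x k a} → x ∈ xs → k < length xs → Inv k a → Inv (suc k) (f x a)) → Inv (length xs) (foldr f z xs)
  foldr-invariant Inv []       z h = z
  foldr-invariant Inv (x ∷ xs) z h = h (here refl) ≤-refl
    (foldr-invariant Inv xs z λ x∈ k< → h (there x∈) (m≤n⇒m≤1+n k<))

  module Costs {κ α : Ty} (A : Algorithm κ α) where

    open Semantics A public

    -- The steps are compared with the size `s j` of the original input rather than with the size of
    -- the environment, which is what keeps nested loops polynomial. Steps include the size of the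
    -- value, so one field bounds both.
    record Cost {J Γ τ} (s : J → ℕ) (ρ : J → Env Γ) (t : Term κ α Γ τ) : Set where
      constructor cost
      field
        steps-bounded : Bounded s (λ j → steps t (ρ j))

      value-bounded : Bounded s (λ j → size τ (value t (ρ j)))
      value-bounded = ≤-bounded (λ j → m≤m+n _ _) steps-bounded

    open Cost public

    Small : ∀ {J Γ τ} → (J → ℕ) → (J → Env Γ) → τ ∈ Γ → Set
    Small {τ = τ} s ρ x = Bounded s (λ j → size τ (lookup (ρ j) x))

    module _ {J : Set} {Γ : List Ty} {s : J → ℕ} {ρ : J → Env Γ} where

      var-cost : ∀ {τ} {x : τ ∈ Γ} → Small s ρ x → Cost s ρ (var x)
      var-cost b = cost (≤-bounded (λ j → ≤-reflexive (+-identityʳ _)) b)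

      const-cost : ∀ {τ} {v : ⟦ τ ⟧} → Cost s ρ (const v)
      const-cost {τ} {v} = cost (const-bounded (size τ v + 0))

      letin-cost : ∀ {σ τ} {t : Term κ α Γ σ} {u : Term κ α (σ ∷ Γ) τ} → Cost s ρ t →
        Cost s (λ j → value t (ρ j) ∷ ρ j) u → Cost s ρ (letin t u)
      letin-cost (cost ct) cu = cost (+-bounded (value-bounded cu) (+-bounded ct (steps-bounded cu)))

      -- The slack of 2 is what `frac` needs, whose denominator is a successor; the other operations
      -- of the program need no more.
      op-cost : ∀ {σ τ} {o : Op σ τ} {t : Term κ α Γ σ} →
        (∀ v → size τ (applyOp o v) ≤ 2 + size σ v) → Cost s ρ t → Cost s ρ (op o t)
      op-cost h ct = cost (+-bounded (≤-bounded (λ j → h _) (+-bounded (const-bounded 2) (value-bounded ct))) (steps-bounded ct))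

      pair-cost : ∀ {σ τ} {t : Term κ α Γ σ} {u : Term κ α Γ τ} → Cost s ρ t → Cost s ρ u → Cost s ρ (pair t u)
      pair-cost ct cu = cost (+-bounded (+-bounded (value-bounded ct) (value-bounded cu)) (+-bounded (steps-bounded ct) (steps-bounded cu)))

      cons-cost : ∀ {τ} {t : Term κ α Γ τ} {u : Term κ α Γ (list τ)} → Cost s ρ t → Cost s ρ u → Cost s ρ (cons t u)
      cons-cost ct cu = cost (+-bounded (+-bounded (value-bounded ct) (value-bounded cu)) (+-bounded (steps-bounded ct) (steps-bounded cu)))

      cond-cost : ∀ {τ} {b : Term κ α Γ bool} {t u : Term κ α Γ τ} → Cost s ρ b → Cost s ρ t → Cost s ρ u →
        Cost s ρ (cond b t u)
      cond-cost {τ} {b} {t} {u} (cost cb) (cost ct) (cost cu) = cost (≤-bounded (λ j → le (value b (ρ j)))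
        (+-bounded (+-bounded ct cu) (+-bounded cb (+-bounded ct cu))))
        where
        le : ∀ {j} v → size τ (if v then value t (ρ j) else value u (ρ j))
          + (steps b (ρ j) + (if v then steps t (ρ j) else steps u (ρ j)))
          ≤ steps t (ρ j) + steps u (ρ j) + (steps b (ρ j) + (steps t (ρ j) + steps u (ρ j)))
        le {j} true  = +-mono-≤ (≤-trans (m≤m+n _ _) (m≤m+n _ _)) (+-monoʳ-≤ (steps b (ρ j)) (m≤m+n _ _))
        le {j} false = +-mono-≤ (≤-trans (m≤m+n (size τ (value u (ρ j))) _) (m≤n+m (steps u (ρ j)) (steps t (ρ j)))) (+-monoʳ-≤ (steps b (ρ j)) (m≤n+m (steps u (ρ j)) (steps t (ρ j))))

      oracle-cost : ∀ {t : Term κ α Γ κ} → Cost s ρ t → Bounded s (λ j → Algorithm.time A (value t (ρ j))) →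
        Cost s ρ (oracle t)
      oracle-cost {t} (cost ct) ca = cost (+-bounded (≤-bounded (λ j → m≤n+m _ (Algorithm.steps A (value t (ρ j)))) ca) (+-bounded ct ca))

      -- The family in which a loop body is analysed: every element and every accumulator that the
      -- invariant permits, not just those arising in the run. The body can then be treated like any
      -- other term.
      record Iteration {σ τ} (l : Term κ α Γ (list σ)) (Inv : J → ℕ → ⟦ τ ⟧ → Set) : Set where
        constructor iteration
        field
          index   : J
          element : ⟦ σ ⟧
          acc     : ⟦ τ ⟧
          round   : ℕ
          element∈ : element ∈ value l (ρ index)
          round<   : round < length (value l (ρ index))
          holds    : Inv index round acc

      open Iteration public

      -- A polynomial that bounds the body over all `Iteration`s bounds the loop after
      -- multiplication by the length of the list. The size of the accumulator follows: it is the
      -- initial value or a value of the body, whose size is part of the steps.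
      fold-cost : ∀ {σ τ} {l : Term κ α Γ (list σ)} {z : Term κ α Γ τ} {f : Term κ α (σ ∷ τ ∷ Γ) τ}
        (Inv : J → ℕ → ⟦ τ ⟧ → Set) →
        Cost s ρ l → Cost s ρ z →
        (∀ j → Inv j 0 (value z (ρ j))) →
        (∀ {j x k a} → x ∈ value l (ρ j) → k < length (value l (ρ j)) → Inv j k a → Inv j (suc k) (value f (x ∷ a ∷ ρ j))) →
        Cost {Iteration l Inv} (s ∘ index) (λ i → element i ∷ acc i ∷ ρ (index i)) f →
        Cost s ρ (fold l z f)
      fold-cost {σ} {τ} {l} {z} {f} Inv cl cz iz is (cost (p , cf)) = cost (
        +-bounded (≤-bounded (λ j → sz j _ (λ x → x) ≤-refl) (+-bounded (steps-bounded cz) cp))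
          (+-bounded (+-bounded (steps-bounded cl) (steps-bounded cz))
            (≤-bounded (λ j → tot j _ (λ x → x) ≤-refl) (*-bounded (≤-bounded (λ j → length≤size (value l (ρ j))) (value-bounded cl)) cp))))
        where
        bound : J → ℕ
        bound j = Polynomial.at p (s j)

        cp : Bounded s bound
        cp = p , λ j → ≤-refl

        Sub : J → List ⟦ σ ⟧ → Set
        Sub j xs = ∀ {x} → x ∈ xs → x ∈ value l (ρ j)

        g : J → ⟦ σ ⟧ → ⟦ τ ⟧ → ⟦ τ ⟧
        g j x a = value f (x ∷ a ∷ ρ j)

        inv : ∀ j xs → Sub j xs → length xs ≤ length (value l (ρ j)) → Inv j (length xs) (foldr (g j) (value z (ρ j)) xs)
        inv j xs sub le = foldr-invariant (Inv j) xs (iz j) λ x∈ k< → is (sub x∈) (<-≤-trans k< le)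

        bnd : ∀ j x xs → Sub j (x ∷ xs) → length xs < length (value l (ρ j)) →
          steps f (x ∷ foldr (g j) (value z (ρ j)) xs ∷ ρ j) ≤ bound j
        bnd j x xs sub lt = cf (iteration j x _ (length xs) (sub (here refl)) lt (inv j xs (sub ∘ there) (<⇒≤ lt)))

        sz : ∀ j xs → Sub j xs → length xs ≤ length (value l (ρ j)) → size τ (foldr (g j) (value z (ρ j)) xs) ≤ steps z (ρ j) + bound j
        sz j []       sub le = ≤-trans (m≤m+n _ (substeps z (ρ j))) (m≤m+n _ (bound j))
        sz j (x ∷ xs) sub le = ≤-trans (≤-trans (m≤m+n _ _) (bnd j x xs sub le)) (m≤n+m _ (steps z (ρ j)))

        tot : ∀ j xs → Sub j xs → length xs ≤ length (value l (ρ j)) →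
          foldSteps (g j) (λ x a → steps f (x ∷ a ∷ ρ j)) (value z (ρ j)) xs ≤ length xs * bound j
        tot j []       sub le = z≤n
        tot j (x ∷ xs) sub le = +-mono-≤ (bnd j x xs sub le) (tot j xs (sub ∘ there) (<⇒≤ le))

      -- For loops whose accumulator grows by at most `g j` in each round, hence by at most
      -- `k * g j` in `k` rounds. Loops that rebuild the whole accumulator go through `fold-cost`
      -- with an invariant of their own.
      growing-fold-cost : ∀ {σ τ} {l : Term κ α Γ (list σ)} {z : Term κ α Γ τ} {f : Term κ α (σ ∷ τ ∷ Γ) τ}
        {g : J → ℕ} → Bounded s g → Cost s ρ l → Cost s ρ z →
        (∀ {j x a} → x ∈ value l (ρ j) → size τ (value f (x ∷ a ∷ ρ j)) ≤ g j + size τ a) →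
        (∀ {J′ : Set} (h : J′ → J) (x : J′ → ⟦ σ ⟧) (a : J′ → ⟦ τ ⟧) →
          Bounded (s ∘ h) (size σ ∘ x) → Bounded (s ∘ h) (size τ ∘ a) →
          Cost (s ∘ h) (λ i → x i ∷ a i ∷ ρ (h i)) f) →
        Cost s ρ (fold l z f)
      growing-fold-cost {σ} {τ} {l} {z} {f} {g} cg cl cz h cf = fold-cost Inv cl cz (λ j → ≤-refl)
        (λ {j} {x} {k} x∈ k< i → ≤-trans (h x∈) (≤-trans (+-monoʳ-≤ (g j) i) (≤-reflexive (sym (+-assoc (g j) (k * g j) _)))))
        (cf index element acc
          (≤-bounded (λ i → size-∈ (element∈ i)) (reindex index (value-bounded cl)))
          (≤-bounded (λ i → ≤-trans (holds i) (+-monoˡ-≤ _ (*-monoˡ-≤ (g (index i)) (<⇒≤ (<-≤-trans (round< i) (length≤size (value l (ρ (index i)))))))))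
            (reindex index (+-bounded (*-bounded (value-bounded cl) cg) (value-bounded cz)))))
        where
        Inv : J → ℕ → ⟦ τ ⟧ → Set
        Inv j k a = size τ a ≤ k * g j + size τ (value z (ρ j))

-- Closed tours around trees.

module TreeTours where

  open import Data.Bool using (Bool; true; false; if_then_else_)
  open import Data.Fin using (suc)
  open import Data.Fin.Properties using (_≟_)
  open import Data.List using (List; []; _∷_; _++_; foldr)
  open import Data.List.Membership.Propositional using (_∈_; _∉_)
  open import Data.List.Relation.Unary.Any using (here; there)
  open import Data.List.Relation.Unary.All as All using (All; []; _∷_)
  open import Data.List.Relation.Unary.All.Properties using (¬Any⇒All¬; All¬⇒¬Any)
  open import Data.List.Relation.Unary.AllPairs using ([]; _∷_)
  open import Data.List.Relation.Unary.Unique.Propositional using (Unique)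
  open import Data.Nat using (ℕ; suc)
  open import Data.Product hiding (map)
  open import Data.Rational hiding (_≟_)
  open import Data.Rational.Properties hiding (_≟_)
  open import Data.Rational.Solver using (module +-*-Solver)
  open import Data.Sum using (_⊎_; inj₁; inj₂; [_,_]′)
  open import Function using (_∘_; id)
  open import Function.Bundles using (Equivalence)
  open import Relation.Binary.Construct.Closure.ReflexiveTransitive using (Star; ε; _◅_)
  open import Relation.Binary.PropositionalEquality
  open import Relation.Nullary
  open import Relation.Nullary.Decidable using (dec-true)

  0≤q-p : ∀ {p q} → p ≤ q → 0ℚ ≤ q - p
  0≤q-p {p} {q} h = ≤-trans (≤-reflexive (sym (+-inverseʳ p))) (+-monoˡ-≤ (- p) h)

  -- A linear inequality is proved by exhibiting the difference of its sides.
  by-difference : ∀ {p q} e → 0ℚ ≤ e → q ≡ p + e → p ≤ q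
  by-difference {p} e 0≤e eq = ≤-trans (≤-reflexive (sym (+-identityʳ p))) (≤-trans (+-monoʳ-≤ p 0≤e) (≤-reflexive (sym eq)))

  0≤+ : ∀ {p q} → 0ℚ ≤ p → 0ℚ ≤ q → 0ℚ ≤ p + q
  0≤+ = +-mono-≤

  0≤* : ∀ {p q} → 0ℚ ≤ p → 0ℚ ≤ q → 0ℚ ≤ p * q
  0≤* {p} {q} 0≤p 0≤q = ≤-trans (≤-reflexive (sym (*-zeroʳ p))) (*-monoˡ-≤-nonNeg p {{nonNegative 0≤p}} 0≤q)

  2ℚ : ℚ
  2ℚ = 1ℚ + 1ℚ

  sumOver : ∀ {A : Set} → (A → ℚ) → List A → ℚ
  sumOver f = foldr (λ x s → f x + s) 0ℚ

  sumOver-nonneg : ∀ {A : Set} {f : A → ℚ} xs → (∀ x → 0ℚ ≤ f x) → 0ℚ ≤ sumOver f xs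
  sumOver-nonneg []       h = ≤-refl
  sumOver-nonneg (x ∷ xs) h = 0≤+ (h x) (sumOver-nonneg xs h)

  sumOver-mono : ∀ {A : Set} {f g : A → ℚ} xs → (∀ x → f x ≤ g x) → sumOver f xs ≤ sumOver g xs
  sumOver-mono []       h = ≤-refl
  sumOver-mono (x ∷ xs) h = +-mono-≤ (h x) (sumOver-mono xs h)

  -- Mainly applied to the costs of missing edges after (`f`) and before (`g`) an insertion, where
  -- `e` is the edge that pays `c`.
  sumOver-drop : ∀ {A : Set} {f g : A → ℚ} {xs e} c → (∀ x → f x ≤ g x) → e ∈ xs → c + f e ≤ g e →
    c + sumOver f xs ≤ sumOver g xs
  sumOver-drop {xs = _ ∷ xs} c h (here refl) le =
    ≤-trans (≤-reflexive (sym (+-assoc c _ _))) (+-mono-≤ le (sumOver-mono xs h))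
  sumOver-drop {f = f} {xs = x ∷ xs} c h (there e∈) le =
    ≤-trans (≤-reflexive (solve 3 (λ c a s → c :+ (a :+ s) := a :+ (c :+ s)) refl c (f x) (sumOver f xs)))
      (+-mono-≤ (h x) (sumOver-drop c h e∈ le))
    where open +-*-Solver

  module _ {n : ℕ} where

    open import Data.List.Membership.DecPropositional (_≟_ {suc n}) using (_∈?_)

    private V = Vertex n

    -- Continuing past the first match makes this a `foldr`, the only loop of the program language,
    -- in which the rest of the list is seen only through the accumulator. On a duplicate-free list
    -- at most one insertion takes place.
    insertAfter : V → V → List V → List V
    insertAfter x y []      = []
    insertAfter x y (z ∷ w) = if does (x ≟ z) then z ∷ y ∷ insertAfter x y w else z ∷ insertAfter x y w

    attach : V → V → List V → List V
    attach x y w = if does (y ∈? w) then w else insertAfter x y w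

    -- Edges are listed in an arbitrary orientation, so both are tried.
    traverse : V × V → List V → List V
    traverse (x , y) w = attach y x (attach x y w)

    sweep : Edges n → List V → List V
    sweep E w = foldr traverse w E

    -- The second list is a counter: one sweep for each of its elements.
    sweeps : Edges n → Edges n → List V
    sweeps E = foldr (λ _ → sweep E) (root ∷ [])

    tour : Edges n → List V
    tour E = sweeps E E

    insertAfter-∉ : ∀ {x y w} → x ∉ w → insertAfter x y w ≡ w
    insertAfter-∉ {w = []}            x∉ = refl
    insertAfter-∉ {x} {y} {w = z ∷ w} x∉ with x ≟ z
    ... | yes refl = contradiction (here refl) x∉
    ... | no _     = cong (z ∷_) (insertAfter-∉ (x∉ ∘ there))

    insertAfter-All : ∀ {P : V → Set} {x y w} → P y → All P w → All P (insertAfter x y w)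
    insertAfter-All Py []                = []
    insertAfter-All {x = x} Py (_∷_ {z} Pz Pw) with does (x ≟ z)
    ... | true  = Pz ∷ Py ∷ insertAfter-All Py Pw
    ... | false = Pz ∷ insertAfter-All Py Pw

    insertAfter-unique : ∀ {x y w} → y ∉ w → Unique w → Unique (insertAfter x y w)
    insertAfter-unique y∉ []           = []
    insertAfter-unique {x} {y} y∉ (_∷_ {z} {w} z≢ uw) with x ≟ z
    ... | yes refl = subst (λ v → Unique (x ∷ y ∷ v)) (sym (insertAfter-∉ (All¬⇒¬Any z≢)))
                       (((y∉ ∘ here ∘ sym) ∷ z≢) ∷ ¬Any⇒All¬ _ (y∉ ∘ there) ∷ uw)
    ... | no _     = insertAfter-All (y∉ ∘ here ∘ sym) z≢ ∷ insertAfter-unique (y∉ ∘ there) uw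

    insertAfter-⊆ : ∀ {x y w v} → v ∈ w → v ∈ insertAfter x y w
    insertAfter-⊆ {x} {w = z ∷ w} v∈ with does (x ≟ z) | v∈
    ... | true  | here eq = here eq
    ... | true  | there p = there (there (insertAfter-⊆ p))
    ... | false | here eq = here eq
    ... | false | there p = there (insertAfter-⊆ p)

    insertAfter-∈ : ∀ {x y w} → x ∈ w → y ∈ insertAfter x y w
    insertAfter-∈ {x} {w = z ∷ w} x∈ with x ≟ z | x∈
    ... | yes _  | _       = there (here refl)
    ... | no x≢z | here eq = contradiction eq x≢z
    ... | no _   | there p = there (insertAfter-∈ p)

    attach-unique : ∀ {x y w} → Unique w → Unique (attach x y w)
    attach-unique {x} {y} {w} u with y ∈? w
    ... | yes _ = u
    ... | no y∉ = insertAfter-unique y∉ u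

    attach-⊆ : ∀ {x y w v} → v ∈ w → v ∈ attach x y w
    attach-⊆ {x} {y} {w} v∈ with does (y ∈? w)
    ... | true  = v∈
    ... | false = insertAfter-⊆ v∈

    traverse-unique : ∀ {e w} → Unique w → Unique (traverse e w)
    traverse-unique = attach-unique ∘ attach-unique

    traverse-⊆ : ∀ {e w v} → v ∈ w → v ∈ traverse e w
    traverse-⊆ = attach-⊆ ∘ attach-⊆

    sweep-unique : ∀ E {w} → Unique w → Unique (sweep E w)
    sweep-unique []      = id
    sweep-unique (e ∷ E) = traverse-unique ∘ sweep-unique E

    sweep-⊆ : ∀ E {w v} → v ∈ w → v ∈ sweep E w
    sweep-⊆ []      = id
    sweep-⊆ (e ∷ E) = traverse-⊆ ∘ sweep-⊆ E

    data Attached (x y : V) (w w′ : List V) : Set where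
      unchanged : (x ∈ w → y ∈ w) → w′ ≡ w → Attached x y w w′
      inserted  : x ∈ w → y ∉ w → w′ ≡ insertAfter x y w → Attached x y w w′

    attached : ∀ x y w → Attached x y w (attach x y w)
    attached x y w with y ∈? w
    ... | yes y∈ = unchanged (λ _ → y∈) refl
    ... | no y∉ with x ∈? w
    ...   | yes x∈ = inserted x∈ y∉ refl
    ...   | no x∉  = unchanged (λ x∈ → contradiction x∈ x∉) (insertAfter-∉ x∉)

    -- The tour cannot grow along such an edge, which lies wholly inside `w` or wholly outside.
    Settled : List V → V × V → Set
    Settled w (x , y) = (x ∈ w → y ∈ w) × (y ∈ w → x ∈ w)

    attach-settled : ∀ {x y w} → (x ∈ w → y ∈ w) → attach x y w ≡ w
    attach-settled {x} {y} {w} h with attached x y w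
    ... | unchanged _ eq   = eq
    ... | inserted x∈ y∉ _ = contradiction (h x∈) y∉

    sweep-settled : ∀ {w} E → All (Settled w) E → sweep E w ≡ w
    sweep-settled []            []              = refl
    sweep-settled {w} ((x , y) ∷ E) ((f , g) ∷ ss) = begin
      attach y x (attach x y (sweep E w))  ≡⟨ cong (attach y x ∘ attach x y) (sweep-settled E ss) ⟩
      attach y x (attach x y w)            ≡⟨ cong (attach y x) (attach-settled f) ⟩
      attach y x w                         ≡⟨ attach-settled g ⟩
      w                                    ∎
      where open ≡-Reasoning

    -- Summed over the edges, this has two uses. With unit costs it counts the edges not yet inside
    -- the tour; with doubled lengths it is the money still available for insertions.
    missing : (V × V → ℚ) → List V → V × V → ℚ
    missing c w (x , y) = if does (x ∈? w) then (if does (y ∈? w) then 0ℚ else c (x , y)) else c (x , y)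

    outstanding : (V × V → ℚ) → Edges n → List V → ℚ
    outstanding c E w = sumOver (missing c w) E

    module _ {c : V × V → ℚ} (c≥0 : ∀ e → 0ℚ ≤ c e) where

      missing-nonneg : ∀ w e → 0ℚ ≤ missing c w e
      missing-nonneg w (x , y) with does (x ∈? w) | does (y ∈? w)
      ... | true  | true  = ≤-refl
      ... | true  | false = c≥0 _
      ... | false | _     = c≥0 _

      missing-≤ : ∀ w e → missing c w e ≤ c e
      missing-≤ w (x , y) with does (x ∈? w) | does (y ∈? w)
      ... | true  | true  = c≥0 _
      ... | true  | false = ≤-refl
      ... | false | _     = ≤-refl

      missing-mono : ∀ {w w′} → (∀ {v} → v ∈ w → v ∈ w′) → ∀ e → missing c w′ e ≤ missing c w e
      missing-mono {w} {w′} ⊆ (x , y) with x ∈? w | y ∈? w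
      ... | no _   | _      = missing-≤ w′ (x , y)
      ... | yes _  | no _   = missing-≤ w′ (x , y)
      ... | yes x∈ | yes y∈ rewrite dec-true (x ∈? w′) (⊆ x∈) | dec-true (y ∈? w′) (⊆ y∈) = ≤-refl

      missing-∉ : ∀ {x y w} → x ∉ w ⊎ y ∉ w → missing c w (x , y) ≡ c (x , y)
      missing-∉ {x} {y} {w} h with x ∈? w | y ∈? w
      ... | no _   | _      = refl
      ... | yes _  | no _   = refl
      ... | yes x∈ | yes y∈ = contradiction h [ contradiction x∈ , contradiction y∈ ]′

      missing-∈ : ∀ {x y w} → x ∈ w → y ∈ w → missing c w (x , y) ≡ 0ℚ
      missing-∈ {x} {y} {w} x∈ y∈ rewrite dec-true (x ∈? w) x∈ | dec-true (y ∈? w) y∈ = refl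

      -- The edge used for the insertion passes from outside to inside, and the edges already inside
      -- stay there.
      outstanding-insert : ∀ {E u v w w′} → (u , v) ∈ E → (∀ {z} → z ∈ w → z ∈ w′) →
        u ∉ w ⊎ v ∉ w → u ∈ w′ → v ∈ w′ → c (u , v) + outstanding c E w′ ≤ outstanding c E w
      outstanding-insert {u = u} {v} {w} {w′} e∈ ⊆ h u∈ v∈ = sumOver-drop (c (u , v)) (missing-mono ⊆) e∈ (≤-reflexive (begin
        c (u , v) + missing c w′ (u , v)  ≡⟨ cong (c (u , v) +_) (missing-∈ u∈ v∈) ⟩
        c (u , v) + 0ℚ                    ≡⟨ +-identityʳ _ ⟩
        c (u , v)                         ≡⟨ missing-∉ h ⟨
        missing c w (u , v)               ∎))
        where open ≡-Reasoning

    -- A sweep that does not settle all edges moves an edge inside the list, so as many sweeps as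
    -- there are edges suffice.

    private
      unit : V × V → ℚ
      unit _ = 1ℚ

      0≤1 : ∀ (e : V × V) → 0ℚ ≤ 1ℚ
      0≤1 _ = from-yes (0ℚ ≤? 1ℚ)

    record Progress (E : Edges n) (w w′ : List V) : Set where
      constructor progress
      field decreases : 1ℚ + outstanding unit E w′ ≤ outstanding unit E w

    progress-trans : ∀ {E w w′ w″} → Progress E w w′ → (∀ {v} → v ∈ w′ → v ∈ w″) → Progress E w w″
    progress-trans {E} (progress p) ⊆ = progress (≤-trans (+-monoʳ-≤ 1ℚ (sumOver-mono E (missing-mono 0≤1 ⊆))) p)

    attach-progress : ∀ {E x y w} → Adjacent E x y → (x ∈ w → y ∈ w) ⊎ Progress E w (attach x y w)
    attach-progress {E} {x} {y} {w} adj with attached x y w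
    ... | unchanged h _ = inj₁ h
    ... | inserted x∈ y∉ eq rewrite eq = inj₂ (progress ([
        (λ e∈ → outstanding-insert 0≤1 e∈ insertAfter-⊆ (inj₂ y∉) (insertAfter-⊆ x∈) (insertAfter-∈ x∈)) ,
        (λ e∈ → outstanding-insert 0≤1 e∈ insertAfter-⊆ (inj₁ y∉) (insertAfter-∈ x∈) (insertAfter-⊆ x∈)) ]′ adj))

    sweep-progress : ∀ {E w} E′ → (∀ {e} → e ∈ E′ → e ∈ E) → All (Settled w) E′ ⊎ Progress E w (sweep E′ w)
    sweep-progress []            ⊆ = inj₁ []
    sweep-progress {E} {w} ((x , y) ∷ E′) ⊆ with sweep-progress {E} {w} E′ (⊆ ∘ there)
    ... | inj₂ p  = inj₂ (progress-trans p (traverse-⊆ {x , y}))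
    ... | inj₁ ss rewrite sweep-settled E′ ss with attach-progress {E} {x} {y} {w} (inj₁ (⊆ (here refl)))
    ...   | inj₂ p = inj₂ (progress-trans p (attach-⊆ {y} {x}))
    ...   | inj₁ f rewrite attach-settled {x} {y} {w} f with attach-progress {E} {y} {x} {w} (inj₂ (⊆ (here refl)))
    ...     | inj₂ p = inj₂ p
    ...     | inj₁ g = inj₁ ((f , g) ∷ ss)

    private
      -- A sweep leaves a settled tour alone, so the first alternative persists. Under the second,
      -- each sweep so far has moved an edge inside.
      rounds : ∀ {E} (ks : Edges n) → let w = sweeps E ks in
        All (Settled w) E ⊎ sumOver unit ks + outstanding unit E w ≤ sumOver unit E
      rounds {E} [] = inj₂ (≤-trans (≤-reflexive (+-identityˡ _)) (sumOver-mono E (missing-≤ 0≤1 (root ∷ []))))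
      rounds {E} (k ∷ ks) with rounds {E} ks
      ... | inj₁ ss rewrite sweep-settled E ss = inj₁ ss
      ... | inj₂ le with sweep-progress {E} {sweeps E ks} E id
      ...   | inj₁ ss rewrite sweep-settled E ss = inj₁ ss
      ...   | inj₂ (progress p) = inj₂ (≤-trans (≤-trans (≤-reflexive (assoc₁ 1ℚ (sumOver unit ks) _)) (+-monoʳ-≤ (sumOver unit ks) p)) le)
        where
        open +-*-Solver
        assoc₁ : ∀ a b c → (a + b) + c ≡ b + (a + c)
        assoc₁ = solve 3 (λ a b c → (a :+ b) :+ c := b :+ (a :+ c)) refl

      inside : ∀ {E w} → outstanding unit E w ≤ 0ℚ → ∀ {u v} → (u , v) ∈ E → ¬ (u ∉ w ⊎ v ∉ w)
      inside {E} {w} le {u} {v} e∈ h = contradiction (begin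
        1ℚ                          ≡⟨ +-identityʳ 1ℚ ⟨
        1ℚ + 0ℚ                     ≤⟨ +-monoʳ-≤ 1ℚ (sumOver-nonneg E (λ _ → ≤-refl)) ⟩
        1ℚ + sumOver (λ _ → 0ℚ) E   ≤⟨ sumOver-drop 1ℚ (missing-nonneg 0≤1 w) e∈
                                         (≤-reflexive (trans (+-identityʳ 1ℚ) (sym (missing-∉ 0≤1 h)))) ⟩
        outstanding unit E w        ≤⟨ le ⟩
        0ℚ                          ∎) (from-no (1ℚ ≤? 0ℚ))
        where open ≤-Reasoning

      exhausted : ∀ {E w} → outstanding unit E w ≤ 0ℚ → ∀ {u v} → (u , v) ∈ E → u ∈ w × v ∈ w
      exhausted {E} {w} le {u} {v} e∈ with u ∈? w | v ∈? w
      ... | yes p | yes q = p , q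
      ... | no p  | _     = contradiction (inj₁ p) (inside le e∈)
      ... | yes _ | no q  = contradiction (inj₂ q) (inside le e∈)

    tour-settled : ∀ E → All (Settled (tour E)) E
    tour-settled E with rounds {E} E
    ... | inj₁ ss = ss
    -- There were as many sweeps as edges, so no edge is left outside.
    ... | inj₂ le = All.tabulate λ e∈ → (λ _ → proj₂ (both e∈)) , (λ _ → proj₁ (both e∈))
      where
      both : ∀ {u v} → (u , v) ∈ E → u ∈ tour E × v ∈ tour E
      both = exhausted (by-difference _ (0≤q-p le) (solve 2 (λ a b → con 0ℚ := b :+ (a :- (a :+ b))) refl (sumOver unit E) (outstanding unit E (tour E))))
        where open +-*-Solver

    sweeps-root : ∀ E ks → root ∈ sweeps E ks
    sweeps-root E []       = here refl
    sweeps-root E (_ ∷ ks) = sweep-⊆ E (sweeps-root E ks)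

    sweeps-unique : ∀ E ks → Unique (sweeps E ks)
    sweeps-unique E []       = [] ∷ []
    sweeps-unique E (_ ∷ ks) = sweep-unique E (sweeps-unique E ks)

    tour-unique : ∀ E → Unique (tour E)
    tour-unique E = sweeps-unique E E

    -- The root is on the tour, and a settled edge with one end on the tour has both ends there, so
    -- membership spreads along every path of tree edges from the root.
    tour-spans : ∀ {E v} → IsTree E → v ∈ spanned E → v ∈ tour E
    tour-spans {E} t v∈ = go (sweeps-root E E) (IsTree.connected t v∈)
      where
      go : ∀ {u v} → u ∈ tour E → Star (Adjacent E) u v → v ∈ tour E
      go u∈ ε             = u∈
      go u∈ (inj₁ e ◅ es) = go (proj₁ (All.lookup (tour-settled E) e) u∈) es
      go u∈ (inj₂ e ◅ es) = go (proj₂ (All.lookup (tour-settled E) e) u∈) es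

  module _ {n : ℕ} (d : Metric n) where

    open Metric d using (dist≡0; dist-sym; triangle)

    private
      V = Vertex n
      D = dist d

    dist-self : ∀ u → D u u ≡ 0ℚ
    dist-self u = Equivalence.from (dist≡0 u u) refl

    -- Going from `u` to `v` and back is no shorter than staying at `u`, so `0 ≤ D u v + D v u`, and
    -- by symmetry the summands are equal.
    dist-nonneg : ∀ u v → 0ℚ ≤ D u v
    dist-nonneg u v with ≤-total 0ℚ (D u v)
    ... | inj₁ h = h
    ... | inj₂ h = ≤-trans (≤-reflexive (sym (dist-self u))) (≤-trans (triangle u v u)
      (≤-trans (+-mono-≤ h (≤-reflexive (dist-sym v u))) (≤-reflexive (+-identityˡ _))))

    closed : V → List V → ℚ
    closed u []      = D u root
    closed u (v ∷ w) = D u v + closed v w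

    closed-nonneg : ∀ u w → 0ℚ ≤ closed u w
    closed-nonneg u []      = dist-nonneg u root
    closed-nonneg u (v ∷ w) = 0≤+ (dist-nonneg u v) (closed-nonneg v w)

    closed-detour : ∀ u v w → closed u w ≤ D u v + closed v w
    closed-detour u v []      = triangle u v root
    closed-detour u v (z ∷ w) = ≤-trans (+-monoˡ-≤ _ (triangle u v z)) (≤-reflexive (+-assoc (D u v) _ _))

    -- A detour through the root between the two lists can only lengthen the walk, and it splits it
    -- into two closed parts.
    closed-++ : ∀ u w w′ → closed u (w ++ w′) ≤ closed u w + closed root w′
    closed-++ u []      w′ = closed-detour u root w′
    closed-++ u (v ∷ w) w′ = ≤-trans (+-monoʳ-≤ (D u v) (closed-++ v w w′)) (≤-reflexive (sym (+-assoc (D u v) _ _)))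

    -- From `y` the walk may return to `x` and go on as before, so the insertion costs at most the
    -- edge in both directions.
    closed-insertAfter : ∀ u {x y w} → Unique w → x ∈ w →
      closed u (insertAfter x y w) ≤ 2ℚ * D x y + closed u w
    closed-insertAfter u {x} {y} {z ∷ w} (z≢ ∷ uw) x∈ with x ≟ z | x∈
    ... | yes refl | _       rewrite insertAfter-∉ {y = y} (All¬⇒¬Any z≢) =
      by-difference _ (0≤+ (0≤q-p (≤-reflexive (dist-sym y x))) (0≤q-p (closed-detour y x w)))
        (solve 6 (λ a b c e f g → (con 1ℚ :+ con 1ℚ) :* b :+ (a :+ e) := (a :+ (b :+ f)) :+ ((b :- c) :+ (c :+ e :- f)))
          refl (D u x) (D x y) (D y x) (closed x w) (closed y w) 0ℚ)
      where open +-*-Solver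
    ... | no x≢z   | here eq = contradiction eq x≢z
    ... | no _     | there p = ≤-trans (+-monoʳ-≤ (D u z) (closed-insertAfter z uw p))
      (≤-reflexive (solve 3 (λ a b c → a :+ (b :+ c) := b :+ (a :+ c)) refl (D u z) (2ℚ * D x y) (closed z w)))
      where open +-*-Solver

    private
      double : V × V → ℚ
      double (x , y) = 2ℚ * D x y

      double≥0 : ∀ e → 0ℚ ≤ double e
      double≥0 (x , y) = 0≤* (from-yes (0ℚ ≤? 2ℚ)) (dist-nonneg x y)

    -- Twice the length of an edge is set aside until the edge is inside the tour. An insertion
    -- spends at most this amount, so the total never grows; at the start it is at most twice the
    -- length of the tree.
    budget : Edges n → List V → ℚ
    budget E w = closed root w + outstanding double E w

    attach-budget : ∀ {E x y w} → Unique w → Adjacent E x y → budget E (attach x y w) ≤ budget E w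
    attach-budget {E} {x} {y} {w} u adj with attached x y w
    ... | unchanged _ eq rewrite eq = ≤-refl
    ... | inserted x∈ y∉ eq rewrite eq =
      by-difference _ (0≤+ (0≤q-p (closed-insertAfter root u x∈)) (0≤q-p drop))
        (solve 5 (λ b a a′ o o′ → a :+ o := (a′ :+ o′) :+ ((b :+ a :- a′) :+ (o :- (b :+ o′)))) refl
          (2ℚ * D x y) (closed root w) (closed root (insertAfter x y w)) (outstanding double E w) (outstanding double E (insertAfter x y w)))
      where
      open +-*-Solver
      drop : 2ℚ * D x y + outstanding double E (insertAfter x y w) ≤ outstanding double E w
      drop = [ (λ e∈ → outstanding-insert double≥0 e∈ insertAfter-⊆ (inj₂ y∉) (insertAfter-⊆ x∈) (insertAfter-∈ x∈)) ,
               (λ e∈ → ≤-trans (≤-reflexive (cong (λ a → 2ℚ * a + outstanding double E (insertAfter x y w)) (dist-sym x y)))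
                 (outstanding-insert double≥0 e∈ insertAfter-⊆ (inj₁ y∉) (insertAfter-∈ x∈) (insertAfter-⊆ x∈))) ]′ adj

    sweep-budget : ∀ {E w} E′ → (∀ {e} → e ∈ E′ → e ∈ E) → Unique w → budget E (sweep E′ w) ≤ budget E w
    sweep-budget             []            ⊆ u = ≤-refl
    sweep-budget {E} {w} ((x , y) ∷ E′) ⊆ u =
      ≤-trans (attach-budget {E} {y} {x} (attach-unique {x = x} (sweep-unique E′ u)) (inj₂ (⊆ (here refl))))
        (≤-trans (attach-budget {E} {x} {y} (sweep-unique E′ u) (inj₁ (⊆ (here refl)))) (sweep-budget E′ (⊆ ∘ there) u))

    tour-closed : ∀ E → closed root (tour E) ≤ 2ℚ * treeLength d E
    tour-closed E = ≤-trans (by-difference _ (sumOver-nonneg E (missing-nonneg double≥0 (tour E))) refl) (go E)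
      where
      total : ∀ E → sumOver double E ≡ 2ℚ * treeLength d E
      total []            = sym (*-zeroʳ 2ℚ)
      total ((x , y) ∷ E) = trans (cong (2ℚ * D x y +_) (total E)) (sym (*-distribˡ-+ 2ℚ (D x y) (treeLength d E)))

      go : ∀ ks → budget E (sweeps E ks) ≤ 2ℚ * treeLength d E
      go []       = ≤-trans (+-mono-≤ (≤-reflexive (cong (λ a → a + a) (dist-self root))) (sumOver-mono E (missing-≤ double≥0 (root ∷ []))))
        (≤-reflexive (trans (+-identityˡ _) (total E)))
      go (_ ∷ ks) = ≤-trans (sweep-budget E id (sweeps-unique E ks)) (go ks)

-- Latencies, the potential and the approximation ratio.

module Latency where

  open TreeTours
  import Data.Rational
  open import Algebra.Definitions.RawMonoid Data.Rational.+-0-rawMonoid using (sum)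
  open import Data.Bool using (Bool; true; false; if_then_else_)
  open import Data.Fin using (Fin; zero; suc)
  open import Data.Fin.Properties using (_≟_)
  open import Data.List using (List; []; _∷_; _++_)
  open import Data.List.Membership.Propositional using (_∈_; _∉_; find; lose)
  open import Data.List.Relation.Unary.Any using (Any; here; there; any?)
  open import Data.List.Relation.Unary.Any.Properties using (++⁺ˡ)
  open import Data.List.Membership.Propositional.Properties using (∈-++⁺ˡ; ∈-++⁺ʳ)
  open import Data.List.Relation.Unary.All using (All; []; _∷_)
  open import Data.List.Relation.Unary.AllPairs using ([]; _∷_)
  open import Data.List.Relation.Unary.Unique.Propositional using (Unique)
  import Data.List.Relation.Unary.Unique.Propositional.Properties as Unique
  open import Data.Nat using (ℕ; zero; suc)
  open import Data.Product hiding (map)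
  open import Data.Rational hiding (_≟_)
  open import Data.Rational.Properties hiding (_≟_)
  open import Data.Rational.Solver using (module +-*-Solver)
  open import Function using (_∘_)
  open import Level using (0ℓ)
  open import Relation.Binary.PropositionalEquality
  open import Relation.Nullary
  open import Relation.Nullary.Decidable using (dec-true; dec-false)
  open import Relation.Unary using (Pred; Decidable)

  sum-mono : ∀ {m} {f g : Fin m → ℚ} → (∀ j → f j ≤ g j) → sum f ≤ sum g
  sum-mono {zero}  h = ≤-refl
  sum-mono {suc m} h = +-mono-≤ (h zero) (sum-mono (h ∘ suc))

  sum-+ : ∀ {m} (f g : Fin m → ℚ) → sum (λ j → f j + g j) ≡ sum f + sum g
  sum-+ {zero}  f g = sym (+-identityʳ 0ℚ)
  sum-+ {suc m} f g = trans (cong (f zero + g zero +_) (sum-+ (f ∘ suc) (g ∘ suc)))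
    (solve 4 (λ a b c e → (a :+ b) :+ (c :+ e) := (a :+ c) :+ (b :+ e)) refl (f zero) (g zero) (sum (f ∘ suc)) (sum (g ∘ suc)))
    where open +-*-Solver

  sum-* : ∀ {m} c (f : Fin m → ℚ) → sum (λ j → c * f j) ≡ c * sum f
  sum-* {zero}  c f = sym (*-zeroʳ c)
  sum-* {suc m} c f = trans (cong (c * f zero +_) (sum-* c (f ∘ suc))) (sym (*-distribˡ-+ c _ _))

  sum-nonneg : ∀ {m} {f : Fin m → ℚ} → (∀ j → 0ℚ ≤ f j) → 0ℚ ≤ sum f
  sum-nonneg {zero}  h = ≤-refl
  sum-nonneg {suc m} h = 0≤+ (h zero) (sum-nonneg (h ∘ suc))

  0≤1ℚ : 0ℚ ≤ 1ℚ
  0≤1ℚ = from-yes (0ℚ ≤? 1ℚ)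

  0≤2ℚ : 0ℚ ≤ 2ℚ
  0≤2ℚ = from-yes (0ℚ ≤? 2ℚ)

  -- The first scale costs 4 ρ γ and the others cost 8 K γ, where K ≤ 4 ρ.
  36ℚ : ℚ
  36ℚ = 2ℚ * 2ℚ * (1ℚ + 2ℚ * (2ℚ * 2ℚ))

  -- `natℚ (suc k)` unfolds to the very sum with which the solver equation in `call-step` is
  -- written.
  natℚ : ℕ → ℚ
  natℚ zero    = 0ℚ
  natℚ (suc k) = natℚ k + 1ℚ

  natℚ-nonneg : ∀ k → 0ℚ ≤ natℚ k
  natℚ-nonneg zero    = ≤-refl
  natℚ-nonneg (suc k) = 0≤+ (natℚ-nonneg k) 0≤1ℚ

  -- A copy of _≤?_ that does not unfold, so that one can abstract over its values.
  abstract
    _≤??_ : ∀ p q → Dec (p ≤ q)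
    _≤??_ = _≤?_

  module _ {n : ℕ} where

    open import Data.List.Membership.DecPropositional (_≟_ {suc n}) using (_∈?_)

    private V = Vertex n

    new : List V → List V → List V
    new P []      = []
    new P (v ∷ w) = if does (v ∈? P) then new P w else v ∷ new P w

    extend : List V → List V → List V
    extend P w = P ++ new P w

    new-All : ∀ {R : V → Set} {P w} → All R w → All R (new P w)
    new-All [] = []
    new-All {P = P} (_∷_ {v} r rs) with does (v ∈? P)
    ... | true  = new-All rs
    ... | false = r ∷ new-All rs

    new-unique : ∀ P {w} → Unique w → Unique (new P w)
    new-unique P []                  = []
    new-unique P (_∷_ {v} v≢ u) with does (v ∈? P)
    ... | true  = new-unique P u
    ... | false = new-All v≢ ∷ new-unique P u

    new-∉ : ∀ {P} w {v} → v ∈ P → v ∉ new P w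
    new-∉ {P} (x ∷ w) v∈ v∈new with x ∈? P | v∈new
    ... | yes _ | p         = new-∉ w v∈ p
    ... | no x∉ | here refl = x∉ v∈
    ... | no _  | there p   = new-∉ w v∈ p

    ∈-new : ∀ {P w v} → v ∈ w → v ∉ P → v ∈ new P w
    ∈-new {P} {x ∷ w} v∈ v∉ with x ∈? P | v∈
    ... | yes x∈ | here refl = contradiction x∈ v∉
    ... | yes _  | there p   = ∈-new p v∉
    ... | no _   | here refl = here refl
    ... | no _   | there p   = there (∈-new p v∉)

    extend-unique : ∀ {P w} → Unique P → Unique w → Unique (extend P w)
    extend-unique {P} {w} uP uw = Unique.++⁺ uP (new-unique P uw) λ { (v∈ , v∈new) → new-∉ w v∈ v∈new }

    ⊆-extend : ∀ {P w v} → v ∈ w → v ∈ extend P w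
    ⊆-extend {P} {w} {v} v∈ with v ∈? P
    ... | yes p = ∈-++⁺ˡ p
    ... | no ¬p = ∈-++⁺ʳ P (∈-new v∈ ¬p)

    dropRoot : List V → List V
    dropRoot []      = []
    dropRoot (v ∷ w) = if does (root ≟ v) then dropRoot w else v ∷ dropRoot w

    dropRoot-All : ∀ {R : V → Set} {w} → All R w → All R (dropRoot w)
    dropRoot-All [] = []
    dropRoot-All (_∷_ {v} r rs) with does (root ≟ v)
    ... | true  = dropRoot-All rs
    ... | false = r ∷ dropRoot-All rs

    dropRoot-unique : ∀ {w} → Unique w → Unique (dropRoot w)
    dropRoot-unique []              = []
    dropRoot-unique (_∷_ {v} v≢ u) with does (root ≟ v)
    ... | true  = dropRoot-unique u
    ... | false = dropRoot-All v≢ ∷ dropRoot-unique u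

    dropRoot-root : ∀ w → All (root ≢_) (dropRoot w)
    dropRoot-root []      = []
    dropRoot-root (v ∷ w) with root ≟ v
    ... | yes _ = dropRoot-root w
    ... | no r≢ = r≢ ∷ dropRoot-root w

    dropRoot-path : ∀ {w} → Unique w → IsPath (dropRoot w)
    dropRoot-path {w} u = dropRoot-root w ∷ dropRoot-unique u

    ∈-dropRoot : ∀ {w v} → v ∈ w → root ≢ v → v ∈ dropRoot w
    ∈-dropRoot {x ∷ w} v∈ r≢ with root ≟ x | v∈
    ... | yes r≡ | here refl = contradiction r≡ r≢
    ... | yes _  | there p   = ∈-dropRoot p r≢
    ... | no _   | here refl = here refl
    ... | no _   | there p   = there (∈-dropRoot p r≢)

  module _ {n : ℕ} (d : Metric n) where

    open import Data.List.Membership.DecPropositional (_≟_ {suc n}) using (_∈?_)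
    open Metric d using (triangle; dist-sym)

    private
      V = Vertex n
      D = dist d

    -- Vertices visited before are skipped, and by the triangle inequality a shortcut does not
    -- lengthen the walk.
    closed-new : ∀ P u w → closed d u (new P w) ≤ closed d u w
    closed-new P u []      = ≤-refl
    closed-new P u (v ∷ w) with does (v ∈? P)
    ... | true  = ≤-trans (closed-new P u w) (closed-detour d u v w)
    ... | false = +-monoʳ-≤ (D u v) (closed-new P v w)

    closed-extend : ∀ P w → closed d root (extend P w) ≤ closed d root P + closed d root w
    closed-extend P w = ≤-trans (closed-++ d root P (new P w)) (+-monoʳ-≤ (closed d root P) (closed-new P root w))

    -- The walk is compared with the one that returns to the root after every vertex.
    closed-star : ∀ u w → closed d u w ≤ D root u + 2ℚ * sumOver (D root) w
    closed-star u []      = ≤-reflexive (trans (dist-sym u root) (solve 1 (λ a → a := a :+ con 2ℚ :* con 0ℚ) refl (D root u)))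
      where open +-*-Solver
    closed-star u (v ∷ w) = by-difference _ (0≤+ (0≤q-p (triangle u root v)) (0≤+ (0≤q-p (closed-star v w)) (0≤q-p (≤-reflexive (dist-sym u root)))))
      (solve 6 (λ ru rv s uv ur c → ru :+ con 2ℚ :* (rv :+ s) := (uv :+ c) :+ ((ur :+ rv :- uv) :+ ((rv :+ con 2ℚ :* s :- c) :+ (ru :- ur))))
        refl (D root u) (D root v) (sumOver (D root) w) (D u v) (D u root) (closed d v w))
      where open +-*-Solver

    module _ {C : V → Set} (C? : Decidable C) where

      -- Unlike lengthUntil, this charges the return to the root if C is not met.
      closedUntil : V → List V → ℚ
      closedUntil u []      = D u root
      closedUntil u (v ∷ w) = D u v + (if does (C? v) then 0ℚ else closedUntil v w)

      closedUntil-≤ : ∀ u w → closedUntil u w ≤ closed d u w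
      closedUntil-≤ u []      = ≤-refl
      closedUntil-≤ u (v ∷ w) with does (C? v)
      ... | true  = +-monoʳ-≤ (D u v) (closed-nonneg d v w)
      ... | false = +-monoʳ-≤ (D u v) (closedUntil-≤ v w)

      closedUntil-¬ : ∀ u {w} → ¬ Any C w → closedUntil u w ≡ closed d u w
      closedUntil-¬ u {[]}    ¬c = refl
      closedUntil-¬ u {v ∷ w} ¬c with C? v
      ... | yes c = contradiction (here c) ¬c
      ... | no _  = cong (D u v +_) (closedUntil-¬ v (¬c ∘ there))

      closedUntil-++ : ∀ u {w} w′ → Any C w → closedUntil u (w ++ w′) ≡ closedUntil u w
      closedUntil-++ u {v ∷ w} w′ c with C? v | c
      ... | yes _ | _       = refl
      ... | no ¬c | here c′ = contradiction c′ ¬c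
      ... | no _  | there p = cong (D u v +_) (closedUntil-++ v w′ p)

      closedUntil-detour : ∀ u v w → closedUntil u w ≤ D u v + closedUntil v w
      closedUntil-detour u v []      = triangle u v root
      closedUntil-detour u v (z ∷ w) = ≤-trans (+-monoˡ-≤ _ (triangle u v z)) (≤-reflexive (+-assoc (D u v) _ _))

      -- Dropping the root is a shortcut, and if `C` is never met, `lengthUntil` ends before the
      -- return that `closedUntil` charges. This passes from the bookkeeping quantity to the latency
      -- of the actual path.
      lengthUntil-dropRoot : ¬ C root → ∀ u w → lengthUntil d C? u (dropRoot w) ≤ closedUntil u w
      lengthUntil-dropRoot ¬c u []      = dist-nonneg d u root
      lengthUntil-dropRoot ¬c u (v ∷ w) with root ≟ v
      ... | yes refl rewrite dec-false (C? root) ¬c =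
        ≤-trans (lengthUntil-dropRoot ¬c u w) (closedUntil-detour u root w)
      ... | no _ with does (C? v)
      ...   | true  = ≤-refl
      ...   | false = +-monoʳ-≤ (D u v) (lengthUntil-dropRoot ¬c v w)

      lengthUntil-nonneg : ∀ u w → 0ℚ ≤ lengthUntil d C? u w
      lengthUntil-nonneg u []      = ≤-refl
      lengthUntil-nonneg u (v ∷ w) with does (C? v)
      ... | true  = 0≤+ (dist-nonneg d u v) ≤-refl
      ... | false = 0≤+ (dist-nonneg d u v) (lengthUntil-nonneg v w)

    prefix : V → List V → ℚ → List V
    prefix u []      B = []
    prefix u (v ∷ q) B = if does (D u v ≤?? B) then v ∷ prefix v q (B - D u v) else []

    prefix-All : ∀ {R : V → Set} u {q} B → All R q → All R (prefix u q B)
    prefix-All u B []                = []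
    prefix-All u B (_∷_ {v} r rs) with does (D u v ≤?? B)
    ... | true  = r ∷ prefix-All v _ rs
    ... | false = []

    prefix-unique : ∀ u {q} B → Unique q → Unique (prefix u q B)
    prefix-unique u B []               = []
    prefix-unique u B (_∷_ {v} v≢ uq) with does (D u v ≤?? B)
    ... | true  = prefix-All v _ v≢ ∷ prefix-unique v _ uq
    ... | false = []

    prefix-length : ∀ u q {B} → 0ℚ ≤ B → walkLength d u (prefix u q B) ≤ B
    prefix-length u []          0≤B = 0≤B
    prefix-length u (v ∷ q) {B} 0≤B with D u v ≤?? B
    ... | no _  = 0≤B
    ... | yes h = ≤-trans (+-monoʳ-≤ (D u v) (prefix-length v q (0≤q-p h)))
      (≤-reflexive (solve 2 (λ a b → a :+ (b :- a) := b) refl (D u v) B))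
      where open +-*-Solver

    -- If the next edge exceeded the budget, so would the length up to the first vertex in `C`,
    -- since the lengths after that edge are nonnegative.
    prefix-meets : ∀ {C : V → Set} (C? : Decidable C) u {q B} → Any C q → lengthUntil d C? u q ≤ B → Any C (prefix u q B)
    prefix-meets C? u {v ∷ q} {B} c le with D u v ≤?? B
    ... | no ¬h = contradiction (≤-trans (≤-trans (≤-reflexive (sym (+-identityʳ _))) (+-monoʳ-≤ (D u v) (nn (does (C? v))))) le) ¬h
      where
      nn : ∀ b → 0ℚ ≤ (if b then 0ℚ else lengthUntil d C? v q)
      nn true  = ≤-refl
      nn false = lengthUntil-nonneg C? v q
    ... | yes h with C? v | c
    ...   | yes c′ | _       = here c′
    ...   | no ¬c  | here c′ = contradiction c′ ¬c
    ...   | no _   | there p = there (prefix-meets C? v p (by-difference _ (0≤q-p le)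
        (solve 3 (λ a b l → b :- a := l :+ (b :- (a :+ l))) refl (D u v) B (lengthUntil d C? v q))))
        where open +-*-Solver

  module Covering {n : ℕ} (d : Metric n) {m : ℕ} (C : Fin m → Pred (Vertex n) 0ℓ) (C? : ∀ j → Decidable (C j))
    (root-∉ : ∀ j → ¬ C j root) where

    private V = Vertex n

    covers : Fin m → List V → Bool
    covers j vs = does (any? (C? j) vs)

    reward : List V → Fin m → ℚ
    reward P j = if covers j P then 0ℚ else 1ℚ

    gain : List V → List V → ℚ
    gain P vs = sum (λ j → if covers j vs then reward P j else 0ℚ)

    uncovered : List V → ℚ
    uncovered P = sum (reward P)

    lat : List V → ℚ
    lat P = sum (λ j → closedUntil d (C? j) root P)

    opt : List V → Fin m → ℚ
    opt q j = lengthUntil d (C? j) root q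

    latencyOf : List V → ℚ
    latencyOf q = sum (opt q)

    late : ℚ → ℚ → ℚ
    late B x = if does (x ≤?? B) then 0ℚ else 1ℚ

    remaining : ℚ → List V → ℚ
    remaining B q = sum (λ j → late B (opt q j))

    -- The guarantee of the oracle for the query made at `P`, expressed through the elements to be
    -- covered so that both problems share it.
    record Serves (ρ γ B : ℚ) (P : List V) (T : Edges n) : Set where
      field
        tree      : IsTree T
        short     : treeLength d T ≤ γ * B
        rewarding : ∀ p → IsPath p → walkLength d root p ≤ B → gain P (root ∷ p) ≤ ρ * gain P (spanned T)

    if-nonneg : ∀ b {x y} → 0ℚ ≤ x → 0ℚ ≤ y → 0ℚ ≤ (if b then x else y)
    if-nonneg true  x y = x
    if-nonneg false x y = y

    reward-nonneg : ∀ P j → 0ℚ ≤ reward P j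
    reward-nonneg P j = if-nonneg (covers j P) ≤-refl 0≤1ℚ

    uncovered-nonneg : ∀ P → 0ℚ ≤ uncovered P
    uncovered-nonneg P = sum-nonneg (reward-nonneg P)

    -- An element met by `P` keeps its latency. For any other, `closedUntil` is the closed length of
    -- `P`, to which the appended walk adds at most `L`.
    lat-extend : ∀ {L} P w → closed d root w ≤ L → lat (extend P w) ≤ lat P + L * uncovered P
    lat-extend {L} P w le = ≤-trans (sum-mono pointwise)
      (≤-reflexive (trans (sum-+ (λ j → closedUntil d (C? j) root P) (λ j → L * reward P j)) (cong (lat P +_) (sum-* L (reward P)))))
      where
      pointwise : ∀ j → closedUntil d (C? j) root (extend P w) ≤ closedUntil d (C? j) root P + L * reward P j
      pointwise j with any? (C? j) P
      ... | yes c = ≤-reflexive (trans (closedUntil-++ d (C? j) root (new P w) c)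
                      (sym (trans (cong (closedUntil d (C? j) root P +_) (*-zeroʳ L)) (+-identityʳ _))))
      ... | no ¬c rewrite closedUntil-¬ d (C? j) root ¬c | *-identityʳ L =
        ≤-trans (closedUntil-≤ d (C? j) root (extend P w)) (≤-trans (closed-extend d P w) (+-monoʳ-≤ (closed d root P) le))

    -- The gain counts only elements that `P` misses and `T` meets, and those are covered
    -- afterwards.
    uncovered-extend : ∀ P w T → (∀ {v} → v ∈ T → v ∈ w) → uncovered (extend P w) + gain P T ≤ uncovered P
    uncovered-extend P w T ⊆ = ≤-trans (≤-reflexive (sym (sum-+ (reward (extend P w)) _))) (sum-mono pointwise)
      where
      covered : ∀ {j} → Any (C j) T → Any (C j) (extend P w)
      covered c with find c
      ... | v , v∈ , Cv = lose (⊆-extend {P = P} (⊆ v∈)) Cv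

      pointwise : ∀ j → reward (extend P w) j + (if covers j T then reward P j else 0ℚ) ≤ reward P j
      pointwise j with any? (C? j) P
      ... | yes c rewrite dec-true (any? (C? j) (extend P w)) (++⁺ˡ c) = zero-if (covers j T)
        where
        zero-if : ∀ b → 0ℚ + (if b then 0ℚ else 0ℚ) ≤ 0ℚ
        zero-if true  = ≤-refl
        zero-if false = ≤-refl
      ... | no _ with any? (C? j) T
      ...   | yes c rewrite dec-true (any? (C? j) (extend P w)) (covered c) = ≤-refl
      ...   | no _ = at-most (covers j (extend P w))
        where
        at-most : ∀ b → (if b then 0ℚ else 1ℚ) + 0ℚ ≤ 1ℚ
        at-most true  = 0≤1ℚ
        at-most false = ≤-refl

    gain-nonneg : ∀ P T → 0ℚ ≤ gain P T
    gain-nonneg P T = sum-nonneg λ j → if-nonneg (covers j T) (reward-nonneg P j) ≤-refl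

    FeasiblePath : List V → Set
    FeasiblePath q = IsPath q × (∀ j → Any (C j) q)

    -- An uncovered element either is late on `q` or is met by the prefix, which then collects its
    -- reward.
    prefix-gain : ∀ {q} B P → FeasiblePath q →
      uncovered P ≤ remaining B q + gain P (root ∷ prefix d root q B)
    prefix-gain {q} B P (_ , meets) = ≤-trans (sum-mono pointwise) (≤-reflexive (sum-+ (λ j → late B (opt q j)) _))
      where
      p = prefix d root q B
      pointwise : ∀ j → reward P j ≤ late B (opt q j) + (if covers j (root ∷ p) then reward P j else 0ℚ)
      pointwise j with opt q j ≤?? B
      ... | yes h rewrite dec-true (any? (C? j) (root ∷ p)) (there (prefix-meets d (C? j) root (meets j) h)) =
        ≤-reflexive (sym (+-identityˡ _))
      ... | no _ = ≤-trans (one (covers j P)) (≤-trans (≤-reflexive (sym (+-identityʳ 1ℚ))) (+-monoʳ-≤ 1ℚ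
          (if-nonneg (covers j (root ∷ p)) (reward-nonneg P j) ≤-refl)))
        where
        one : ∀ b → (if b then 0ℚ else 1ℚ) ≤ 1ℚ
        one true  = 0≤1ℚ
        one false = ≤-refl

    prefix-path : ∀ {q} B → IsPath q → IsPath (prefix d root q B)
    prefix-path B (r≢ ∷ u) = prefix-All d root B r≢ ∷ prefix-unique d root B u

    module _ {ρ γ : ℚ} (1≤ρ : 1ℚ ≤ ρ) (1≤γ : 1ℚ ≤ γ) where

      0≤ρ : 0ℚ ≤ ρ
      0≤ρ = ≤-trans 0≤1ℚ 1≤ρ

      0≤γ : 0ℚ ≤ γ
      0≤γ = ≤-trans 0≤1ℚ 1≤γ

      module _ {B : ℚ} (0≤B : 0ℚ ≤ B) {P : List V} {T : Edges n} (s : Serves ρ γ B P T) where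

        open Serves s

        P′ : List V
        P′ = extend P (tour T)

        call-lat : lat P′ ≤ lat P + 2ℚ * (γ * B) * uncovered P
        call-lat = lat-extend P (tour T) (≤-trans (tour-closed d T) (*-monoˡ-≤-nonNeg 2ℚ short))

        call-gain : uncovered P′ + gain P (spanned T) ≤ uncovered P
        call-gain = uncovered-extend P (tour T) (spanned T) (tour-spans tree)

        call-uncovered-≤ : uncovered P′ ≤ uncovered P
        call-uncovered-≤ = ≤-trans (≤-trans (≤-reflexive (sym (+-identityʳ _))) (+-monoʳ-≤ (uncovered P′) (gain-nonneg P (spanned T)))) call-gain

        call-uncovered : ∀ {q} → FeasiblePath q → uncovered P ≤ remaining B q + ρ * (uncovered P - uncovered P′)
        call-uncovered {q} f = ≤-trans (prefix-gain B P f) (+-monoʳ-≤ (remaining B q)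
          (≤-trans (rewarding _ (prefix-path B (proj₁ f)) (prefix-length d root q 0≤B))
            (*-monoˡ-≤-nonNeg ρ {{nonNegative 0≤ρ}} (by-difference _ (0≤q-p call-gain)
              (solve 3 (λ u u′ g → u :- u′ := g :+ (u :- (u′ :+ g))) refl (uncovered P) (uncovered P′) (gain P (spanned T)))))))
          where open +-*-Solver

      potential : ℚ → List V → ℚ
      potential B P = lat P + 2ℚ * 2ℚ * (γ * (ρ * B)) * uncovered P

      -- The invariant of k calls with bound B, started at potential c.
      record WithinScale (B : ℚ) (q : List V) (c : ℚ) (k : ℕ) (P : List V) : Set where
        constructor withinScale
        field bound : potential B P + 2ℚ * (γ * B) * (natℚ k * uncovered P)
                      ≤ c + natℚ k * (2ℚ * 2ℚ * (γ * B) * remaining B q)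

      -- A call raises the latency by at most `2 γ B u` and lowers the other term of the potential
      -- by at least `4 γ B (u - r)`. So it releases `2 γ B u`, up to the charge `4 γ B r`. As `u`
      -- never increases, `k` calls have released at least `2 γ B k` times its present value, which
      -- is the credit kept in the invariant.
      call-step : ∀ {B q c k P T} → 0ℚ ≤ B → FeasiblePath q → Serves ρ γ B P T →
        WithinScale B q c k P → WithinScale B q c (suc k) (extend P (tour T))
      call-step {B} {q} {c} {k} {P} {T} 0≤B f s (withinScale le) = withinScale (by-difference _
        -- The slack consists of the slack of the previous invariant, that of the latency bound,
        -- `4 γ B` times that of the bound on `u`, and the decrease of `u` inside the credit.
        (0≤+ (0≤q-p le) (0≤+ (0≤q-p (call-lat 0≤B s)) (0≤+
          (0≤* (0≤* (0≤* 0≤2ℚ 0≤2ℚ) 0≤γB) (0≤q-p (call-uncovered 0≤B s f)))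
          (0≤* (0≤* 0≤2ℚ 0≤γB) (0≤* (natℚ-nonneg (suc k)) (0≤q-p (call-uncovered-≤ 0≤B s)))))))
        (solve 10 (λ B γ ρ c k r l l′ u u′ →
            c :+ (k :+ con 1ℚ) :* (con 2ℚ :* con 2ℚ :* (γ :* B) :* r) :=
            (l′ :+ con 2ℚ :* con 2ℚ :* (γ :* (ρ :* B)) :* u′ :+ con 2ℚ :* (γ :* B) :* ((k :+ con 1ℚ) :* u′)) :+
            ((c :+ k :* (con 2ℚ :* con 2ℚ :* (γ :* B) :* r) :- (l :+ con 2ℚ :* con 2ℚ :* (γ :* (ρ :* B)) :* u :+ con 2ℚ :* (γ :* B) :* (k :* u))) :+
            ((l :+ con 2ℚ :* (γ :* B) :* u :- l′) :+
            (con 2ℚ :* con 2ℚ :* (γ :* B) :* (r :+ ρ :* (u :- u′) :- u) :+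
            con 2ℚ :* (γ :* B) :* ((k :+ con 1ℚ) :* (u :- u′))))))
          refl B γ ρ c (natℚ k) (remaining B q) (lat P) (lat (extend P (tour T))) (uncovered P) (uncovered (extend P (tour T)))))
        where
        open +-*-Solver
        0≤γB = 0≤* 0≤γ 0≤B

      scale-start : ∀ {B q P} → WithinScale B q (potential B P) 0 P
      scale-start {B} {q} {P} = withinScale (≤-reflexive (solve 4 (λ p g u r → p :+ g :* (con 0ℚ :* u) := p :+ con 0ℚ :* r) refl
        (potential B P) (2ℚ * (γ * B)) (uncovered P) (2ℚ * 2ℚ * (γ * B) * remaining B q)))
        where open +-*-Solver

      -- Doubling `B` adds `4 γ ρ B u` to the potential, and the credit `2 γ B K u` pays for it
      -- because `K ≥ 2 ρ`.
      scale-end : ∀ {B q c K P} → 0ℚ ≤ B → 2ℚ * ρ ≤ natℚ K → WithinScale B q c K P →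
        potential (2ℚ * B) P ≤ c + natℚ K * (2ℚ * 2ℚ * (γ * B) * remaining B q)
      scale-end {B} {q} {c} {K} {P} 0≤B le (withinScale w) = ≤-trans (by-difference _
        (0≤* (0≤* 0≤2ℚ (0≤* 0≤γ 0≤B)) (0≤* (0≤q-p le) (uncovered-nonneg P)))
        (solve 6 (λ B γ ρ k l u →
            l :+ con 2ℚ :* con 2ℚ :* (γ :* (ρ :* B)) :* u :+ con 2ℚ :* (γ :* B) :* (k :* u) :=
            l :+ con 2ℚ :* con 2ℚ :* (γ :* (ρ :* (con 2ℚ :* B))) :* u :+ con 2ℚ :* (γ :* B) :* ((k :- con 2ℚ :* ρ) :* u))
          refl B γ ρ (natℚ K) (lat P) (uncovered P))) w
        where open +-*-Solver

      module _ (b : ℕ → ℚ) (b≥0 : ∀ k → 0ℚ ≤ b k) (b-double : ∀ k → b (suc k) ≡ 2ℚ * b k) where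

        -- The total of the scales at which an element of latency `x` counts as late: a geometric
        -- sum.
        below : ℕ → ℚ → ℚ
        below zero    x = 0ℚ
        below (suc k) x = below k x + b k * late (b k) x

        -- The first bound carries the induction for the second. If `x > b k`, the sum so far is at
        -- most `b k`, so adding `b k` gives at most `2 b k`, and this is at most `2 x`.
        below-≤ : ∀ k {x} → 0ℚ ≤ x → below k x ≤ b k × below k x ≤ 2ℚ * x
        below-≤ zero    0≤x = b≥0 0 , 0≤* 0≤2ℚ 0≤x
        below-≤ (suc k) {x} 0≤x rewrite b-double k with below-≤ k 0≤x | x ≤?? b k
        ... | h₁ , h₂ | yes _ = ≤-trans (≤-trans (≤-reflexive eq) h₁) (by-difference _ (b≥0 k) (solve 1 (λ a → con 2ℚ :* a := a :+ a) refl (b k)))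
                              , ≤-trans (≤-reflexive eq) h₂
          where
          open +-*-Solver
          eq : below k x + b k * 0ℚ ≡ below k x
          eq = trans (cong (below k x +_) (*-zeroʳ (b k))) (+-identityʳ _)
        ... | h₁ , h₂ | no ¬h = le , ≤-trans le (*-monoˡ-≤-nonNeg 2ℚ (<⇒≤ (≰⇒> ¬h)))
          where
          open +-*-Solver
          le : below k x + b k * 1ℚ ≤ 2ℚ * b k
          le = by-difference _ (0≤q-p h₁) (solve 2 (λ s a → con 2ℚ :* a := s :+ a :* con 1ℚ :+ (a :- s)) refl (below k x) (b k))

        smaller : ℕ → List V → ℚ
        smaller k q = sum (λ j → below k (opt q j))

        -- This exchanges the sums over scales and over elements: the charges `B r` of the scales
        -- become one geometric sum for each element.
        smaller-suc : ∀ k q → smaller (suc k) q ≡ smaller k q + b k * remaining (b k) q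
        smaller-suc k q = trans (sum-+ (λ j → below k (opt q j)) (λ j → b k * late (b k) (opt q j))) (cong (smaller k q +_) (sum-* (b k) (λ j → late (b k) (opt q j))))

        smaller-≤ : ∀ k q → smaller k q ≤ 2ℚ * latencyOf q
        smaller-≤ k q = ≤-trans (sum-mono (λ j → proj₂ (below-≤ k (lengthUntil-nonneg d (C? j) root q)))) (≤-reflexive (sum-* 2ℚ (opt q)))

        elements : ℚ
        elements = sum {m} (λ _ → 1ℚ)

        charge : ℕ → ℕ → List V → ℚ
        charge K k q = natℚ K * (2ℚ * 2ℚ * (γ * smaller k q))

        initial : ℚ
        initial = 2ℚ * 2ℚ * (γ * (ρ * b 0)) * elements

        record BeforeScale (K k : ℕ) (q P : List V) : Set where
          constructor beforeScale
          field bound : potential (b k) P ≤ initial + charge K k q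

        bounded-start : ∀ {K q} → BeforeScale K 0 q (root ∷ [])
        bounded-start {K} {q} = beforeScale (begin
          lat [r] + weight * uncovered [r]  ≤⟨ +-mono-≤ zero-lat (*-monoˡ-≤-nonNeg weight {{nonNegative 0≤weight}} le) ⟩
          0ℚ + initial                      ≡⟨ +-comm 0ℚ initial ⟩
          initial + 0ℚ                      ≤⟨ +-monoʳ-≤ initial 0≤charge ⟩
          initial + charge K 0 q            ∎)
          where
          open ≤-Reasoning
          [r] = root ∷ []
          weight = 2ℚ * 2ℚ * (γ * (ρ * b 0))

          0≤weight : 0ℚ ≤ weight
          0≤weight = 0≤* (0≤* 0≤2ℚ 0≤2ℚ) (0≤* 0≤γ (0≤* 0≤ρ (b≥0 0)))

          0≤charge : 0ℚ ≤ charge K 0 q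
          0≤charge = 0≤* (natℚ-nonneg K) (0≤* (0≤* 0≤2ℚ 0≤2ℚ) (0≤* 0≤γ (sum-nonneg {f = λ j → below 0 (opt q j)} λ _ → ≤-refl)))

          le : uncovered (root ∷ []) ≤ elements
          le = sum-mono λ j → one (covers j (root ∷ []))
            where
            one : ∀ c → (if c then 0ℚ else 1ℚ) ≤ 1ℚ
            one true  = 0≤1ℚ
            one false = ≤-refl
          zero-lat : lat (root ∷ []) ≤ 0ℚ
          -- Zero is written as a product so that `sum-*` evaluates the sum.
          zero-lat = ≤-trans (sum-mono {g = λ _ → 0ℚ * 0ℚ} λ j → ≤-trans (closedUntil-≤ d (C? j) root (root ∷ []))
              (≤-reflexive (cong (λ a → a + a) (dist-self d root))))
            (≤-reflexive (trans (sum-* {m} 0ℚ (λ _ → 0ℚ)) (*-zeroˡ (sum {m} (λ _ → 0ℚ)))))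

        bounded-scale : ∀ {K k q P P′} → 2ℚ * ρ ≤ natℚ K → BeforeScale K k q P →
          WithinScale (b k) q (potential (b k) P) K P′ → BeforeScale K (suc k) q P′
        bounded-scale {K} {k} {q} {P} {P′} le (beforeScale h) w = beforeScale (begin
          potential (b (suc k)) P′
            ≡⟨ cong (λ a → potential a P′) (b-double k) ⟩
          potential (2ℚ * b k) P′
            ≤⟨ scale-end (b≥0 k) le w ⟩
          potential (b k) P + natℚ K * (2ℚ * 2ℚ * (γ * b k) * remaining (b k) q)
            ≤⟨ +-monoˡ-≤ (natℚ K * (2ℚ * 2ℚ * (γ * b k) * remaining (b k) q)) h ⟩
          initial + charge K k q + natℚ K * (2ℚ * 2ℚ * (γ * b k) * remaining (b k) q)
            ≡⟨ solve 6 (λ e K γ s b r →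
              e :+ K :* (con 2ℚ :* con 2ℚ :* (γ :* s)) :+ K :* (con 2ℚ :* con 2ℚ :* (γ :* b) :* r) :=
              e :+ K :* (con 2ℚ :* con 2ℚ :* (γ :* (s :+ b :* r)))) refl
              initial (natℚ K) γ (smaller k q) (b k) (remaining (b k) q) ⟩
          initial + natℚ K * (2ℚ * 2ℚ * (γ * (smaller k q + b k * remaining (b k) q)))
            ≡⟨ cong (λ a → initial + natℚ K * (2ℚ * 2ℚ * (γ * a))) (smaller-suc k q) ⟨
          initial + charge K (suc k) q ∎)
          where
          open ≤-Reasoning
          open +-*-Solver

        -- The last tour adds at most `2 b L` to each uncovered latency, and the potential holds
        -- `4 γ ρ b L` for it. `initial` is at most `4 ρ γ` times the latency of `q`, because no
        -- latency is below `b 0`. The charges add at most `4 γ K` times twice that latency, where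
        -- `K ≤ 4 ρ`.
        final-bound : ∀ {K L q P w} → natℚ K ≤ 2ℚ * (2ℚ * ρ) → (∀ j → b 0 ≤ opt q j) → closed d root w ≤ 2ℚ * b L →
          BeforeScale K L q P → latencyOf (dropRoot (extend P w)) ≤ 36ℚ * (ρ * γ) * latencyOf q
        final-bound {K} {L} {q} {P} {w} K≤ first≤ w≤ (beforeScale h) =
          ≤-trans (sum-mono λ j → lengthUntil-dropRoot d (C? j) (root-∉ j) root (extend P w))
          (≤-trans (lat-extend P w w≤)
          (≤-trans (by-difference _ (0≤* (0≤* 0≤2ℚ (0≤* (b≥0 L) (uncovered-nonneg P))) 1≤2γρ)
            (solve 5 (λ l b u γ ρ → l :+ con 2ℚ :* con 2ℚ :* (γ :* (ρ :* b)) :* u :=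
               l :+ con 2ℚ :* b :* u :+ con 2ℚ :* (b :* u) :* (con 2ℚ :* (γ :* ρ) :- con 1ℚ)) refl (lat P) (b L) (uncovered P) γ ρ))
          (≤-trans h
          (by-difference _
            (0≤+ (0≤* (0≤* (0≤* 0≤2ℚ 0≤2ℚ) (0≤* 0≤γ 0≤ρ)) (0≤q-p start))
            (0≤+ (0≤* (0≤* (0≤* 0≤2ℚ 0≤2ℚ) (0≤* 0≤γ (natℚ-nonneg K))) (0≤q-p (smaller-≤ L q)))
                 (0≤* (0≤* (0≤* 0≤2ℚ 0≤2ℚ) (0≤* 0≤γ (0≤* 0≤2ℚ (sum-nonneg λ j → lengthUntil-nonneg d (C? j) root q)))) (0≤q-p K≤))))
            (solve 7 (λ γ ρ o e b s K →
               con 36ℚ :* (ρ :* γ) :* o :=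
               con 2ℚ :* con 2ℚ :* (γ :* (ρ :* b)) :* e :+ K :* (con 2ℚ :* con 2ℚ :* (γ :* s)) :+
               (con 2ℚ :* con 2ℚ :* (γ :* ρ) :* (o :- b :* e) :+
               (con 2ℚ :* con 2ℚ :* (γ :* K) :* (con 2ℚ :* o :- s) :+
                con 2ℚ :* con 2ℚ :* (γ :* (con 2ℚ :* o)) :* (con 2ℚ :* (con 2ℚ :* ρ) :- K))))
              refl γ ρ (latencyOf q) elements (b 0) (smaller L q) (natℚ K))))))
          where
          open +-*-Solver
          start : b 0 * elements ≤ latencyOf q
          start = ≤-trans (≤-reflexive (sym (sum-* (b 0) (λ (_ : Fin m) → 1ℚ)))) (sum-mono λ j → ≤-trans (≤-reflexive (*-identityʳ (b 0))) (first≤ j))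
          1≤2γρ : 0ℚ ≤ 2ℚ * (γ * ρ) - 1ℚ
          -- `γ ρ - 1` is the sum of `(γ - 1) (ρ - 1)`, `γ - 1` and `ρ - 1`.
          1≤2γρ = 0≤q-p (by-difference {1ℚ} _ (0≤+ (0≤* 0≤2ℚ (0≤+ (0≤* (0≤q-p 1≤γ) (0≤q-p 1≤ρ)) (0≤+ (0≤q-p 1≤γ) (0≤q-p 1≤ρ)))) 0≤1ℚ)
            (solve 2 (λ γ ρ → con 2ℚ :* (γ :* ρ) := con 1ℚ :+ (con 2ℚ :* ((γ :- con 1ℚ) :* (ρ :- con 1ℚ) :+ ((γ :- con 1ℚ) :+ (ρ :- con 1ℚ))) :+ con 1ℚ)) refl γ ρ))

-- The length bounds as fractions, and the numbers of calls and of scales.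

module Scales where

  open PolynomialBounds using (n<2^bitLength)
  open TreeTours
  open Latency
  open import Data.Integer as ℤ using (+_; +≤+)
  import Data.Integer.Properties as ℤₚ
  open import Data.List using (List; _∷_; foldr; length; upTo; tabulate)
  open import Data.Fin using (Fin; zero; suc)
  open import Function using (_∘_)
  open import Data.List.Properties using (length-map; length-upTo)
  open import Data.List.Membership.Propositional using (_∈_)
  open import Data.List.Relation.Unary.Any using (here; there)
  open import Data.Nat as ℕ using (ℕ; zero; suc)
  import Data.Nat.Properties as ℕₚ
  import Data.Nat.DivMod as ℕ
  open import Data.Product
  open import Data.Rational
  open import Data.Rational.Properties
  open import Data.Rational.Solver using (module +-*-Solver)
  open import Data.Rational.Unnormalised as ℚᵘ using (ℚᵘ; mkℚᵘ; *≡*; *≤*)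
  import Data.Rational.Unnormalised.Properties as ℚᵘ
  open import Relation.Binary.PropositionalEquality
  open import Relation.Nullary

  natℚ-+ : ∀ m n → natℚ (m ℕ.+ n) ≡ natℚ m + natℚ n
  natℚ-+ zero    n = sym (+-identityˡ _)
  natℚ-+ (suc m) n = trans (cong (_+ 1ℚ) (natℚ-+ m n))
    (solve 3 (λ a b c → a :+ b :+ c := a :+ c :+ b) refl (natℚ m) (natℚ n) 1ℚ)
    where open +-*-Solver

  toℚᵘ-natℚ : ∀ n → toℚᵘ (natℚ n) ℚᵘ.≃ mkℚᵘ (+ n) 0
  toℚᵘ-natℚ zero    = ℚᵘ.≃-refl
  toℚᵘ-natℚ (suc n) = ℚᵘ.≃-trans (toℚᵘ-homo-+ (natℚ n) 1ℚ)
    (ℚᵘ.≃-trans (ℚᵘ.+-congˡ (toℚᵘ 1ℚ) (toℚᵘ-natℚ n)) (*≡* (cong (ℤ._* + 1)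
      (trans (cong (ℤ._+ + 1) (ℤₚ.*-identityʳ (+ n))) (cong +_ (ℕₚ.+-comm n 1))))))

  toℚᵘ-frac : ∀ m n → toℚᵘ (+ m / suc n) ℚᵘ.≃ mkℚᵘ (+ m) n
  toℚᵘ-frac m n = toℚᵘ-fromℚᵘ (mkℚᵘ (+ m) n)

  -- Passing to unnormalised fractions avoids all gcd computations and leaves a cross-multiplied
  -- inequality between naturals.
  ≤-fractions : ∀ {x y m n p q} → toℚᵘ x ℚᵘ.≃ mkℚᵘ (+ m) n → toℚᵘ y ℚᵘ.≃ mkℚᵘ (+ p) q →
    m ℕ.* suc q ℕ.≤ p ℕ.* suc n → x ≤ y
  ≤-fractions {m = m} {n} {p} {q} ex ey le = toℚᵘ-cancel-≤ (ℚᵘ.≤-trans (ℚᵘ.≤-reflexive ex) (ℚᵘ.≤-trans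
    (*≤* (subst₂ ℤ._≤_ (ℤₚ.pos-* m (suc q)) (ℤₚ.pos-* p (suc n)) (+≤+ le))) (ℚᵘ.≤-reflexive (ℚᵘ.≃-sym ey))))

  nonneg-numerator : ∀ {p} → 0ℚ ≤ p → toℚᵘ p ℚᵘ.≃ mkℚᵘ (+ ℤ.∣ ↥ p ∣) (ℚ.denominator-1 p)
  nonneg-numerator {p@record{}} 0≤p = ℚᵘ.≃-reflexive (cong (λ i → mkℚᵘ i (ℚ.denominator-1 p))
    (sym (ℤₚ.0≤i⇒+∣i∣≡i (subst₂ ℤ._≤_ (ℤₚ.*-zeroˡ (↧ p)) (ℤₚ.*-identityʳ (↥ p)) (drop-*≤* 0≤p)))))

  ≤numerator : ∀ {p} → 0ℚ ≤ p → p ≤ natℚ ℤ.∣ ↥ p ∣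
  ≤numerator {p} 0≤p = ≤-fractions (nonneg-numerator 0≤p) (toℚᵘ-natℚ ℤ.∣ ↥ p ∣) (ℕₚ.*-monoʳ-≤ ℤ.∣ ↥ p ∣ (ℕ.s≤s ℕ.z≤n))

  -- The numerator of a positive rational is at least 1. This makes the first scale a lower bound
  -- for all latencies.
  1/denominator≤ : ∀ {p n} → 0ℚ ≤ p → p ≢ 0ℚ → ↧ₙ p ℕ.≤ suc n → + 1 / suc n ≤ p
  1/denominator≤ {p} {n} 0≤p p≢0 le = ≤-fractions (toℚᵘ-frac 1 n) (nonneg-numerator 0≤p)
    (ℕₚ.≤-trans (ℕₚ.≤-reflexive (ℕₚ.*-identityˡ _)) (ℕₚ.≤-trans le (ℕₚ.m≤n*m (suc n) ℤ.∣ ↥ p ∣ {{ℕ.≢-nonZero (λ e → p≢0 (↥p≡0⇒p≡0 p (ℤₚ.∣i∣≡0⇒i≡0 e)))}})))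

  -- `K` is twice `⌊ρ⌋ + 1`. The lower bound is `ρ ≤ ⌊ρ⌋ + 1`, and the upper one is
  -- `⌊ρ⌋ + 1 ≤ ρ + 1 ≤ 2 ρ`, where `1 ≤ ρ` enters.
  calls : ∀ {ρ} → 1ℚ ≤ ρ → ∃[ K ] 2ℚ * ρ ≤ natℚ K × natℚ K ≤ 2ℚ * (2ℚ * ρ)
  calls {ρ} 1≤ρ = suc k ℕ.+ suc k , lower , upper
    where
    open +-*-Solver
    a = ℤ.∣ ↥ ρ ∣
    k = a ℕ./ ↧ₙ ρ
    0≤ρ : 0ℚ ≤ ρ
    0≤ρ = ≤-trans 0≤1ℚ 1≤ρ

    ρ≤ : ρ ≤ natℚ (suc k)
    ρ≤ = ≤-fractions (nonneg-numerator 0≤ρ) (toℚᵘ-natℚ (suc k)) (begin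
      a ℕ.* 1                               ≡⟨ ℕₚ.*-identityʳ a ⟩
      a                                     ≡⟨ ℕ.m≡m%n+[m/n]*n a (↧ₙ ρ) ⟩
      a ℕ.% ↧ₙ ρ ℕ.+ k ℕ.* ↧ₙ ρ             ≤⟨ ℕₚ.+-monoˡ-≤ _ (ℕₚ.<⇒≤ (ℕ.m%n<n a (↧ₙ ρ))) ⟩
      suc k ℕ.* ↧ₙ ρ                        ∎)
      where open ℕₚ.≤-Reasoning

    ≤ρ : natℚ k ≤ ρ
    ≤ρ = ≤-fractions (toℚᵘ-natℚ k) (nonneg-numerator 0≤ρ) (begin
      k ℕ.* ↧ₙ ρ  ≤⟨ ℕ.m/n*n≤m a (↧ₙ ρ) ⟩
      a           ≡⟨ ℕₚ.*-identityʳ a ⟨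
      a ℕ.* 1     ∎)
      where open ℕₚ.≤-Reasoning

    lower : 2ℚ * ρ ≤ natℚ (suc k ℕ.+ suc k)
    lower = ≤-trans (≤-reflexive (solve 1 (λ r → con 2ℚ :* r := r :+ r) refl ρ))
      (≤-trans (+-mono-≤ ρ≤ ρ≤) (≤-reflexive (sym (natℚ-+ (suc k) (suc k)))))

    upper : natℚ (suc k ℕ.+ suc k) ≤ 2ℚ * (2ℚ * ρ)
    upper = ≤-trans (≤-reflexive (natℚ-+ (suc k) (suc k))) (≤-trans (+-mono-≤ le le)
      (≤-reflexive (solve 1 (λ r → (r :+ r) :+ (r :+ r) := con 2ℚ :* (con 2ℚ :* r)) refl ρ)))
      where
      le : natℚ (suc k) ≤ ρ + ρ
      le = +-mono-≤ ≤ρ 1≤ρ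

  total : {A : Set} → (A → ℕ) → List A → ℕ
  total f = foldr (λ x a → f x ℕ.+ a) 0

  ∈-total : ∀ {A : Set} (f : A → ℕ) {x xs} → x ∈ xs → f x ℕ.≤ total f xs
  ∈-total f (here refl)             = ℕₚ.m≤m+n _ _
  ∈-total f {xs = y ∷ _} (there x∈) = ℕₚ.≤-trans (∈-total f x∈) (ℕₚ.m≤n+m _ (f y))

  -- A natural upper bound for the sum of the distances, which the program can find without rational
  -- arithmetic.
  sumOver≤numerators : ∀ {A : Set} (f : A → ℚ) → (∀ x → 0ℚ ≤ f x) → ∀ {k} (h : Fin k → A) →
    sumOver f (tabulate h) ≤ natℚ (total (λ x → ℤ.∣ ↥ x ∣) (tabulate (f ∘ h)))
  sumOver≤numerators f 0≤f {zero}  h = ≤-refl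
  sumOver≤numerators f 0≤f {suc k} h = ≤-trans (+-mono-≤ (≤numerator (0≤f (h zero))) (sumOver≤numerators f 0≤f (h ∘ suc)))
    (≤-reflexive (sym (natℚ-+ ℤ.∣ ↥ f (h zero) ∣ _)))

  length-binaryDigits : ∀ n → length (binaryDigits n) ≡ bitLength n
  length-binaryDigits n = trans (length-map _ (upTo (bitLength n))) (length-upTo (bitLength n))

  abstract
    -- Abstract, so that type checking does not normalise the fraction; `scale-frac` recovers the
    -- form that the program computes.
    scale : ℕ → ℕ → ℚ
    scale Q k = + (2 ℕ.^ k) / suc Q

    scale-nonneg : ∀ Q k → 0ℚ ≤ scale Q k
    scale-nonneg Q k = ≤-fractions {m = 0} {0} ℚᵘ.≃-refl (toℚᵘ-frac (2 ℕ.^ k) Q) ℕ.z≤n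

    scale-suc : ∀ Q k → scale Q (suc k) ≡ 2ℚ * scale Q k
    scale-suc Q k = toℚᵘ-injective (ℚᵘ.≃-trans (toℚᵘ-frac (2 ℕ.^ suc k) Q) (ℚᵘ.≃-sym
      (ℚᵘ.≃-trans (toℚᵘ-homo-* 2ℚ (scale Q k)) (ℚᵘ.≃-trans (ℚᵘ.*-congˡ {toℚᵘ 2ℚ} (toℚᵘ-frac (2 ℕ.^ k) Q))
        (*≡* (cong₂ ℤ._*_ (sym (ℤₚ.pos-* 2 (2 ℕ.^ k))) (cong +_ (sym (ℕₚ.+-identityʳ (suc Q))))))))))

    scale-frac : ∀ Q k → scale Q k ≡ + (2 ℕ.^ k) / suc Q
    scale-frac Q k = refl

    1/denominator≤scale : ∀ {p Q} → 0ℚ ≤ p → p ≢ 0ℚ → ↧ₙ p ℕ.≤ suc Q → scale Q 0 ≤ p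
    1/denominator≤scale = 1/denominator≤

    -- A number is below 2 to the power of its bit length, so the last bound reaches `N`. The
    -- exponent is written as the length of the list over which the program iterates.
    natℚ≤scale : ∀ Q N → natℚ N ≤ scale Q (length (binaryDigits (suc Q ℕ.* N)))
    natℚ≤scale Q N = ≤-fractions (toℚᵘ-natℚ N) (toℚᵘ-frac (2 ℕ.^ L) Q) (begin
      N ℕ.* suc Q        ≡⟨ ℕₚ.*-comm N (suc Q) ⟩
      suc Q ℕ.* N        ≤⟨ ℕₚ.<⇒≤ (n<2^bitLength (suc Q ℕ.* N)) ⟩
      2 ℕ.^ bitLength (suc Q ℕ.* N)  ≡⟨ cong (2 ℕ.^_) (length-binaryDigits (suc Q ℕ.* N)) ⟨
      2 ℕ.^ L            ≡⟨ ℕₚ.*-identityʳ _ ⟨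
      2 ℕ.^ L ℕ.* 1      ∎)
      where
      open ℕₚ.≤-Reasoning
      L : ℕ
      L = length (binaryDigits (suc Q ℕ.* N))

-- Programs for the list operations, with their values and running times.

module Programs where

  open PolynomialBounds
  open RunningTime
  open TreeTours using (insertAfter; attach; traverse; sweep; sweeps; tour; traverse-unique; sweep-unique)
  open Latency using (new; extend; dropRoot)
  open import Data.Bool using (Bool; true; false; if_then_else_)
  open import Data.Fin using (Fin; zero; suc; toℕ)
  open import Data.Fin.Properties using (_≟_; toℕ<n; injective⇒≤)
  open import Data.List using (List; []; _∷_; _++_; length; foldr; map; tabulate)
  open import Data.List.Properties using (map-++)
  open import Data.List.Membership.Propositional using (_∈_)
  open import Data.List.Membership.Propositional.Properties using (∈-map⁻; ∈-lookup)
  open import Data.List.Relation.Unary.Any using (here; there)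
  open import Data.List.Relation.Unary.All as All using (All; []; _∷_; lookup)
  open import Data.List.Relation.Unary.AllPairs using ([]; _∷_)
  open import Data.List.Relation.Unary.Unique.Propositional using (Unique)
  open import Data.Nat hiding (_≟_)
  open import Data.Nat.Properties hiding (_≟_)
  open import Data.Product hiding (map)
  open import Data.Rational as ℚ using (ℚ)
  open import Function using (_∘_)
  open import Relation.Binary.PropositionalEquality hiding (J)
  open import Relation.Nullary
  import Data.Integer

  size-map : ∀ {τ} {A : Set} (f : A → ⟦ τ ⟧) {c} → (∀ x → size τ (f x) ≤ c) → ∀ xs → size (list τ) (map f xs) ≤ suc (length xs * c)
  size-map f h []       = ≤-refl
  size-map f {c} h (x ∷ xs) = ≤-trans (+-mono-≤ (h x) (size-map f h xs)) (≤-reflexive (+-suc c _))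

  size-tabulate : ∀ {τ k} (f : Fin k → ⟦ τ ⟧) {c} → (∀ i → size τ (f i) ≤ c) → size (list τ) (tabulate f) ≤ suc (k * c)
  size-tabulate {k = zero}  f h = ≤-refl
  size-tabulate {k = suc k} f {c} h = ≤-trans (+-mono-≤ (h zero) (size-tabulate (f ∘ suc) (h ∘ suc))) (≤-reflexive (+-suc c _))

  bitLength-toℕ : ∀ {n} (i : Fin n) → bitLength (toℕ i) ≤ suc n
  bitLength-toℕ i = ≤-trans (bitLength≤suc (toℕ i)) (s≤s (<⇒≤ (toℕ<n i)))

  -- Pigeonhole: lookup in a duplicate-free list maps its positions injectively into `Fin n`.
  unique-length : ∀ {n} {xs : List (Fin n)} → Unique xs → length xs ≤ n
  unique-length {xs = xs} u = injective⇒≤ {f = Data.List.lookup xs} (inj u)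
    where
    inj : ∀ {xs : List (Fin _)} → Unique xs → ∀ {i j} → Data.List.lookup xs i ≡ Data.List.lookup xs j → i ≡ j
    inj (x≢ ∷ u) {zero}  {zero}  eq = refl
    inj {x ∷ xs} (x≢ ∷ u) {zero}  {suc j} eq = contradiction eq (All.lookup x≢ (∈-lookup {xs = xs} j))
    inj {x ∷ xs} (x≢ ∷ u) {suc i} {zero}  eq = contradiction (sym eq) (All.lookup x≢ (∈-lookup {xs = xs} i))
    inj (x≢ ∷ u) {suc i} {suc j} eq = cong suc (inj u eq)

  EncodesTree : ℕ → List (ℕ × ℕ) → Set
  EncodesTree n l = Σ[ T ∈ Edges n ] l ≡ encodeTree T

  -- The invariant that bounds a list of vertices by `n` alone, however many insertions have been
  -- made.
  EncodesUnique : ℕ → List ℕ → Set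
  EncodesUnique n a = Σ[ w ∈ List (Vertex n) ] a ≡ encodeWalk w × Unique w

  size-encodesUnique : ∀ {n a} → EncodesUnique n a → size (list nat) a ≤ suc (suc n * suc (suc n))
  size-encodesUnique {n} (w , refl , u) = ≤-trans (size-map {τ = nat} toℕ bitLength-toℕ w)
    (s≤s (*-monoˡ-≤ (suc (suc n)) (unique-length u)))

  -- Each program below computes the function of the same name definitionally.

  memberⁿ : ℕ → List ℕ → Bool
  memberⁿ x = foldr (λ y a → if x ≡ᵇ y then true else a) false

  insertAfterⁿ : ℕ → ℕ → List ℕ → List ℕ
  insertAfterⁿ x y = foldr (λ z a → if x ≡ᵇ z then z ∷ y ∷ a else z ∷ a) []

  attachⁿ : ℕ → ℕ → List ℕ → List ℕ
  attachⁿ x y w = if memberⁿ y w then w else insertAfterⁿ x y w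

  traverseⁿ : ℕ × ℕ → List ℕ → List ℕ
  traverseⁿ e w = attachⁿ (proj₂ e) (proj₁ e) (attachⁿ (proj₁ e) (proj₂ e) w)

  sweepⁿ : List (ℕ × ℕ) → List ℕ → List ℕ
  sweepⁿ E w = foldr traverseⁿ w E

  tourⁿ : List (ℕ × ℕ) → List ℕ
  tourⁿ E = foldr (λ _ → sweepⁿ E) (0 ∷ []) E

  extendⁿ : List ℕ → List ℕ → List ℕ
  extendⁿ P w = foldr _∷_ (foldr (λ x a → if memberⁿ x P then a else x ∷ a) [] w) P

  dropRootⁿ : List ℕ → List ℕ
  dropRootⁿ = foldr (λ x a → if 0 ≡ᵇ x then a else x ∷ a) []

  sucs : List ℕ → List ℕ
  sucs = foldr (λ x a → suc x ∷ a) []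

  -- A fold has no counter, so every round shifts the list and puts 0 in front.
  verticesⁿ : {A : Set} → List A → List ℕ
  verticesⁿ = foldr (λ _ a → 0 ∷ sucs a) []

  toℕ-≡ᵇ : ∀ {n} (u v : Fin n) → (toℕ u ≡ᵇ toℕ v) ≡ does (u ≟ v)
  toℕ-≡ᵇ zero    zero    = refl
  toℕ-≡ᵇ zero    (suc v) = refl
  toℕ-≡ᵇ (suc u) zero    = refl
  toℕ-≡ᵇ (suc u) (suc v) = toℕ-≡ᵇ u v

  module _ {n : ℕ} where

    open import Data.List.Membership.DecPropositional (_≟_ {suc n}) using (_∈?_)

    member-toℕ : ∀ (u : Vertex n) w → memberⁿ (toℕ u) (encodeWalk w) ≡ does (u ∈? w)
    member-toℕ u []      = refl
    member-toℕ u (v ∷ w) rewrite toℕ-≡ᵇ u v | member-toℕ u w with does (u ≟ v)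
    ... | true  = refl
    ... | false = refl

    insertAfter-toℕ : ∀ (x y : Vertex n) w → insertAfterⁿ (toℕ x) (toℕ y) (encodeWalk w) ≡ encodeWalk (insertAfter x y w)
    insertAfter-toℕ x y []      = refl
    insertAfter-toℕ x y (z ∷ w) rewrite toℕ-≡ᵇ x z | insertAfter-toℕ x y w with does (x ≟ z)
    ... | true  = refl
    ... | false = refl

    attach-toℕ : ∀ (x y : Vertex n) w → attachⁿ (toℕ x) (toℕ y) (encodeWalk w) ≡ encodeWalk (attach x y w)
    attach-toℕ x y w rewrite member-toℕ y w | insertAfter-toℕ x y w with does (y ∈? w)
    ... | true  = refl
    ... | false = refl

    traverse-toℕ : ∀ (x y : Vertex n) w → traverseⁿ (toℕ x , toℕ y) (encodeWalk w) ≡ encodeWalk (traverse (x , y) w)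
    traverse-toℕ x y w = trans (cong (attachⁿ (toℕ y) (toℕ x)) (attach-toℕ x y w)) (attach-toℕ y x (attach x y w))

    sweep-toℕ : ∀ (E : Edges n) w → sweepⁿ (encodeTree E) (encodeWalk w) ≡ encodeWalk (sweep E w)
    sweep-toℕ []            w = refl
    sweep-toℕ ((x , y) ∷ E) w = trans (cong (traverseⁿ (toℕ x , toℕ y)) (sweep-toℕ E w)) (traverse-toℕ x y (sweep E w))

    tour-toℕ : ∀ (E : Edges n) → tourⁿ (encodeTree E) ≡ encodeWalk (tour E)
    tour-toℕ E = go E
      where
      go : ∀ ks → foldr (λ _ → sweepⁿ (encodeTree E)) (0 ∷ []) (encodeTree ks) ≡ encodeWalk (sweeps E ks)
      go []       = refl
      go (_ ∷ ks) = trans (cong (sweepⁿ (encodeTree E)) (go ks)) (sweep-toℕ E (sweeps E ks))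

    extend-toℕ : ∀ (P w : List (Vertex n)) → extendⁿ (encodeWalk P) (encodeWalk w) ≡ encodeWalk (extend P w)
    extend-toℕ P w = trans (append P) (trans (cong (encodeWalk P ++_) (new-toℕ w)) (sym (map-++ toℕ P (new P w))))
      where
      new-toℕ : ∀ w → foldr (λ x a → if memberⁿ x (encodeWalk P) then a else x ∷ a) [] (encodeWalk w) ≡ encodeWalk (new P w)
      new-toℕ []      = refl
      new-toℕ (v ∷ w) rewrite member-toℕ v P | new-toℕ w with does (v ∈? P)
      ... | true  = refl
      ... | false = refl
      append : ∀ Q {ys} → foldr _∷_ ys (encodeWalk Q) ≡ encodeWalk Q ++ ys
      append []      = refl
      append (v ∷ Q) = cong (toℕ v ∷_) (append Q)

    dropRoot-toℕ : ∀ (w : List (Vertex n)) → dropRootⁿ (encodeWalk w) ≡ encodeWalk (dropRoot w)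
    dropRoot-toℕ []      = refl
    dropRoot-toℕ (v ∷ w) rewrite toℕ-≡ᵇ {suc n} root v | dropRoot-toℕ w with does (root ≟ v)
    ... | true  = refl
    ... | false = refl

  sucs-tabulate : ∀ {k} (f : Fin k → ℕ) → sucs (tabulate f) ≡ tabulate (suc ∘ f)
  sucs-tabulate {zero}  f = refl
  sucs-tabulate {suc k} f = cong (suc (f zero) ∷_) (sucs-tabulate (f ∘ suc))

  vertices-tabulate : ∀ {A : Set} {k} (f : Fin k → A) → verticesⁿ (tabulate f) ≡ tabulate {n = k} toℕ
  vertices-tabulate {k = zero}  f = refl
  vertices-tabulate {k = suc k} f = cong (0 ∷_) (trans (cong sucs (vertices-tabulate (f ∘ suc))) (sucs-tabulate toℕ))

  v0 : ∀ {σ : Ty} {Γ} → σ ∈ σ ∷ Γ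
  v0 = here refl

  v1 : ∀ {σ σ₁ : Ty} {Γ} → σ ∈ σ₁ ∷ σ ∷ Γ
  v1 = there v0

  v2 : ∀ {σ σ₁ σ₂ : Ty} {Γ} → σ ∈ σ₁ ∷ σ₂ ∷ σ ∷ Γ
  v2 = there v1

  infixl 5 _↑ _↑↑

  _↑ : ∀ {σ σ₁ : Ty} {Γ} → σ ∈ Γ → σ ∈ σ₁ ∷ Γ
  _↑ = there

  _↑↑ : ∀ {σ σ₁ σ₂ : Ty} {Γ} → σ ∈ Γ → σ ∈ σ₁ ∷ σ₂ ∷ Γ
  x ↑↑ = there (there x)

  module _ {κ α : Ty} where

    private variable
      Γ : List Ty

    memberT : nat ∈ Γ → list nat ∈ Γ → Term κ α Γ bool
    memberT x w = fold (var w) (const false)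
      (cond (op eqⁿ (pair (var (x ↑↑)) (var v0))) (const true) (var v1))

    insertAfterT : nat ∈ Γ → nat ∈ Γ → list nat ∈ Γ → Term κ α Γ (list nat)
    insertAfterT x y w = fold (var w) (const [])
      (cond (op eqⁿ (pair (var (x ↑↑)) (var v0))) (cons (var v0) (cons (var (y ↑↑)) (var v1))) (cons (var v0) (var v1)))

    attachT : nat ∈ Γ → nat ∈ Γ → list nat ∈ Γ → Term κ α Γ (list nat)
    attachT x y w = cond (memberT y w) (var w) (insertAfterT x y w)

    traverseT : nat ×ᵗ nat ∈ Γ → list nat ∈ Γ → Term κ α Γ (list nat)
    traverseT e w = letin (op fst (var e)) (letin (op snd (var (e ↑)))
      (letin (attachT v1 v0 (w ↑↑)) (attachT v1 v2 v0)))

    sweepT : list (nat ×ᵗ nat) ∈ Γ → list nat ∈ Γ → Term κ α Γ (list nat)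
    sweepT E w = fold (var E) (var w) (traverseT v0 v1)

    tourT : list (nat ×ᵗ nat) ∈ Γ → Term κ α Γ (list nat)
    tourT E = fold (var E) (const (0 ∷ [])) (sweepT (E ↑↑) v1)

    extendT : list nat ∈ Γ → list nat ∈ Γ → Term κ α Γ (list nat)
    extendT P w = fold (var P)
      (fold (var w) (const []) (cond (memberT v0 (P ↑↑)) (var v1) (cons (var v0) (var v1))))
      (cons (var v0) (var v1))

    dropRootT : list nat ∈ Γ → Term κ α Γ (list nat)
    dropRootT w = fold (var w) (const []) (cond (op eqⁿ (pair (const 0) (var v0))) (var v1) (cons (var v0) (var v1)))

    sucsT : list nat ∈ Γ → Term κ α Γ (list nat)
    sucsT w = fold (var w) (const []) (cons (op addⁿ (pair (const 1) (var v0))) (var v1))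

    verticesT : ∀ {τ} → list τ ∈ Γ → Term κ α Γ (list nat)
    verticesT l = fold (var l) (const []) (cons (const 0) (sucsT v1))

    -- The outermost round of the fold sees the first element and returns it. On the distance matrix
    -- this is the row of the root.
    headT : ∀ {τ} → list (list τ) ∈ Γ → Term κ α Γ (list τ)
    headT l = fold (var l) (const []) (var v0)

    totalT : ∀ {τ} → Op τ nat → list τ ∈ Γ → Term κ α Γ nat
    totalT o l = fold (var l) (const 0) (op addⁿ (pair (op o (var v0)) (var v1)))

    module _ (A : Algorithm κ α) where

      open Costs A

      private variable
        J : Set
        s : J → ℕ
        ρ : J → Env Γ

      eq-cost : {t : Term κ α Γ (nat ×ᵗ nat)} → Cost s ρ t → Cost s ρ (op eqⁿ t)
      eq-cost = op-cost λ _ → s≤s z≤n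

      add-cost : {t : Term κ α Γ (nat ×ᵗ nat)} → Cost s ρ t → Cost s ρ (op addⁿ t)
      add-cost = op-cost λ { (m , n) → m≤n⇒m≤1+n (bitLength-+ m n) }

      mul-cost : {t : Term κ α Γ (nat ×ᵗ nat)} → Cost s ρ t → Cost s ρ (op mulⁿ t)
      mul-cost = op-cost λ { (m , n) → m≤n⇒m≤1+n (bitLength-* m n) }

      digits-cost : {t : Term κ α Γ nat} → Cost s ρ t → Cost s ρ (op digits t)
      digits-cost = op-cost λ n → m≤n⇒m≤1+n (size-binaryDigits n)

      frac-cost : {t : Term κ α Γ (nat ×ᵗ nat)} → Cost s ρ t → Cost s ρ (op frac t)
      frac-cost = op-cost λ { (m , n) → ≤-trans (size-frac m n)
        (≤-trans (+-monoʳ-≤ (bitLength m) (bitLength-+ 1 n))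
          (≤-reflexive (trans (+-suc (bitLength m) _) (cong suc (+-suc (bitLength m) _))))) }

      fst-cost : ∀ {σ τ} {t : Term κ α Γ (σ ×ᵗ τ)} → Cost s ρ t → Cost s ρ (op fst t)
      fst-cost = op-cost λ { (x , y) → ≤-trans (m≤m+n _ _) (m≤n+m _ 2) }

      snd-cost : ∀ {σ τ} {t : Term κ α Γ (σ ×ᵗ τ)} → Cost s ρ t → Cost s ρ (op snd t)
      snd-cost {σ = σ} = op-cost λ { (x , y) → ≤-trans (m≤n+m _ (size σ x)) (m≤n+m _ 2) }

      memberT-cost : ∀ {x w} → Small s ρ x → Small s ρ w → Cost s ρ (memberT x w)
      memberT-cost bx bw = growing-fold-cost (const-bounded 1) (var-cost bw) const-cost (λ _ → s≤s z≤n)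
        λ h _ _ be ba → cond-cost (eq-cost (pair-cost (var-cost (reindex h bx)) (var-cost be))) const-cost (var-cost ba)

      insertAfterT-cost : ∀ {x y w} → Small s ρ x → Small s ρ y → Small s ρ w → Cost s ρ (insertAfterT x y w)
      insertAfterT-cost {ρ = ρ} {x = x} {y} {w} bx by bw =
        growing-fold-cost (+-bounded bw by) (var-cost bw) const-cost (λ {j} {e} {a} → grow j e a)
          λ h _ _ be ba → cond-cost (eq-cost (pair-cost (var-cost (reindex h bx)) (var-cost be)))
            (cons-cost (var-cost be) (cons-cost (var-cost (reindex h by)) (var-cost ba))) (cons-cost (var-cost be) (var-cost ba))
        where
        grow : ∀ j e a → e ∈ lookup (ρ j) w →
          size (list nat) (if lookup (ρ j) x ≡ᵇ e then e ∷ lookup (ρ j) y ∷ a else e ∷ a) ≤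
          size (list nat) (lookup (ρ j) w) + bitLength (lookup (ρ j) y) + size (list nat) a
        grow j e a e∈ with lookup (ρ j) x ≡ᵇ e
        ... | true  = ≤-trans (+-monoˡ-≤ _ (size-∈ {nat} e∈)) (≤-reflexive (sym (+-assoc (size (list nat) (lookup (ρ j) w)) _ _)))
        ... | false = +-monoˡ-≤ _ (≤-trans (size-∈ {nat} e∈) (m≤m+n _ _))

      attachT-cost : ∀ {x y w} → Small s ρ x → Small s ρ y → Small s ρ w → Cost s ρ (attachT x y w)
      attachT-cost bx by bw = cond-cost (memberT-cost by bw) (var-cost bw) (insertAfterT-cost bx by bw)

      traverseT-cost : ∀ {e w} → Small s ρ e → Small s ρ w → Cost s ρ (traverseT e w)
      traverseT-cost be bw = letin-cost cu (letin-cost cv (letin-cost cw (attachT-cost bv bu (value-bounded cw))))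
        where
        cu = fst-cost (var-cost be)
        bu = value-bounded cu
        cv = snd-cost (var-cost be)
        bv = value-bounded cv
        cw = attachT-cost bu bv bw

      extendT-cost : ∀ {P w} → Small s ρ P → Small s ρ w → Cost s ρ (extendT P w)
      extendT-cost {ρ = ρ} {P = P} {w} bP bw = growing-fold-cost bP (var-cost bP) new-cost
          (λ x∈ → +-monoˡ-≤ _ (size-∈ {nat} x∈))
          λ h _ _ be ba → cons-cost (var-cost be) (var-cost ba)
        where
        grow : ∀ j e a → e ∈ lookup (ρ j) w →
          size (list nat) (if memberⁿ e (lookup (ρ j) P) then a else e ∷ a) ≤ size (list nat) (lookup (ρ j) w) + size (list nat) a
        grow j e a e∈ with memberⁿ e (lookup (ρ j) P)
        ... | true  = m≤n+m _ (size (list nat) (lookup (ρ j) w))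
        ... | false = +-monoˡ-≤ _ (size-∈ {nat} e∈)

        new-cost = growing-fold-cost bw (var-cost bw) const-cost (λ {j} {e} {a} → grow j e a)
          λ h _ _ be ba → cond-cost (memberT-cost be (reindex h bP)) (var-cost ba) (cons-cost (var-cost be) (var-cost ba))

      dropRootT-cost : ∀ {w} → Small s ρ w → Cost s ρ (dropRootT w)
      dropRootT-cost {ρ = ρ} {w = w} bw = growing-fold-cost bw (var-cost bw) const-cost (λ {j} {e} {a} → grow j e a)
          λ h _ _ be ba → cond-cost (eq-cost (pair-cost const-cost (var-cost be))) (var-cost ba) (cons-cost (var-cost be) (var-cost ba))
        where
        grow : ∀ j e a → e ∈ lookup (ρ j) w →
          size (list nat) (if 0 ≡ᵇ e then a else e ∷ a) ≤ size (list nat) (lookup (ρ j) w) + size (list nat) a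
        grow j e a e∈ with 0 ≡ᵇ e
        ... | true  = m≤n+m _ (size (list nat) (lookup (ρ j) w))
        ... | false = +-monoˡ-≤ _ (size-∈ {nat} e∈)

      sucsT-cost : ∀ {w} → Small s ρ w → Cost s ρ (sucsT w)
      sucsT-cost bw = growing-fold-cost (+-bounded (const-bounded 2) bw) (var-cost bw) const-cost
        (λ {j} {x} x∈ → +-monoˡ-≤ _ (≤-trans (bitLength-+ 1 x) (+-monoʳ-≤ 2 (size-∈ {nat} x∈))))
        λ h _ _ be ba → cons-cost (add-cost (pair-cost const-cost (var-cost be))) (var-cost ba)

      -- Each round changes every entry, so the rule for growing accumulators does not fit. The
      -- exact value of the accumulator serves as the invariant.
      verticesT-cost : ∀ {τ} {l : list τ ∈ Γ} → Small s ρ l → Cost s ρ (verticesT l)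
      verticesT-cost {s = s} {ρ = ρ} {l = l} bl = fold-cost (λ j k a → a ≡ tabulate {n = k} toℕ) (var-cost bl) const-cost (λ j → refl)
        (λ { {k = k} _ _ refl → cong (0 ∷_) (sucs-tabulate {k} toℕ) })
        (cons-cost const-cost (sucsT-cost
          (≤-bounded (λ i → ≤-trans (≤-reflexive (cong (size (list nat)) (holds i)))
              (≤-trans (size-tabulate {nat} {round i} toℕ bitLength-toℕ) (s≤s (*-mono-≤ (le i) (s≤s (le i))))))
            (suc-bounded (*-bounded (reindex index bl) (suc-bounded (reindex index bl)))))))
        where
        le : ∀ {Inv : _ → ℕ → List ℕ → Set} (i : Iteration {s = s} {ρ = ρ} (var l) Inv) → round i ≤ size (list _) (lookup (ρ (index i)) l)
        le i = <⇒≤ (<-≤-trans (round< i) (length≤size (lookup (ρ (index i)) l)))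

      headT-cost : ∀ {τ} {l : list (list τ) ∈ Γ} → Small s ρ l → Cost s ρ (headT l)
      headT-cost bl = growing-fold-cost bl (var-cost bl) const-cost (λ {j} x∈ → ≤-trans (size-∈ x∈) (m≤m+n _ _))
        λ h _ _ be ba → var-cost be

      totalT-cost : ∀ {τ} {o : Op τ nat} {l : list τ ∈ Γ} → (∀ x → bitLength (applyOp o x) ≤ 2 + size τ x) →
        Small s ρ l → Cost s ρ (totalT o l)
      totalT-cost {o = o} ho bl = growing-fold-cost (+-bounded (const-bounded 3) bl) (var-cost bl) const-cost
        (λ {j} {x} {a} x∈ → ≤-trans (bitLength-+ (applyOp o x) a) (s≤s (+-monoˡ-≤ (bitLength a) (≤-trans (ho x) (+-monoʳ-≤ 2 (size-∈ x∈))))))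
        λ h _ _ be ba → add-cost (pair-cost (op-cost ho (var-cost be)) (var-cost ba))

      module _ {n : J → ℕ} (bn : Bounded s n) where

        encodesUnique-bounded : {a : J → List ℕ} → (∀ j → EncodesUnique (n j) (a j)) → Bounded s (size (list nat) ∘ a)
        encodesUnique-bounded h = ≤-bounded (λ j → size-encodesUnique (h j))
          (suc-bounded (*-bounded (suc-bounded bn) (suc-bounded (suc-bounded bn))))

      traverse-encodesUnique : ∀ {n l a e} → EncodesTree n l → e ∈ l → EncodesUnique n a → EncodesUnique n (traverseⁿ e a)
      traverse-encodesUnique (T , refl) e∈ (w , refl , u) with ∈-map⁻ _ e∈
      ... | (x , y) , _ , refl = traverse (x , y) w , traverse-toℕ x y w , traverse-unique u

      -- A bound for `traverseT` in terms of its own list could not be iterated within a polynomial.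
      -- The invariant bounds that list in every round, and `EncodesTree` ensures that only vertices
      -- are inserted.
      sweepT-cost : ∀ {n : J → ℕ} {E w} → Bounded s n → (∀ j → EncodesTree (n j) (lookup (ρ j) E)) →
        (∀ j → EncodesUnique (n j) (lookup (ρ j) w)) → Small s ρ E → Cost s ρ (sweepT E w)
      sweepT-cost {n = n} bn hE hw bE = fold-cost (λ j _ a → EncodesUnique (n j) a) (var-cost bE)
        (var-cost (encodesUnique-bounded bn hw)) hw (λ {j} e∈ _ → traverse-encodesUnique (hE j) e∈)
        (traverseT-cost (≤-bounded (λ i → size-∈ {nat ×ᵗ nat} (element∈ i)) (reindex index bE))
          (encodesUnique-bounded (reindex index bn) holds))

      sweep-encodesUnique : ∀ {n l a} → EncodesTree n l → EncodesUnique n a → EncodesUnique n (sweepⁿ l a)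
      sweep-encodesUnique (T , refl) (w , refl , u) = sweep T w , sweep-toℕ T w , sweep-unique T u

      tourT-cost : ∀ {n : J → ℕ} {E} → Bounded s n → (∀ j → EncodesTree (n j) (lookup (ρ j) E)) → Small s ρ E →
        Cost s ρ (tourT E)
      tourT-cost {n = n} bn hE bE = fold-cost (λ j _ a → EncodesUnique (n j) a) (var-cost bE) const-cost
        (λ j → root ∷ [] , refl , [] ∷ []) (λ {j} _ _ → sweep-encodesUnique (hE j))
        (sweepT-cost (reindex index bn) (hE ∘ index) holds (reindex index bE))

-- The reduction for a general covering problem.

module GenericReduction where

  open PolynomialBounds
  open RunningTime
  open TreeTours
  open Latency
  open Scales
  open Programs
  open import Data.Bool using (Bool; true)
  open import Data.Fin using (Fin; zero; suc; toℕ)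
  open import Data.Fin.Properties using (_≟_)
  open import Data.List using (List; []; _∷_; length; foldr; tabulate; replicate; allFin)
  open import Data.List.Properties using (length-replicate; map-tabulate; length-tabulate)
  open import Data.List.Membership.Propositional using (_∈_; lose)
  open import Data.List.Membership.Propositional.Properties using (∈-tabulate⁺; ∈-allFin; ∈-++⁺ˡ)
  open import Data.List.Relation.Unary.Any using (Any; here)
  open import Data.List.Relation.Unary.All as All using (All; []; _∷_; lookup)
  open import Data.List.Relation.Unary.AllPairs using ([]; _∷_)
  open import Data.List.Relation.Unary.Unique.Propositional using (Unique)
  import Data.List.Relation.Unary.Unique.Propositional.Properties as Unique
  open import Data.Integer as ℤ using ()
  open import Data.Nat as ℕ using (ℕ; zero; suc)
  import Data.Nat.Properties as ℕₚ
  open import Data.Product hiding (map)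
  open import Data.Rational hiding (_≟_)
  open import Data.Rational.Properties hiding (_≟_)
  open import Data.Unit using (⊤; tt)
  open import Function using (_∘_; id)
  open import Function.Bundles using (Equivalence)
  open import Level using (0ℓ)
  open import Relation.Binary.PropositionalEquality hiding (J)
  open import Relation.Nullary
  open import Relation.Unary using (Pred; Decidable)

  -- What the two latency problems have in common: a path has to cover a family of elements,
  -- and oracle queries reward the elements that are not covered by a given list of vertices.
  record CoverProblem (κ σ : Ty) : Set₁ where
    field
      Inst      : Set
      enc       : Inst → ⟦ σ ⟧
      n         : Inst → ℕ
      d         : ∀ I → Metric (n I)
      m         : Inst → ℕ
      C         : ∀ I → Fin (m I) → Pred (Vertex (n I)) 0ℓ
      C?        : ∀ I j → Decidable (C I j)
      root-∉    : ∀ I j → ¬ C I j root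
      coverable : ∀ I j → ∃ (C I j)

      Query     : Set
      encQuery  : Query → ⟦ κ ⟧
      query     : ∀ I → List (Vertex (n I)) → ∀ B → 0ℚ ≤ B → Query

      matrixT      : ∀ {Γ} → σ ∈ Γ → Term κ treeTy Γ matrixTy
      matrix-value : ∀ A {Γ} {η : All ⟦_⟧ Γ} {x I} → lookup η x ≡ enc I →
        Semantics.value A (matrixT x) η ≡ encodeMetric (d I)
      matrix-cost  : ∀ A {J Γ s} {η : J → All ⟦_⟧ Γ} {x} → let open Costs A in
        Small s η x → Cost s η (matrixT x)

      queryT      : ∀ {Γ} → σ ∈ Γ → list nat ∈ Γ → rat ∈ Γ → Term κ treeTy Γ κ
      query-value : ∀ A {Γ} {η : All ⟦_⟧ Γ} {x p b I P} (0≤B : 0ℚ ≤ lookup η b) →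
        lookup η x ≡ enc I → lookup η p ≡ encodeWalk P →
        Semantics.value A (queryT x p b) η ≡ encQuery (query I P (lookup η b) 0≤B)
      query-cost  : ∀ A {J Γ s} {η : J → All ⟦_⟧ Γ} {x p b} → let open Costs A in
        Small s η x → Small s η p → Small s η b → Cost s η (queryT x p b)

  module Reduce {κ σ : Ty} (𝓟 : CoverProblem κ σ) (K : ℕ) where

    open CoverProblem 𝓟

    private
      Tm : List Ty → Ty → Set
      Tm = Term κ treeTy

    callT : ∀ {Γ} → σ ∈ Γ → list nat ∈ Γ → rat ∈ Γ → Tm Γ (list nat)
    callT x p b = letin (oracle (queryT x p b)) (letin (tourT v0) (extendT (p ↑↑) v0))

    -- `K` does not depend on the input, so the loop runs over a literal list and makes a constant
    -- number of calls.
    callsT : ∀ {Γ} → σ ∈ Γ → list nat ∈ Γ → rat ∈ Γ → Tm Γ (list nat)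
    callsT x p b = fold {σ = bool} (const (replicate K true)) (var p) (callT (x ↑↑) v1 (b ↑↑))

    -- The state consists of 2 ^ k and the vertices visited before scale k.
    scaleT : ∀ {Γ} → σ ∈ Γ → nat ∈ Γ → nat ×ᵗ list nat ∈ Γ → Tm Γ (nat ×ᵗ list nat)
    scaleT x q a = letin (op fst (var a)) (letin (op snd (var (a ↑)))
      (letin (op frac (pair (var v1) (var (q ↑↑))))
        (pair (op mulⁿ (pair (const 2) (var v2))) (callsT (x ↑ ↑↑) v1 v0))))

    -- A list with one element per scale: the number of digits counts here, not their values. It is
    -- logarithmic in `suc Q * N`.
    roundsT : ∀ {Γ} → nat ∈ Γ → nat ∈ Γ → Tm Γ (list nat)
    roundsT q t = op digits (op mulⁿ (pair (op addⁿ (pair (const 1) (var q))) (var t)))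

    scalesT : ∀ {Γ} → σ ∈ Γ → nat ∈ Γ → nat ∈ Γ → Tm Γ (nat ×ᵗ list nat)
    scalesT x q t = fold (roundsT q t) (const (1 , 0 ∷ [])) (scaleT (x ↑↑) (q ↑↑) v1)

    -- The parts of the program are opaque because comparing values of nested let-bindings by
    -- unfolding takes exponential time.  The environment starts with the sums N of the numerators
    -- and Q of the denominators of the distances from the root.
    opaque
      searchT : Tm (nat ∷ nat ∷ list rat ∷ matrixTy ∷ σ ∷ list bool ∷ []) walkTy
      searchT =
        letin (scalesT (v2 ↑↑) v1 v0)
        (letin (op snd (var v0))
        (letin (verticesT (v2 ↑ ↑↑))
        (letin (extendT v1 v0)
        (dropRootT v0))))

    opaque
      numeratorsT : Tm (nat ∷ list rat ∷ matrixTy ∷ σ ∷ list bool ∷ []) walkTy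
      numeratorsT = letin (totalT numʳ v1) searchT

    opaque
      denominatorsT : Tm (list rat ∷ matrixTy ∷ σ ∷ list bool ∷ []) walkTy
      denominatorsT = letin (totalT denʳ v0) numeratorsT

    opaque
      sumsT : Tm (matrixTy ∷ σ ∷ list bool ∷ []) walkTy
      sumsT = letin (headT v0) denominatorsT

    opaque
      latencyT : Tm (σ ∷ list bool ∷ []) walkTy
      latencyT = letin (matrixT v0) sumsT

    -- The coin polynomial is zero, so the only bit string is the empty one and the expectation is a
    -- single value.
    reduction : Reduction κ treeTy σ walkTy
    reduction = record { coins = record { coefficient = 0 ; degree = 0 } ; program = latencyT }

    module Run (A : Algorithm κ treeTy) (ρ γ : ℚ)
      -- With the root in `P`, the root has reward zero, so that in path orienteering only uncovered
      -- elements are rewarded.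
      (serve : ∀ I P B (0≤B : 0ℚ ≤ B) → root ∈ P → Σ[ T ∈ Edges (n I) ]
        Algorithm.run A (encQuery (query I P B 0≤B)) ≡ encodeTree T ×
        Covering.Serves (d I) (C I) (C? I) (root-∉ I) ρ γ B P T) where

      open Costs A

      V : Inst → Set
      V I = Vertex (n I)

      module Cov I = Covering (d I) (C I) (C? I) (root-∉ I)

      -- `R` is the bound on the potential in the analysis of the ratio and trivial in that of the
      -- running time, so that one proof follows the loops for both.
      record Visits I (R : List (V I) → Set) (a : List ℕ) : Set where
        constructor visits
        field
          visited : List (V I)
          encoded : a ≡ encodeWalk visited
          unique  : Unique visited
          root∈   : root ∈ visited
          holds   : R visited

      visits-unique : ∀ {I R a} → Visits I R a → EncodesUnique (n I) a
      visits-unique (visits P eq u _ _) = P , eq , u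

      answers : ∀ {Γ I R} {η : Env Γ} x p b → lookup η x ≡ enc I → 0ℚ ≤ lookup η b → Visits I R (lookup η p) →
        EncodesTree (n I) (Algorithm.run A (value (queryT x p b) η))
      answers {I = I} x p b ex 0≤B (visits P eq u r _)
        with serve I P _ 0≤B r
      ... | T , run≡ , _ = T , trans (cong (Algorithm.run A) (query-value A 0≤B ex eq)) run≡

      call-visits : ∀ {Γ I R R′} {η : Env Γ} x p b → lookup η x ≡ enc I → 0ℚ ≤ lookup η b →
        (∀ {P T} → R P → Cov.Serves I ρ γ (lookup η b) P T → R′ (extend P (tour T))) →
        Visits I R (lookup η p) → Visits I R′ (value (callT x p b) η)
      call-visits {I = I} {η = η} x p b ex 0≤B step (visits P eq u r R)
        with serve I P _ 0≤B r
      ... | T , run≡ , s = visits (extend P (tour T)) encoded (extend-unique u (tour-unique T)) (∈-++⁺ˡ r) (step R s)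
        where
        open ≡-Reasoning
        encoded : value (callT x p b) η ≡ encodeWalk (extend P (tour T))
        encoded = begin
          extendⁿ (lookup η p) (tourⁿ (Algorithm.run A (value (queryT x p b) η)))
            ≡⟨ cong₂ (λ a t → extendⁿ a (tourⁿ t)) eq (trans (cong (Algorithm.run A) (query-value A 0≤B ex eq)) run≡) ⟩
          extendⁿ (encodeWalk P) (tourⁿ (encodeTree T))
            ≡⟨ cong (extendⁿ (encodeWalk P)) (tour-toℕ T) ⟩
          extendⁿ (encodeWalk P) (encodeWalk (tour T))
            ≡⟨ extend-toℕ P (tour T) ⟩
          encodeWalk (extend P (tour T)) ∎

      calls-visits : ∀ {Γ I} {η : Env Γ} (W : ℕ → List (V I) → Set) x p b → lookup η x ≡ enc I → 0ℚ ≤ lookup η b →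
        (∀ {k P T} → W k P → Cov.Serves I ρ γ (lookup η b) P T → W (suc k) (extend P (tour T))) →
        Visits I (W 0) (lookup η p) → Visits I (W K) (value (callsT x p b) η)
      calls-visits {I = I} {η} W x p b ex 0≤B step v = subst (λ k → Visits I (W k) (value (callsT x p b) η)) (length-replicate K)
        (foldr-invariant (λ k → Visits I (W k)) (replicate K true) v
          λ {t} {k} {a} _ _ → call-visits {η = t ∷ a ∷ η} (x ↑↑) v1 (b ↑↑) ex 0≤B step)

      ScaleState : ∀ I → (ℕ → List (V I) → Set) → ℕ → ℕ × List ℕ → Set
      ScaleState I S k (b , a) = b ≡ 2 ℕ.^ k × Visits I (S k) a

      -- S k holds before scale k; W i holds after i calls within the scale.
      ScaleStep : ∀ I → (ℕ → ℚ) → (ℕ → List (V I) → Set) → Set₁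
      ScaleStep I b S = ∀ k P → S k P → Σ[ W ∈ (ℕ → List (V I) → Set) ]
        W 0 P ×
        (∀ {i P T} → W i P → Cov.Serves I ρ γ (b k) P T → W (suc i) (extend P (tour T))) ×
        (∀ {P} → W K P → S (suc k) P)

      -- The bound comes as `B` with an equation, so that matching on `refl` puts the abstract
      -- `scale Q k` in place of the computed fraction.
      scale-visits : ∀ {Γ I S k Q} {η : Env Γ} x B {b : ℕ} {a} → lookup η x ≡ enc I → ScaleStep I (scale Q) S →
        B ≡ scale Q k → Visits I (S k) a → Visits I (S (suc k)) (value (callsT (x ↑ ↑↑) v1 v0) (B ∷ a ∷ b ∷ η))
      scale-visits {I = I} {S} {k} {Q} {η} x B {b} {a} ex step refl (visits P eq u r s) with step k P s
      ... | W , start , next , finish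
        with visits P′ eq′ u′ r′ w ← calls-visits {η = B ∷ a ∷ b ∷ η} W (x ↑ ↑↑) v1 v0 ex (scale-nonneg Q k) next (visits P eq u r start)
        = visits P′ eq′ u′ r′ (finish w)

      scale-state : ∀ {Γ I S k} {η : Env Γ} x q a → lookup η x ≡ enc I → ScaleStep I (scale (lookup η q)) S →
        ScaleState I S k (lookup η a) → ScaleState I S (suc k) (value (scaleT x q a) η)
      scale-state {k = k} {η} x q a ex step (b≡ , v) = cong (2 ℕ.*_) b≡ ,
        scale-visits {k = k} {η = η} x (applyOp frac (proj₁ (lookup η a) , lookup η q)) ex step
          (trans (cong (λ b → applyOp frac (b , lookup η q)) b≡) (sym (scale-frac (lookup η q) k))) v

      scales-state : ∀ {Γ I S} {η : Env Γ} x q t → lookup η x ≡ enc I → ScaleStep I (scale (lookup η q)) S → S 0 (root ∷ []) →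
        ScaleState I S (length (value (roundsT q t) η)) (value (scalesT x q t) η)
      scales-state {I = I} {S} {η} x q t ex step s = foldr-invariant (ScaleState I S) (value (roundsT q t) η)
        (refl , visits (root ∷ []) refl ([] ∷ []) (here refl) s)
        λ {y} {k} {a} _ _ → scale-state {k = k} {η = y ∷ a ∷ η} (x ↑↑) (q ↑↑) v1 ex step

      -- Approximation

      module _ (1≤ρ : 1ℚ ≤ ρ) (1≤γ : 1ℚ ≤ γ) (K-lower : 2ℚ * ρ ≤ natℚ K) (K-upper : natℚ K ≤ 2ℚ * (2ℚ * ρ)) where

        record Approximates I (a : List ℕ) : Set where
          constructor approximation
          field
            path     : Walk (n I)
            encodes  : a ≡ encodeWalk path
            feasible : Cov.FeasiblePath I path
            ratio    : ∀ q → Cov.FeasiblePath I q → Cov.latencyOf I path ≤ 36ℚ * (ρ * γ) * Cov.latencyOf I q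

        module _ I (N Q : ℕ) (row : List ℚ) (M : List (List ℚ))
          (N-bound : sumOver (dist (d I) root) (allFin (suc (n I))) ≤ natℚ N)
          (Q-bound : ∀ v → ↧ₙ (dist (d I) root v) ℕ.≤ suc Q)
          (M-vertices : verticesⁿ M ≡ encodeWalk (allFin (suc (n I)))) where

          private
            D = dist (d I)
            vertices = allFin (suc (n I))
            L = length (binaryDigits (suc Q ℕ.* N))
            b = scale Q

            η : Env (nat ∷ nat ∷ list rat ∷ matrixTy ∷ σ ∷ list bool ∷ [])
            η = N ∷ Q ∷ row ∷ M ∷ enc I ∷ [] ∷ []

            -- All competitors at once, since one run has to be compared with every `q`.
            S : ℕ → List (V I) → Set
            S k P = ∀ q → Cov.FeasiblePath I q → Cov.BeforeScale I 1≤ρ 1≤γ b (scale-nonneg Q) (scale-suc Q) K k q P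

            step : ScaleStep I b S
            step k P s = (λ i P′ → ∀ q → Cov.FeasiblePath I q → Cov.WithinScale I 1≤ρ 1≤γ (b k) q (Cov.potential I 1≤ρ 1≤γ (b k) P) i P′)
              , (λ q f → Cov.scale-start I 1≤ρ 1≤γ)
              , (λ w served q f → Cov.call-step I 1≤ρ 1≤γ (scale-nonneg Q k) f served (w q f))
              , (λ w q f → Cov.bounded-scale I 1≤ρ 1≤γ b (scale-nonneg Q) (scale-suc Q) K-lower (s q f) (w q f))

            state : ScaleState I S L (value (scalesT (v2 ↑↑) v1 v0) η)
            state = scales-state {η = η} (v2 ↑↑) v1 v0 refl step λ q f → Cov.bounded-start I 1≤ρ 1≤γ b (scale-nonneg Q) (scale-suc Q)

            finish : ∀ {a} → Visits I (S L) a → Approximates I (dropRootⁿ (extendⁿ a (verticesⁿ M)))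
            finish {a} (visits P encoded unique _ holds) = approximation (dropRoot W) value≡
                (dropRoot-path (extend-unique unique (Unique.allFin⁺ (suc (n I)))) , covers)
                λ q f → Cov.final-bound I 1≤ρ 1≤γ b (scale-nonneg Q) (scale-suc Q) {w = vertices} K-upper (first≤ q f) vertices-closed (holds q f)
              where
              W = extend P vertices

              value≡ : dropRootⁿ (extendⁿ a (verticesⁿ M)) ≡ encodeWalk (dropRoot W)
              value≡ = begin
                dropRootⁿ (extendⁿ a (verticesⁿ M))                     ≡⟨ cong₂ (λ a b → dropRootⁿ (extendⁿ a b)) encoded M-vertices ⟩
                dropRootⁿ (extendⁿ (encodeWalk P) (encodeWalk vertices)) ≡⟨ cong dropRootⁿ (extend-toℕ P vertices) ⟩
                dropRootⁿ (encodeWalk W)                                ≡⟨ dropRoot-toℕ W ⟩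
                encodeWalk (dropRoot W)                                 ∎
                where open ≡-Reasoning

              covers : ∀ j → Any (C I j) (dropRoot W)
              covers j with coverable I j
              ... | v , c = lose (∈-dropRoot (⊆-extend {P = P} (∈-allFin v)) (λ { refl → root-∉ I j c })) c

              -- A path never returns to the root, so its first edge has positive length, hence
              -- length at least `1 / suc Q`, and it is part of every latency.
              first≤ : ∀ q → Cov.FeasiblePath I q → ∀ j → b 0 ≤ Cov.opt I q j
              first≤ []      (_ , meets) j with () ← meets j
              first≤ (v ∷ q) ((r≢v ∷ _) ∷ _ , _) j = ≤-trans
                (1/denominator≤scale (dist-nonneg (d I) root v) (r≢v ∘ Equivalence.to (Metric.dist≡0 (d I) root v)) (Q-bound v))
                (≤-trans (≤-reflexive (sym (+-identityʳ (D root v)))) (+-monoʳ-≤ (D root v)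
                  (Cov.if-nonneg I (does (C? I j v)) ≤-refl (lengthUntil-nonneg (d I) (C? I j) v q))))

              vertices-closed : closed (d I) root vertices ≤ 2ℚ * b L
              vertices-closed = begin
                closed (d I) root vertices                      ≤⟨ closed-star (d I) root vertices ⟩
                D root root + 2ℚ * sumOver (D root) vertices    ≡⟨ cong (_+ 2ℚ * sumOver (D root) vertices) (dist-self (d I) root) ⟩
                0ℚ + 2ℚ * sumOver (D root) vertices             ≡⟨ +-identityˡ _ ⟩
                2ℚ * sumOver (D root) vertices                  ≤⟨ *-monoˡ-≤-nonNeg 2ℚ N-bound ⟩
                2ℚ * natℚ N                                     ≤⟨ *-monoˡ-≤-nonNeg 2ℚ (natℚ≤scale Q N) ⟩
                2ℚ * b L                                        ∎
                where open ≤-Reasoning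

          opaque
            unfolding searchT

            search-approximates : Approximates I (value searchT η)
            search-approximates = finish (proj₂ state)

        module _ I (M : List (List ℚ)) (M≡ : M ≡ encodeMetric (d I)) where

          private
            D = dist (d I)

            η₀ : Env (matrixTy ∷ σ ∷ list bool ∷ [])
            η₀ = M ∷ enc I ∷ [] ∷ []

            η₁ : Env (list rat ∷ matrixTy ∷ σ ∷ list bool ∷ [])
            η₁ = value (headT v0) η₀ ∷ η₀

            η₂ : Env (nat ∷ list rat ∷ matrixTy ∷ σ ∷ list bool ∷ [])
            η₂ = value (totalT denʳ v0) η₁ ∷ η₁

            row≡ : value (headT v0) η₀ ≡ tabulate (D root)
            row≡ = cong (foldr (λ x _ → x) []) M≡

          opaque
            unfolding numeratorsT

            numerators-approximates : Approximates I (value numeratorsT η₂)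
            numerators-approximates = search-approximates I (value (totalT numʳ v1) η₂) (value (totalT denʳ v0) η₁) (value (headT v0) η₀) M
              (subst (λ r → sumOver (D root) (allFin (suc (n I))) ≤ natℚ (total (λ x → ℤ.∣ ↥ x ∣) r)) (sym row≡)
                (sumOver≤numerators (D root) (dist-nonneg (d I) root) id))
              (λ v → subst (λ r → ↧ₙ (D root v) ℕ.≤ suc (total ↧ₙ_ r)) (sym row≡)
                (ℕₚ.m≤n⇒m≤1+n (∈-total ↧ₙ_ (∈-tabulate⁺ {f = D root} v))))
              (trans (cong verticesⁿ M≡) (trans (vertices-tabulate (λ u → tabulate (D u))) (sym (map-tabulate id toℕ))))

          opaque
            unfolding denominatorsT

            denominators-approximates : Approximates I (value denominatorsT η₁)
            denominators-approximates = numerators-approximates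

          opaque
            unfolding sumsT

            sums-approximates : Approximates I (value sumsT η₀)
            sums-approximates = denominators-approximates

        opaque
          unfolding latencyT

          approximates : ∀ I → Approximates I (value latencyT (enc I ∷ [] ∷ []))
          approximates I = sums-approximates I _ (matrix-value A {η = enc I ∷ [] ∷ []} {x = v0} refl)

      -- Running time

      module _ (time-bound : Σ[ p ∈ Polynomial ] ∀ q →
        Algorithm.time A (encQuery q) ℕ.≤ Polynomial.at p (size κ (encQuery q))) where

        private
          Good : ∀ I → List ℕ → Set
          Good I = Visits I (λ _ → ⊤)

        module _ {J : Set} {s : J → ℕ} {I : J → Inst} (bn : Bounded s (n ∘ I)) where

          good-bounded : {a : J → List ℕ} → (∀ j → Good (I j) (a j)) → Bounded s (size (list nat) ∘ a)
          good-bounded good = encodesUnique-bounded A bn (visits-unique ∘ good)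

        module _ {J : Set} {Γ : List Ty} {s : J → ℕ} {η : J → Env Γ} {I : J → Inst} (bn : Bounded s (n ∘ I)) where

          call-cost : ∀ {x p b} → (∀ j → lookup (η j) x ≡ enc (I j)) → (∀ j → 0ℚ ≤ lookup (η j) b) →
            (∀ j → Good (I j) (lookup (η j) p)) → Small s η x → Small s η b → Cost s η (callT x p b)
          call-cost {x} {p} {b} ex 0≤b good bx bb = letin-cost c-oracle (letin-cost c-tour
              (extendT-cost A (good-bounded bn good) (value-bounded c-tour)))
            where
            c-query : Cost s η (queryT x p b)
            c-query = query-cost A bx (good-bounded bn good) bb

            -- The time bound of `A` speaks of encoded instances, and by the invariant the query is
            -- one.
            le : ∀ j → Algorithm.time A (value (queryT x p b) (η j)) ℕ.≤ Polynomial.at (proj₁ time-bound) (size κ (value (queryT x p b) (η j)))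
            le j with good j
            ... | visits P eq _ _ _ = subst (λ v → Algorithm.time A v ℕ.≤ Polynomial.at (proj₁ time-bound) (size κ v))
              (sym (query-value A {η = η j} {x = x} {p = p} {b = b} (0≤b j) (ex j) eq)) (proj₂ time-bound _)

            c-oracle : Cost s η (oracle (queryT x p b))
            c-oracle = oracle-cost c-query (≤-bounded le (at-bounded (proj₁ time-bound) (value-bounded c-query)))

            c-tour : Cost s (λ j → value (oracle (queryT x p b)) (η j) ∷ η j) (tourT v0)
            c-tour = tourT-cost A bn (λ j → answers x p b (ex j) (0≤b j) (good j)) (value-bounded c-oracle)

        module _ {J : Set} {Γ : List Ty} {s : J → ℕ} {η : J → Env Γ} {I : J → Inst} (bn : Bounded s (n ∘ I)) where

          calls-cost : ∀ {x p b} → (∀ j → lookup (η j) x ≡ enc (I j)) → (∀ j → 0ℚ ≤ lookup (η j) b) →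
            (∀ j → Good (I j) (lookup (η j) p)) → Small s η x → Small s η b → Cost s η (callsT x p b)
          calls-cost {x} {p} {b} ex 0≤b good bx bb = fold-cost (λ j _ a → Good (I j) a) const-cost
            (var-cost (good-bounded bn good)) good
            (λ {j} {t} {k} {a} _ _ → call-visits {η = t ∷ a ∷ η j} (x ↑↑) v1 (b ↑↑) (ex j) (0≤b j) (λ _ _ → tt))
            (call-cost (reindex index bn) {x = x ↑↑} {v1} {b ↑↑} (ex ∘ index) (0≤b ∘ index) holds (reindex index bx) (reindex index bb))

        trivial-step : ∀ {I b} → ScaleStep I b (λ _ _ → ⊤)
        trivial-step k P _ = (λ _ _ → ⊤) , tt , (λ _ _ → tt) , (λ _ → tt)

        module _ {J : Set} {Γ : List Ty} {s : J → ℕ} {η : J → Env Γ} {I : J → Inst} (bn : Bounded s (n ∘ I)) where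

          scale-cost : ∀ {x q a} {k : J → ℕ} → (∀ j → lookup (η j) x ≡ enc (I j)) →
            (∀ j → ScaleState (I j) (λ _ _ → ⊤) (k j) (lookup (η j) a)) → Bounded s k →
            Small s η x → Small s η q → Cost s η (scaleT x q a)
          scale-cost {x} {q} {a} {k} ex state bk bx bq =
            letin-cost c-fst (letin-cost c-snd (letin-cost c-frac
              (pair-cost (mul-cost A (pair-cost const-cost (var-cost (value-bounded c-fst))))
                (calls-cost bn {x = x ↑ ↑↑} {v1} {v0} ex frac-nonneg (proj₂ ∘ state) bx (value-bounded c-frac)))))
            where
            -- The number `2 ^ k` has `k + 1` bits, and `k` is polynomially bounded.
            ba : Small s η a
            ba = +-bounded (≤-bounded (λ j → subst (λ b → bitLength b ℕ.≤ suc (k j)) (sym (proj₁ (state j))) (bitLength-bound ℕₚ.≤-refl)) (suc-bounded bk))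
              (good-bounded bn (proj₂ ∘ state))

            c-fst : Cost s η (op fst (var a))
            c-fst = fst-cost A (var-cost ba)

            c-snd : Cost s (λ j → proj₁ (lookup (η j) a) ∷ η j) (op snd (var (a ↑)))
            c-snd = snd-cost A (var-cost ba)

            c-frac : Cost s (λ j → proj₂ (lookup (η j) a) ∷ proj₁ (lookup (η j) a) ∷ η j) (op frac (pair (var v1) (var (q ↑↑))))
            c-frac = frac-cost A (pair-cost (var-cost (value-bounded c-fst)) (var-cost bq))

            frac-nonneg : ∀ j → 0ℚ ≤ applyOp frac (proj₁ (lookup (η j) a) , lookup (η j) q)
            frac-nonneg j = subst (0ℚ ≤_) (trans (scale-frac (lookup (η j) q) (k j)) (cong (λ b → applyOp frac (b , lookup (η j) q)) (sym (proj₁ (state j)))))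
              (scale-nonneg (lookup (η j) q) (k j))

        module _ {J : Set} {Γ : List Ty} {s : J → ℕ} {η : J → Env Γ} {I : J → Inst} (bn : Bounded s (n ∘ I)) where

          scales-cost : ∀ {x q t} → (∀ j → lookup (η j) x ≡ enc (I j)) → Small s η x → Small s η q → Small s η t →
            Cost s η (scalesT x q t)
          scales-cost {x} {q} {t} ex bx bq bt = fold-cost (λ j → ScaleState (I j) (λ _ _ → ⊤)) c-rounds const-cost
            (λ j → refl , visits (root ∷ []) refl ([] ∷ []) (here refl) tt)
            (λ {j} {y} {k} {a} _ _ → scale-state {k = k} {η = y ∷ a ∷ η j} (x ↑↑) (q ↑↑) v1 (ex j) trivial-step)
            (scale-cost (reindex index bn) {x = x ↑↑} {q ↑↑} {v1} (ex ∘ index) holds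
              (≤-bounded (λ i → ℕₚ.<⇒≤ (ℕₚ.<-≤-trans (round< i) (length≤size {nat} (value (roundsT q t) (η (index i)))))) (reindex index (value-bounded c-rounds)))
              (reindex index bx) (reindex index bq))
            where
            c-rounds : Cost s η (roundsT q t)
            c-rounds = digits-cost A (mul-cost A (pair-cost (add-cost A (pair-cost const-cost (var-cost bq))) (var-cost bt)))

        module _ {J : Set} {s : J → ℕ} {I : J → Inst} (bn : Bounded s (n ∘ I)) (bx : Bounded s (size σ ∘ enc ∘ I))
          {M : J → List (List ℚ)} (bM : Bounded s (size matrixTy ∘ M)) {ω : J → List Bool} where

          search-cost : ∀ {N Q : J → ℕ} {row : J → List ℚ} → Bounded s (bitLength ∘ N) → Bounded s (bitLength ∘ Q) →
            Cost s (λ j → N j ∷ Q j ∷ row j ∷ M j ∷ enc (I j) ∷ ω j ∷ []) searchT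
          search-cost {N} {Q} {row} bN bQ = go
            where
            η : J → Env (nat ∷ nat ∷ list rat ∷ matrixTy ∷ σ ∷ list bool ∷ [])
            η j = N j ∷ Q j ∷ row j ∷ M j ∷ enc (I j) ∷ ω j ∷ []

            opaque
              unfolding searchT

              go : Cost s η searchT
              go = letin-cost c-scales
                (letin-cost c-snd (letin-cost c-vertices (letin-cost c-extend (dropRootT-cost A (value-bounded c-extend)))))
                where
                R : J → ℕ × List ℕ
                R j = value (scalesT (v2 ↑↑) v1 v0) (η j)

                c-scales : Cost s η (scalesT (v2 ↑↑) v1 v0)
                c-scales = scales-cost bn {x = v2 ↑↑} {v1} {v0} (λ _ → refl) bx bQ bN

                c-snd : Cost s (λ j → R j ∷ η j) (op snd (var v0))
                c-snd = snd-cost A (var-cost (value-bounded c-scales))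

                c-vertices : Cost s (λ j → proj₂ (R j) ∷ R j ∷ η j) (verticesT (v2 ↑ ↑↑))
                c-vertices = verticesT-cost A bM

                c-extend : Cost s (λ j → verticesⁿ (M j) ∷ proj₂ (R j) ∷ R j ∷ η j) (extendT v1 v0)
                c-extend = extendT-cost A (value-bounded c-snd) (value-bounded c-vertices)

          private
            η₀ : J → Env (matrixTy ∷ σ ∷ list bool ∷ [])
            η₀ j = M j ∷ enc (I j) ∷ ω j ∷ []

            η₁ : J → Env (list rat ∷ matrixTy ∷ σ ∷ list bool ∷ [])
            η₁ j = value (headT v0) (η₀ j) ∷ η₀ j

            η₂ : J → Env (nat ∷ list rat ∷ matrixTy ∷ σ ∷ list bool ∷ [])
            η₂ j = value (totalT denʳ v0) (η₁ j) ∷ η₁ j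

            c-head : Cost s η₀ (headT v0)
            c-head = headT-cost A bM

            c-den : Cost s η₁ (totalT denʳ v0)
            c-den = totalT-cost A (λ q → ℕₚ.≤-trans (ℕₚ.m≤n+m _ (bitLength ℤ.∣ ↥ q ∣)) (ℕₚ.m≤n+m _ 2)) (value-bounded c-head)

            c-num : Cost s η₂ (totalT numʳ v1)
            c-num = totalT-cost A (λ q → ℕₚ.≤-trans (ℕₚ.m≤m+n _ _) (ℕₚ.m≤n+m _ 2)) (value-bounded c-head)

          opaque
            unfolding numeratorsT

            numerators-cost : Cost s η₂ numeratorsT
            numerators-cost = letin-cost c-num (search-cost (value-bounded c-num) (value-bounded c-den))

          opaque
            unfolding denominatorsT

            denominators-cost : Cost s η₁ denominatorsT
            denominators-cost = letin-cost c-den numerators-cost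

          opaque
            unfolding sumsT

            sums-cost : Cost s η₀ sumsT
            sums-cost = letin-cost c-head denominators-cost

        private
          J : Set
          J = Inst × List Bool

          s : J → ℕ
          s (I , _) = size σ (enc I)

          η : J → Env (σ ∷ list bool ∷ [])
          η (I , ω) = enc I ∷ ω ∷ []

          c-matrix : Cost s η (matrixT v0)
          c-matrix = matrix-cost A self-bounded

          -- The distance matrix has `suc n` rows, and each contributes to its size.
          n-bounded : Bounded s (n ∘ proj₁)
          n-bounded = ≤-bounded (λ { (I , ω) → begin
            n I                                           ≤⟨ ℕₚ.n≤1+n (n I) ⟩
            suc (n I)                                     ≡⟨ length-tabulate (λ u → tabulate (dist (d I) u)) ⟨
            length (encodeMetric (d I))                   ≤⟨ length≤size {list rat} (encodeMetric (d I)) ⟩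
            size matrixTy (encodeMetric (d I))            ≡⟨ cong (size matrixTy) (matrix-value A {η = η (I , ω)} {x = v0} refl) ⟨
            size matrixTy (value (matrixT v0) (η (I , ω))) ∎ }) (value-bounded c-matrix)
            where open ℕₚ.≤-Reasoning

        opaque
          unfolding latencyT

          latency-cost : Cost s η latencyT
          latency-cost = letin-cost c-matrix (sums-cost n-bounded self-bounded (value-bounded c-matrix))

        time-bounded : Bounded s (λ j → Algorithm.time (RandomizedAlgorithm.algorithm (reduction ⟨ A ⟩)) (enc (proj₁ j) , proj₂ j))
        time-bounded = +-bounded (steps-bounded latency-cost) (value-bounded latency-cost)

-- Path orienteering for ML and group orienteering for MGL.

module Instances where

  open PolynomialBounds
  import Data.Rational
  open RunningTime
  open TreeTours
  open Latency
  open Scales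
  open Programs
  open GenericReduction
  open import Algebra.Definitions.RawMonoid Data.Rational.+-0-rawMonoid using (sum)
  open import Data.Bool using (Bool; true; false; if_then_else_)
  open import Data.Fin using (Fin; zero; suc; toℕ)
  open import Data.Fin.Properties using (_≟_)
  open import Data.Fin.Subset using (Subset) renaming (_∈_ to _∈ˢ_)
  open import Data.List using (List; []; _∷_; length; foldr; map; tabulate)
  open import Data.List.Membership.Propositional using (_∈_; lose; find)
  open import Data.List.Membership.Propositional.Properties using (∈-map⁺; ∈-map⁻)
  open import Data.List.Relation.Unary.Any as Any using (Any; here; there; any?)
  open import Data.List.Relation.Unary.All as All using (All; []; _∷_; lookup)
  open import Data.Nat as ℕ using (ℕ; zero; suc)
  import Data.Nat.Properties as ℕₚ
  open import Data.Product hiding (map)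
  open import Data.Rational hiding (_≟_; round)
  open import Data.Rational.Properties hiding (_≟_)
  open import Data.Vec as Vec using (Vec; []; _∷_; toList)
  open import Function using (_∘_)
  open import Function.Bundles using (mk⇔)
  open import Relation.Binary.PropositionalEquality hiding (J)
  open import Relation.Nullary
  open import Relation.Nullary.Decidable using (does-⇔; dec-true)

  sum-cong : ∀ {m} {f g : Fin m → ℚ} → (∀ j → f j ≡ g j) → sum f ≡ sum g
  sum-cong {zero}  h = refl
  sum-cong {suc m} h = cong₂ _+_ (h zero) (sum-cong (h ∘ suc))

  foldr-tabulate : ∀ {A B : Set} (f : A → B) {k} {g : Fin k → A} {h : Fin k → B} → (∀ i → f (g i) ≡ h i) →
    foldr (λ x a → f x ∷ a) [] (tabulate g) ≡ tabulate h
  foldr-tabulate f {zero}  e = refl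
  foldr-tabulate f {suc k} e = cong₂ _∷_ (e zero) (foldr-tabulate f (e ∘ suc))

  reward-nonneg : ∀ b → 0ℚ ≤ (if b then 0ℚ else 1ℚ)
  reward-nonneg true  = ≤-refl
  reward-nonneg false = 0≤1ℚ

  reward-size : ∀ b → size rat (if b then 0ℚ else 1ℚ) ℕ.≤ 2
  reward-size true  = ℕₚ.≤-refl
  reward-size false = ℕₚ.≤-refl

  -- Minimum latency

  module _ {κ α : Ty} where

    vertexRewardsT : ∀ {Γ} → matrixTy ∈ Γ → list nat ∈ Γ → Term κ α Γ (list rat)
    vertexRewardsT x p = fold (verticesT x) (const []) (cons (cond (memberT v0 (p ↑↑)) (const 0ℚ) (const 1ℚ)) (var v1))

    module _ (A : Algorithm κ α) where

      open Costs A

      vertexRewardsT-cost : ∀ {J Γ s} {η : J → Env Γ} {x p} → Small s η x → Small s η p → Cost s η (vertexRewardsT x p)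
      vertexRewardsT-cost {η = η} {p = p} bx bp = growing-fold-cost (const-bounded 2) (verticesT-cost A bx) const-cost
        (λ {j} {v} {a} _ → ℕₚ.+-monoˡ-≤ (size (list rat) a) (reward-size (memberⁿ v (lookup (η j) p))))
        λ h _ _ be ba → cons-cost (cond-cost (memberT-cost A be (reindex h bp)) const-cost const-cost) (var-cost ba)

  module _ {n : ℕ} where

    open import Data.List.Membership.DecPropositional (_≟_ {suc n}) using (_∈?_)

    vertexReward : List (Vertex n) → Vertex n → ℚ
    vertexReward P v = if does (v ∈? P) then 0ℚ else 1ℚ

    -- Membership and the covering condition state the same equation in opposite directions; only
    -- the decisions have to agree.
    does-∈? : ∀ (v : Vertex n) vs → does (v ∈? vs) ≡ does (any? (_≟ v) vs)
    does-∈? v vs = does-⇔ (mk⇔ (Any.map sym) (Any.map sym)) (v ∈? vs) (any? (_≟ v) vs)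

  if-const : ∀ b {x : ℚ} → (if b then x else x) ≡ x
  if-const true  = refl
  if-const false = refl

  ML-problem : CoverProblem (OrienteeringProblem.inputTy PathOrienteering) (LatencyProblem.inputTy ML)
  ML-problem = record
    { Inst         = MLInstance
    ; enc          = LatencyProblem.encode ML
    ; n            = MLInstance.n
    ; d            = MLInstance.d
    ; m            = MLInstance.n
    ; C            = λ I j v → v ≡ suc j
    ; C?           = λ I j → _≟ suc j
    ; root-∉       = λ I j ()
    ; coverable    = λ I j → suc j , refl
    ; Query        = PathOrienteeringInstance
    ; encQuery     = OrienteeringProblem.encode PathOrienteering
    ; query        = λ I P B 0≤B → record { n = MLInstance.n I ; d = MLInstance.d I ; π = vertexReward P
                       ; π-nonneg = λ v → reward-nonneg _ ; B = B ; B-nonneg = 0≤B }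
    ; matrixT      = var
    ; matrix-value = λ A e → e
    ; matrix-cost  = λ A → Costs.var-cost A
    ; queryT       = λ x p b → pair (var x) (pair (vertexRewardsT x p) (var b))
    ; query-value  = λ A {_} {η} {x} {p} {b} {I} {P} 0≤B ex ep → cong₂ (λ M r → M , r , lookup η b) ex
        (trans (cong₂ (λ M P → foldr (λ v a → (if memberⁿ v P then 0ℚ else 1ℚ) ∷ a) [] (verticesⁿ M)) ex ep)
        (trans (cong (foldr (λ v a → (if memberⁿ v (encodeWalk P) then 0ℚ else 1ℚ) ∷ a) []) (vertices-tabulate (λ u → tabulate (dist (MLInstance.d I) u))))
          (foldr-tabulate (λ v → if memberⁿ v (encodeWalk P) then 0ℚ else 1ℚ) {g = toℕ}
            (λ v → cong (λ c → if c then 0ℚ else 1ℚ) (member-toℕ v P)))))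
    ; query-cost   = λ A bx bp bb → let open Costs A in
        pair-cost (var-cost bx) (pair-cost (vertexRewardsT-cost A bx bp) (var-cost bb))
    }

  -- Minimum group latency

  -- Position 0 of a subset is vertex 1, since vertex 0 is the root. The shift in every round turns
  -- positions into vertices.
  nodesⁿ : List Bool → List ℕ
  nodesⁿ = foldr (λ b a → if b then 1 ∷ sucs a else sucs a) []

  meetsⁿ : List ℕ → List ℕ → Bool
  meetsⁿ l P = foldr (λ v a → if memberⁿ v P then true else a) false l

  groupNodes : ∀ {n} → Subset n → List (Vertex n)
  groupNodes []      = []
  groupNodes (b ∷ g) = if b then suc zero ∷ map suc (groupNodes g) else map suc (groupNodes g)

  sucs-map : ∀ {n} (w : List (Fin n)) → sucs (map toℕ w) ≡ map toℕ (map suc w)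
  sucs-map []      = refl
  sucs-map (v ∷ w) = cong (suc (toℕ v) ∷_) (sucs-map w)

  nodes-toList : ∀ {n} (g : Subset n) → nodesⁿ (toList g) ≡ encodeWalk (groupNodes g)
  nodes-toList []          = refl
  nodes-toList (true ∷ g)  = cong (1 ∷_) (trans (cong sucs (nodes-toList g)) (sucs-map (groupNodes g)))
  nodes-toList (false ∷ g) = trans (cong sucs (nodes-toList g)) (sucs-map (groupNodes g))

  ∈-groupNodes⁻ : ∀ {n} (g : Subset n) {v} → v ∈ groupNodes g → InGroup g v
  ∈-groupNodes⁻ (true ∷ g)  (here refl) = Vec.there Vec.here
  ∈-groupNodes⁻ (true ∷ g)  (there p)   with ∈-map⁻ suc p
  ... | _ , q , refl with ∈-groupNodes⁻ g q
  ...   | Vec.there r = Vec.there (Vec.there r)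
  ∈-groupNodes⁻ (false ∷ g) p with ∈-map⁻ suc p
  ... | _ , q , refl with ∈-groupNodes⁻ g q
  ...   | Vec.there r = Vec.there (Vec.there r)

  ∈-groupNodes⁺ : ∀ {n} (g : Subset n) {i} → i ∈ˢ g → suc i ∈ groupNodes g
  ∈-groupNodes⁺ (true ∷ g)  Vec.here      = here refl
  ∈-groupNodes⁺ (true ∷ g)  (Vec.there p) = there (∈-map⁺ suc (∈-groupNodes⁺ g p))
  ∈-groupNodes⁺ (false ∷ g) (Vec.there p) = ∈-map⁺ suc (∈-groupNodes⁺ g p)

  module _ {n : ℕ} where

    open import Data.List.Membership.DecPropositional (_≟_ {suc n}) using (_∈?_)

    meets-toℕ : ∀ (l P : List (Vertex n)) → meetsⁿ (encodeWalk l) (encodeWalk P) ≡ does (any? (_∈? P) l)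
    meets-toℕ []      P = refl
    meets-toℕ (v ∷ l) P rewrite member-toℕ v P | meets-toℕ l P with does (v ∈? P)
    ... | true  = refl
    ... | false = refl

    -- The program looks up the nodes of the group in `P`, whereas the instance looks for a node of
    -- the group along `P`.
    meets-group : ∀ (g : Subset n) P → meetsⁿ (nodesⁿ (toList g)) (encodeWalk P) ≡ does (any? (inGroup? g) P)
    meets-group g P = trans (cong (λ l → meetsⁿ l (encodeWalk P)) (nodes-toList g)) (trans (meets-toℕ (groupNodes g) P)
      (does-⇔ (mk⇔ to from) (any? (_∈? P) (groupNodes g)) (any? (inGroup? g) P)))
      where
      to : Any (_∈ P) (groupNodes g) → Any (InGroup g) P
      to p with find p
      ... | v , v∈g , v∈P = lose v∈P (∈-groupNodes⁻ g v∈g)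
      from : Any (InGroup g) P → Any (_∈ P) (groupNodes g)
      from p with find p
      ... | suc i , i∈P , Vec.there i∈g = lose (∈-groupNodes⁺ g i∈g) i∈P

  module _ {κ α : Ty} where

    nodesT : ∀ {Γ} → list bool ∈ Γ → Term κ α Γ (list nat)
    nodesT g = fold (var g) (const []) (letin (sucsT v1) (cond (var v1) (cons (const 1) (var v0)) (var v0)))

    meetsT : ∀ {Γ} → list nat ∈ Γ → list nat ∈ Γ → Term κ α Γ bool
    meetsT l p = fold (var l) (const false) (cond (memberT v0 (p ↑↑)) (const true) (var v1))

    groupRewardsT : ∀ {Γ} → list (list bool) ∈ Γ → list nat ∈ Γ → Term κ α Γ (list rat)
    groupRewardsT gs p = fold (var gs) (const [])
      (letin (nodesT v0) (cons (cond (meetsT v0 (p ↑ ↑↑)) (const 0ℚ) (const 1ℚ)) (var v2)))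

    groupQueryT : ∀ {Γ} → (matrixTy ×ᵗ groupsTy) ∈ Γ → list nat ∈ Γ → rat ∈ Γ → Term κ α Γ (matrixTy ×ᵗ groupsTy ×ᵗ list rat ×ᵗ rat)
    groupQueryT x p b = pair (op fst (var x)) (pair (op snd (var x))
      (pair (letin (op snd (var x)) (groupRewardsT v0 (p ↑))) (var b)))

    module _ (A : Algorithm κ α) where

      open Costs A

      meetsT-cost : ∀ {J Γ s} {η : J → Env Γ} {l p} → Small s η l → Small s η p → Cost s η (meetsT l p)
      meetsT-cost bl bp = growing-fold-cost (const-bounded 1) (var-cost bl) const-cost (λ _ → ℕ.s≤s ℕ.z≤n)
        λ h _ _ be ba → cond-cost (memberT-cost A be (reindex h bp)) const-cost (var-cost ba)

      -- As in `verticesT-cost`, every round shifts all entries. The invariant bounds both their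
      -- number and their values by the round.
      nodesT-cost : ∀ {J Γ s} {η : J → Env Γ} {g} → Small s η g → Cost s η (nodesT g)
      nodesT-cost {s = s} {η = η} {g} bg = fold-cost Inv (var-cost bg) const-cost (λ j → [] , refl , ℕ.z≤n)
        (λ {j} {b} {k} {a} _ _ → step j k b a) c-step
        where
        Inv : _ → ℕ → List ℕ → Set
        Inv _ k a = Σ[ w ∈ List (Fin (suc k)) ] a ≡ map toℕ w × length w ℕ.≤ k

        length-suc : ∀ {k l} (w : List (Fin k)) → length w ℕ.≤ l → length (map Fin.suc w) ℕ.≤ l
        length-suc w = subst (ℕ._≤ _) (sym (length-map suc w))
          where open import Data.List.Properties using (length-map)

        step : ∀ j k b a → Inv j k a → Inv j (suc k) (if b then 1 ∷ sucs a else sucs a)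
        step j k true  _ (w , refl , le) = suc zero ∷ map suc w , cong (1 ∷_) (sucs-map w) , ℕ.s≤s (length-suc w le)
        step j k false _ (w , refl , le) = map suc w , sucs-map w , ℕₚ.m≤n⇒m≤1+n (length-suc w le)

        It : Set
        It = Iteration {s = s} {ρ = η} (var g) Inv

        round-bounded : Bounded {It} (s ∘ index) round
        round-bounded = ≤-bounded (λ i → ℕₚ.<⇒≤ (ℕₚ.<-≤-trans (round< i) (length≤size {bool} (lookup (η (index i)) g)))) (reindex index bg)

        acc-bounded : Bounded {It} (s ∘ index) (size (list nat) ∘ acc)
        acc-bounded = ≤-bounded (λ i → le i (holds i)) (suc-bounded (*-bounded round-bounded (suc-bounded (suc-bounded round-bounded))))
          where
          le : ∀ (i : It) → Inv (index i) (round i) (acc i) → size (list nat) (acc i) ℕ.≤ suc (round i ℕ.* suc (suc (round i)))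
          le i (w , eq , l) = ℕₚ.≤-trans (ℕₚ.≤-reflexive (cong (size (list nat)) eq))
            (ℕₚ.≤-trans (size-map {nat} toℕ bitLength-toℕ w) (ℕ.s≤s (ℕₚ.*-monoˡ-≤ (suc (suc (round i))) l)))

        c-sucs : Cost {It} (s ∘ index) (λ i → element i ∷ acc i ∷ η (index i)) (sucsT v1)
        c-sucs = sucsT-cost A acc-bounded

        c-step : Cost {It} (s ∘ index) (λ i → element i ∷ acc i ∷ η (index i)) (letin (sucsT v1) (cond (var v1) (cons (const 1) (var v0)) (var v0)))
        c-step = letin-cost c-sucs (cond-cost (var-cost (const-bounded 1))
          (cons-cost const-cost (var-cost (value-bounded c-sucs))) (var-cost (value-bounded c-sucs)))

      groupRewardsT-cost : ∀ {J Γ s} {η : J → Env Γ} {gs p} → Small s η gs → Small s η p → Cost s η (groupRewardsT gs p)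
      groupRewardsT-cost {s = s} {η} {gs} {p} bg bp = growing-fold-cost (const-bounded 2) (var-cost bg) const-cost
        (λ {j} {g} {a} _ → ℕₚ.+-monoˡ-≤ (size (list rat) a) (reward-size (meetsⁿ (nodesⁿ g) (lookup (η j) p))))
        λ h x a be ba → letin-cost (nodesT-cost be) (cons-cost (cond-cost (meetsT-cost (value-bounded (nodesT-cost {η = λ i → x i ∷ a i ∷ η (h i)} {g = v0} be)) (reindex h bp)) const-cost const-cost) (var-cost ba))

      groupQueryT-cost : ∀ {J Γ s} {η : J → Env Γ} {x p b} → Small s η x → Small s η p → Small s η b → Cost s η (groupQueryT x p b)
      groupQueryT-cost {s = s} {η} {x} bx bp bb = pair-cost (fst-cost A (var-cost bx)) (pair-cost c-groups
          (pair-cost (letin-cost c-groups (groupRewardsT-cost (value-bounded c-groups) bp)) (var-cost bb)))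
        where
        c-groups : Cost s η (op snd (var x))
        c-groups = snd-cost A (var-cost bx)

  MGL-problem : CoverProblem (OrienteeringProblem.inputTy GroupOrienteering) (LatencyProblem.inputTy MGL)
  MGL-problem = record
    { Inst         = MGLInstance
    ; enc          = LatencyProblem.encode MGL
    ; n            = MGLInstance.n
    ; d            = MGLInstance.d
    ; m            = MGLInstance.m
    ; C            = λ I j → InGroup (MGLInstance.G I j)
    ; C?           = λ I j → inGroup? (MGLInstance.G I j)
    ; root-∉       = λ I j ()
    ; coverable    = λ I j → suc (proj₁ (MGLInstance.G-nonempty I j)) , Vec.there (proj₂ (MGLInstance.G-nonempty I j))
    ; Query        = GroupOrienteeringInstance
    ; encQuery     = OrienteeringProblem.encode GroupOrienteering
    ; query        = λ I P B 0≤B → record { n = MGLInstance.n I ; d = MGLInstance.d I ; m = MGLInstance.m I ; G = MGLInstance.G I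
                       ; π = λ j → if does (any? (inGroup? (MGLInstance.G I j)) P) then 0ℚ else 1ℚ
                       ; π-nonneg = λ j → reward-nonneg _ ; B = B ; B-nonneg = 0≤B }
    ; matrixT      = λ x → op fst (var x)
    ; matrix-value = λ A e → cong proj₁ e
    ; matrix-cost  = λ A b → fst-cost A (Costs.var-cost A b)
    ; queryT       = groupQueryT
    ; query-value  = λ A {_} {η} {x} {p} {b} {I} {P} 0≤B ex ep → cong₂ (λ M r → proj₁ M , proj₂ M , r , lookup η b) ex
        (trans (cong₂ (λ M P → foldr (λ g a → (if meetsⁿ (nodesⁿ g) P then 0ℚ else 1ℚ) ∷ a) [] (proj₂ M)) ex ep)
          (foldr-tabulate (λ g → if meetsⁿ (nodesⁿ g) (encodeWalk P) then 0ℚ else 1ℚ) {g = λ j → toList (MGLInstance.G I j)}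
            (λ j → cong (λ c → if c then 0ℚ else 1ℚ) (meets-group (MGLInstance.G I j) P))))
    ; query-cost   = groupQueryT-cost
    }

  module _ {n : ℕ} where

    open import Data.List.Membership.DecPropositional (_≟_ {suc n}) using (_∈?_)

    -- The sum over all vertices differs from that over the non-root nodes by the term of the root,
    -- which vanishes because `P` contains the root.
    path-reward : ∀ (P vs : List (Vertex n)) → root ∈ P →
      sum (λ v → if does (v ∈? vs) then vertexReward P v else 0ℚ) ≡
      sum (λ (j : Fin n) → if does (any? (_≟ suc j) vs) then (if does (any? (_≟ suc j) P) then 0ℚ else 1ℚ) else 0ℚ)
    path-reward P vs root∈ = trans (cong₂ _+_ root-reward (sum-cong pointwise)) (+-identityˡ _)
      where
      root-reward : (if does (root ∈? vs) then vertexReward P root else 0ℚ) ≡ 0ℚ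
      root-reward rewrite dec-true (root ∈? P) root∈ = if-const (does (root ∈? vs))

      pointwise : ∀ j → (if does (suc j ∈? vs) then vertexReward P (suc j) else 0ℚ) ≡
        (if does (any? (_≟ suc j) vs) then (if does (any? (_≟ suc j) P) then 0ℚ else 1ℚ) else 0ℚ)
      pointwise j = cong₂ (λ a b → if a then (if b then 0ℚ else 1ℚ) else 0ℚ) (does-∈? (suc j) vs) (does-∈? (suc j) P)

  Serving : ∀ {κ σ} (𝓟 : CoverProblem κ σ) (A : Algorithm κ treeTy) (ρ γ : ℚ) → Set
  Serving 𝓟 A ρ γ = ∀ I P B (0≤B : 0ℚ ≤ B) → root ∈ P → Σ[ T ∈ Edges (n I) ]
      Algorithm.run A (encQuery (query I P B 0≤B)) ≡ encodeTree T ×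
      Covering.Serves (d I) (C I) (C? I) (root-∉ I) ρ γ B P T
    where open CoverProblem 𝓟

  module _ {ρ γ : ℚ} where

    ML-serving : ∀ A → IsTreeApproximation ρ γ PathOrienteering A → Serving ML-problem A ρ γ
    ML-serving A approx I P B 0≤B root∈ with approx (CoverProblem.query ML-problem I P B 0≤B)
    ... | T , run≡ , tree , short , rewarding = T , run≡ , record
      { tree      = tree
      ; short     = short
      ; rewarding = λ p path le → subst₂ (λ a b → a ≤ ρ * b) (path-reward P (root ∷ p) root∈) (path-reward P (spanned T) root∈)
                      (rewarding p path le)
      }

    MGL-serving : ∀ A → IsTreeApproximation ρ γ GroupOrienteering A → Serving MGL-problem A ρ γ
    MGL-serving A approx I P B 0≤B root∈ with approx (CoverProblem.query MGL-problem I P B 0≤B)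
    ... | T , run≡ , tree , short , rewarding = T , run≡ , record { tree = tree ; short = short ; rewarding = rewarding }

    module _ (1≤ρ : 1ℚ ≤ ρ) (1≤γ : 1ℚ ≤ γ) {K : ℕ} (K-lower : 2ℚ * ρ ≤ natℚ K) (K-upper : natℚ K ≤ 2ℚ * (2ℚ * ρ)) where

      ML-approximation : ∀ A → IsTreeApproximation ρ γ PathOrienteering A →
        IsApproximation (36ℚ * (ρ * γ)) ML (Reduce.reduction ML-problem K ⟨ A ⟩)
      ML-approximation A approx I = (λ _ → path)
          , (λ { [] → encodes , (proj₁ feasible , λ j → Any.map sym (proj₂ feasible j)) })
          , λ q f → ratio q (proj₁ f , λ j → Any.map sym (proj₂ f j))
        where
        open Reduce.Run ML-problem K A ρ γ (ML-serving A approx)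
        open Approximates (approximates 1≤ρ 1≤γ K-lower K-upper I)

      MGL-approximation : ∀ A → IsTreeApproximation ρ γ GroupOrienteering A →
        IsApproximation (36ℚ * (ρ * γ)) MGL (Reduce.reduction MGL-problem K ⟨ A ⟩)
      MGL-approximation A approx I = (λ _ → path) , (λ { [] → encodes , feasible }) , ratio
        where
        open Reduce.Run MGL-problem K A ρ γ (MGL-serving A approx)
        open Approximates (approximates 1≤ρ 1≤γ K-lower K-upper I)

    ML-time : ∀ A K → IsTreeApproximation ρ γ PathOrienteering A → PolyTime (OrienteeringProblem.encode PathOrienteering) A →
      RandomizedPolyTime (LatencyProblem.encode ML) (Reduce.reduction ML-problem K ⟨ A ⟩)
    ML-time A K approx poly = proj₁ bounded , λ I ω → proj₂ bounded (I , toList ω)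
      where bounded = Reduce.Run.time-bounded ML-problem K A ρ γ (ML-serving A approx) poly

    MGL-time : ∀ A K → IsTreeApproximation ρ γ GroupOrienteering A → PolyTime (OrienteeringProblem.encode GroupOrienteering) A →
      RandomizedPolyTime (LatencyProblem.encode MGL) (Reduce.reduction MGL-problem K ⟨ A ⟩)
    MGL-time A K approx poly = proj₁ bounded , λ I ω → proj₂ bounded (I , toList ω)
      where bounded = Reduce.Run.time-bounded MGL-problem K A ρ γ (MGL-serving A approx) poly

open import Data.Product using (Σ-syntax; _×_; _,_)
open import Data.Rational using (ℚ; 1ℚ; _≤_; _*_)
open Latency using (36ℚ)
open Scales using (calls)
open GenericReduction using (module Reduce)
open Instances

mainTheorem13 : (Σ[ C ∈ ℚ ] (∀ (ρ γ : ℚ) → 1ℚ ≤ ρ → 1ℚ ≤ γ →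
    Σ[ R ∈ LatencyReduction PathOrienteering ML ]
    (∀ (A : TreeAlgorithm PathOrienteering) → IsTreeApproximation ρ γ PathOrienteering A →
    IsApproximation (C * (ρ * γ)) ML (R ⟨ A ⟩)
    × (PolyTime (OrienteeringProblem.encode PathOrienteering) A →
    RandomizedPolyTime (LatencyProblem.encode ML) (R ⟨ A ⟩)))))
    × (Σ[ C ∈ ℚ ] (∀ (ρ γ : ℚ) → 1ℚ ≤ ρ → 1ℚ ≤ γ →
    Σ[ R ∈ LatencyReduction GroupOrienteering MGL ]
    (∀ (A : TreeAlgorithm GroupOrienteering) → IsTreeApproximation ρ γ GroupOrienteering A →
    IsApproximation (C * (ρ * γ)) MGL (R ⟨ A ⟩)
    × (PolyTime (OrienteeringProblem.encode GroupOrienteering) A →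
    RandomizedPolyTime (LatencyProblem.encode MGL) (R ⟨ A ⟩)))))
mainTheorem13 =
  -- `K` is found from `ρ` alone, so the reduction is fixed before the algorithm `A` is given.
  (36ℚ , λ ρ γ 1≤ρ 1≤γ → let (K , lower , upper) = calls 1≤ρ in Reduce.reduction ML-problem K ,
    λ A approx → ML-approximation {ρ} {γ} 1≤ρ 1≤γ lower upper A approx , ML-time {ρ} {γ} A K approx) ,
  (36ℚ , λ ρ γ 1≤ρ 1≤γ → let (K , lower , upper) = calls 1≤ρ in Reduce.reduction MGL-problem K ,
    λ A approx → MGL-approximation {ρ} {γ} 1≤ρ 1≤γ lower upper A approx , MGL-time {ρ} {γ} A K approx)
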